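{- Let $\lambda:\mathbb N\to\mathbb N$ be any function with $\lambda(n)\to\infty$, let $\delta(n)\to0$ as $n\to\infty$, and let $\gamma>0$. If $\mathcal D$ is a $\lambda$-well-behaved (feasible) degree sequence of length $n$ with $R_{\mathcal D}\le\delta(n)M_{\mathcal D}$, then the probability that $H(\mathcal D)$ has a component of size at least $\gamma M_{\mathcal D}$ is $o(1)$ (as $n\to\infty$, uniformly in such $\mathcal D$).
   Context: A degree sequence $\mathcal D=(d_1,\dots,d_n)$ consists of positive integers (no zero entries) and is feasible if realizable by a simple graph; $G(\mathcal D)$ is a uniformly random simple graph on $\{1,\dots,n\}$ with vertex $i$ of degree $d_i$. With $\pi$ a permutation such that $d_{\pi_1}\le\dots\le d_{\pi_n}$, let $j_{\mathcal D}=\min\big(\{j\in[n]:\sum_{i=1}^j d_{\pi_i}(d_{\pi_i}-2)>0\}\cup\{n\}\big)$, $R_{\mathcal D}=\sum_{i=j_{\mathcal D}}^n d_{\pi_i}$, $M_{\mathcal D}=\sum_{i:d_i\ne2}d_i$; $\mathcal D$ is $\lambda$-well-behaved if $M_{\mathcal D}\ge\lambda(n)$. $H(\mathcal D)$ is the multigraph obtained from $G(\mathcal D)$ by deleting all components that are cycles and then suppressing every vertex of degree 2 (deleting it and joining its two neighbours by an edge, possibly creating loops and multiple edges). The size of a component is its number of edges. -}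

module Defs where

open import Data.Bool using (Bool; true; false; if_then_else_; _∧_; _∨_; not; T)
open import Data.Nat using (ℕ; zero; suc; _+_; _*_; _∸_; _≤_; _<_; _≡ᵇ_; _<ᵇ_)
open import Data.Nat.Properties using (≤-decTotalOrder)
open import Data.Fin using (Fin; toℕ)
open import Data.Product using (_×_; _,_; proj₁; proj₂)
open import Data.List using (List; []; _∷_; map; concatMap; filterᵇ; length; allFin; drop; foldr; _++_)
open import Data.Nat.ListAction using (sum)
open import Data.Bool.ListAction using (all; any)
open import Data.Maybe using (Maybe; just; nothing; maybe′)
open import Data.Integer as ℤ using (ℤ; +_; -_)
open import Data.Integer.Properties as ℤP using ()
open import Relation.Nullary.Decidable using (⌊_⌋)
open import Relation.Binary.PropositionalEquality using (_≡_)
open import Data.Rational as ℚ using (ℚ; _/_)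
import Data.List.Sort as Sort

ℕtoℚ : ℕ → ℚ
ℕtoℚ n = (+ n) / 1

DegSeq : ℕ → Set
DegSeq n = Fin n → ℕ

toListD : ∀ {n} → DegSeq n → List ℕ
toListD {n} D = map D (allFin n)

sortedD : ∀ {n} → DegSeq n → List ℕ
sortedD D = Sort.sort ≤-decTotalOrder (toListD D)

firstPos : ℤ → ℕ → List ℕ → Maybe ℕ
firstPos acc k [] = nothing
firstPos acc k (d ∷ ds) =
  let acc′ = acc ℤ.+ ((+ d) ℤ.* ((+ d) ℤ.- (+ 2))) in
  if ⌊ (+ 0) ℤP.<? acc′ ⌋ then just (suc k) else firstPos acc′ (suc k) ds

jD : ∀ {n} → DegSeq n → ℕ
jD {n} D = maybe′ (λ j → j) n (firstPos (+ 0) 0 (sortedD D))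

RD : ∀ {n} → DegSeq n → ℕ
RD D = sum (drop (jD D ∸ 1) (sortedD D))

MD : ∀ {n} → DegSeq n → ℕ
MD D = sum (filterᵇ (λ d → not (d ≡ᵇ 2)) (toListD D))

Positive : ∀ {n} → DegSeq n → Set
Positive {n} D = ∀ i → 1 ≤ D i

WellBehaved : (ℕ → ℕ) → ∀ {n} → DegSeq n → Set
WellBehaved lam {n} D = lam n ≤ MD D

-- (Multi)graphs on vertex set Fin n as lists of edges (pairs of endpoints).
Edge : ℕ → Set
Edge n = Fin n × Fin n

_=ᶠ_ : ∀ {n} → Fin n → Fin n → Bool
i =ᶠ j = toℕ i ≡ᵇ toℕ j

pairs : ∀ n → List (Edge n)
pairs n = concatMap (λ i → map (λ j → (i , j)) (filterᵇ (λ j → toℕ i <ᵇ toℕ j) (allFin n))) (allFin n)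

subsets : ∀ {A : Set} → List A → List (List A)
subsets [] = [] ∷ []
subsets (x ∷ xs) = let r = subsets xs in map (x ∷_) r ++ r

-- multigraph degree (a loop contributes 2)
deg : ∀ {n} → List (Edge n) → Fin n → ℕ
deg es v = sum (map (λ e → (if proj₁ e =ᶠ v then 1 else 0) + (if proj₂ e =ᶠ v then 1 else 0)) es)

realisations : ∀ {n} → DegSeq n → List (List (Edge n))
realisations {n} D = filterᵇ (λ es → all (λ v → deg es v ≡ᵇ D v) (allFin n)) (subsets (pairs n))

Feasible : ∀ {n} → DegSeq n → Set
Feasible D = 0 < length (realisations D)

stepReach : ∀ {n} → List (Edge n) → (Fin n → Bool) → Fin n → Bool
stepReach es S u = S u ∨ any (λ e → (S (proj₁ e) ∧ (proj₂ e =ᶠ u)) ∨ (S (proj₂ e) ∧ (proj₁ e =ᶠ u))) es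

iter : ∀ {A : Set} → ℕ → (A → A) → A → A
iter zero f x = x
iter (suc k) f x = f (iter k f x)

-- vertex set of the connected component of v (paths have < n edges,
-- so n closure steps suffice)
component : ∀ {n} → List (Edge n) → Fin n → Fin n → Bool
component {n} es v = iter n (stepReach es) (λ u → u =ᶠ v)

-- v lies in a component of G which is a cycle (a connected 2-regular
-- finite simple graph is exactly a cycle)
inCycleComp : ∀ {n} → List (Edge n) → Fin n → Bool
inCycleComp {n} es v = all (λ u → not (component es v u) ∨ (deg es u ≡ᵇ 2)) (allFin n)

incident : ∀ {n} → Fin n → Edge n → Bool
incident v e = (proj₁ e =ᶠ v) ∨ (proj₂ e =ᶠ v)

other : ∀ {n} → Fin n → Edge n → Fin n
other v e = if proj₁ e =ᶠ v then proj₂ e else proj₁ e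

-- suppress v if it has degree 2 (not via a loop): delete v and join
-- its two neighbours by an edge (possibly a loop / parallel edge)
suppress : ∀ {n} → Fin n → List (Edge n) → List (Edge n)
suppress v es with filterᵇ (incident v) es
... | e₁ ∷ e₂ ∷ [] = (other v e₁ , other v e₂) ∷ filterᵇ (λ e → not (incident v e)) es
... | _ = es

isVertexH : ∀ {n} → List (Edge n) → Fin n → Bool
isVertexH es v = not (inCycleComp es v) ∧ not (deg es v ≡ᵇ 2)

edgesH : ∀ {n} → List (Edge n) → List (Edge n)
edgesH {n} es =
  foldr (λ v acc → if deg es v ≡ᵇ 2 then suppress v acc else acc)
        (filterᵇ (λ e → not (inCycleComp es (proj₁ e))) es)
        (allFin n)

compSizeH : ∀ {n} → List (Edge n) → Fin n → ℕ
compSizeH es v = let h = edgesH es in length (filterᵇ (λ e → component h v (proj₁ e)) h)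

hasBigComp : ∀ {n} → ℚ → ℕ → List (Edge n) → Bool
hasBigComp {n} γ M es =
  any (λ v → isVertexH es v ∧ ((γ ℚ.* ℕtoℚ M) ℚ.≤ᵇ ℕtoℚ (compSizeH es v))) (allFin n)

-- number of realisations G of D for which H(G) has a component of size
-- ≥ γ·M_D; the probability of this event in G(D) is
-- badCount γ D / length (realisations D)
badCount : ∀ {n} → ℚ → DegSeq n → ℕ
badCount γ D = length (filterᵇ (hasBigComp γ (MD D)) (realisations D))

{-# OPTIONS --safe #-}
module Submission where

-- Write M for the sum of the degrees other than 2 and call an edge with a direction a dart. For a random realisation let
-- ρ k be the fraction of the M darts with tail of degree ≠ 2 along which a path passes more than k vertices of degree ≠ 2
-- or meets a vertex of degree above a large constant t. If H(D) has a component with γ M edges and M is large, then a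
-- fraction γ of the darts survives in this sense on one of their two sides, so it suffices that ρ k becomes small.
--
-- Switching two darts ux, ay into uy, ax disturbs only few of the explored paths, since these have bounded length in H(D)
-- and bounded degrees. This makes survival along a dart nearly independent of the degree of its tail and of
-- survival on its other side. The choice of j_D gives ∑ d (d - 1) ≤ M + t R over the degrees 3 ≤ d ≤ t and
-- ∑ d ≤ R + M / (t - 1) over the degrees d > t. Counting, at each vertex, the darts beside a surviving dart then yields
--   ρ (k + 1) + ρ (k + 1)² / 2 ≤ ρ k + o(1),
-- where the square stems from vertices with two surviving darts. Summing over k < K bounds K ρ(K)² by 2 + o(1).

open import Defs
open import Data.Nat as ℕ using (ℕ)
open import Data.Product using (Σ; ∃; _×_)
open import Data.List using (length)

-- Two obstacles shape the argument. Vertices of degree 2 may outnumber all others, so every bound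
-- is measured against M and never against n: switched darts start at vertices of degree other than
-- 2, and explorations count only such vertices. Moreover R is small only relative to M, so the mean
-- number of onward darts may be 1 up to o(1), and a subcritical branching argument does not apply.
-- The decay comes from the loss at vertices where two darts survive; up to errors, their number is
-- bounded below by the square of a mean over the realisations, through Cauchy-Schwarz. There are
-- two cutoffs because the degrees above t₂ enter the switching error multiplied by t. Hence t₂ has
-- to be large compared with t, whereas an exploration has to stop at t already to keep its mass
-- bounded. Probabilities are replaced by sums over all realisations in natural numbers: if there
-- are N of them, ρ k is the sum of `X` over the realisations, divided by N M.

module Counting where
  open import Data.Bool using (Bool; true; false; if_then_else_; _∧_; _∨_; not; T; _xor_)
  open import Data.Bool.ListAction using (all; any)
  open import Data.Bool.Properties using (T?; T-≡) renaming (_≟_ to _≟B_)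
  open import Data.Empty using (⊥; ⊥-elim)
  open import Data.Fin using (Fin; toℕ)
  open import Data.Fin.Properties using (toℕ-injective; any?) renaming (_≟_ to _≟F_)
  import Data.Integer as ℤ
  import Data.Integer.Properties as ℤP
  import Data.Integer.Tactic.RingSolver as ℤR
  open import Data.List using (List; []; _∷_; _++_; map; concatMap; foldr; take; drop; filterᵇ; allFin)
  open import Data.List.Membership.Propositional using (_∈_; _∉_)
  open import Data.List.Membership.Propositional.Properties using (∈-allFin; ∈-∃++; ∈-++⁻; ∈-++⁺ˡ; ∈-++⁺ʳ; ∈-map⁻; ∈-map⁺; ∈-filter⁻; ∈-filter⁺)
  import Data.List.Membership.DecPropositional as DecMem
  open import Data.List.Properties using (∷-injectiveʳ; length-tabulate; map-∘; map-id; take++drop≡id)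
  import Data.List.Relation.Binary.Permutation.Propositional.Properties as ↭
  open import Data.List.Relation.Unary.All as All using ([]; _∷_)
  open import Data.List.Relation.Unary.AllPairs using ([]; _∷_)
  open import Data.List.Relation.Unary.Any using (here; there)
  open import Data.List.Relation.Unary.Unique.Propositional using (Unique)
  open import Data.List.Relation.Unary.Unique.Propositional.Properties using (allFin⁺; map⁺; ++⁺; filter⁺)
  import Data.List.Sort as Sort
  open import Data.Maybe using (just; nothing; maybe′)
  open import Data.Nat using (zero; suc; _+_; _*_; _∸_; _≤_; _<_; z≤n; s≤s; _≡ᵇ_; _<ᵇ_; _<?_; _≤?_) renaming (_≟_ to _≟ℕ_)
  open import Data.Nat.ListAction using (sum)
  open import Data.Nat.ListAction.Properties using (sum-↭)
  open import Data.Nat.Properties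
  open import Data.Nat.Tactic.RingSolver using (solve-∀)
  open import Data.Product using (_,_; proj₁; proj₂)
  open import Data.Sum using (_⊎_; inj₁; inj₂)
  open import Function using (_∘_; id; Equivalence)
  open import Relation.Binary using (tri<; tri≈; tri>)
  open import Relation.Binary.Construct.Closure.ReflexiveTransitive using (Star; ε; _◅_; _◅◅_; reverse)
  open import Relation.Binary.PropositionalEquality
  open import Relation.Nullary using (¬_; Dec; yes; no)
  open import Relation.Nullary.Decidable using (⌊_⌋; toWitness; fromWitness; _×-dec_)

  -- Finite sums over lists

  module FiniteSums where
    𝟙 : Bool → ℕ
    𝟙 b = if b then 1 else 0

    ∑ : ∀ {A : Set} → List A → (A → ℕ) → ℕ
    ∑ L f = sum (map f L)

    private variable
      A B : Set

    interchange : ∀ a b c d → (a + b) + (c + d) ≡ (a + c) + (b + d)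
    interchange = solve-∀

    ∑-mono : (L : List A) {f g : A → ℕ} → (∀ {x} → x ∈ L → f x ≤ g x) → ∑ L f ≤ ∑ L g
    ∑-mono [] h = z≤n
    ∑-mono (x ∷ L) h = +-mono-≤ (h (here refl)) (∑-mono L (h ∘ there))

    ∑-cong : (L : List A) {f g : A → ℕ} → (∀ x → f x ≡ g x) → ∑ L f ≡ ∑ L g
    ∑-cong [] h = refl
    ∑-cong (x ∷ L) h = cong₂ _+_ (h x) (∑-cong L h)

    ∑-cong∈ : (L : List A) {f g : A → ℕ} → (∀ {x} → x ∈ L → f x ≡ g x) → ∑ L f ≡ ∑ L g
    ∑-cong∈ [] h = refl
    ∑-cong∈ (x ∷ L) h = cong₂ _+_ (h (here refl)) (∑-cong∈ L (h ∘ there))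

    ∑-+ : (L : List A) (f g : A → ℕ) → ∑ L (λ x → f x + g x) ≡ ∑ L f + ∑ L g
    ∑-+ [] f g = refl
    ∑-+ (x ∷ L) f g = trans (cong (f x + g x +_) (∑-+ L f g)) (interchange (f x) (g x) (∑ L f) (∑ L g))

    ∑-*ˡ : (L : List A) (c : ℕ) (f : A → ℕ) → ∑ L (λ x → c * f x) ≡ c * ∑ L f
    ∑-*ˡ [] c f = sym (*-zeroʳ c)
    ∑-*ˡ (x ∷ L) c f = trans (cong (c * f x +_) (∑-*ˡ L c f)) (sym (*-distribˡ-+ c (f x) (∑ L f)))

    ∑-*ʳ : (L : List A) (c : ℕ) (f : A → ℕ) → ∑ L (λ x → f x * c) ≡ ∑ L f * c
    ∑-*ʳ L c f = trans (∑-cong L (λ x → *-comm (f x) c)) (trans (∑-*ˡ L c f) (*-comm c (∑ L f)))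

    ∑-0 : (L : List A) → ∑ L (λ _ → 0) ≡ 0
    ∑-0 [] = refl
    ∑-0 (x ∷ L) = ∑-0 L

    ∑-const : (L : List A) (c : ℕ) → ∑ L (λ _ → c) ≡ length L * c
    ∑-const [] c = refl
    ∑-const (x ∷ L) c = cong (c +_) (∑-const L c)

    ∑-swap : (L : List A) (K : List B) (f : A → B → ℕ) → ∑ L (λ x → ∑ K (f x)) ≡ ∑ K (λ y → ∑ L (λ x → f x y))
    ∑-swap [] K f = sym (∑-0 K)
    ∑-swap (x ∷ L) K f = trans (cong (∑ K (f x) +_) (∑-swap L K f)) (sym (∑-+ K (f x) _))

    ∑-++ : (L K : List A) (f : A → ℕ) → ∑ (L ++ K) f ≡ ∑ L f + ∑ K f
    ∑-++ [] K f = refl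
    ∑-++ (x ∷ L) K f = trans (cong (f x +_) (∑-++ L K f)) (sym (+-assoc (f x) _ _))

    ∑-term : {L : List A} (f : A → ℕ) {x : A} → x ∈ L → f x ≤ ∑ L f
    ∑-term f (here refl) = m≤m+n _ _
    ∑-term f (there {x = y} p) = ≤-trans (∑-term f p) (m≤n+m _ (f y))

    ∑-pos : (L : List A) (f : A → ℕ) → 1 ≤ ∑ L f → ∃ λ x → x ∈ L × 1 ≤ f x
    ∑-pos (x ∷ L) f p with f x in eq
    ... | suc _ = x , here refl , subst (1 ≤_) (sym eq) (s≤s z≤n)
    ... | zero with ∑-pos L f p
    ...   | y , y∈ , q = y , there y∈ , q

    -- Cauchy–Schwarz against the constant function 1.
    ∑-square : (L : List A) (f : A → ℕ) → ∑ L f * ∑ L f ≤ length L * ∑ L (λ x → f x * f x)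
    ∑-square [] f = z≤n
    ∑-square (x ∷ L) f = begin
      (a + s) * (a + s)                     ≡⟨ expand a s ⟩
      a * a + (2 * a * s + s * s)           ≤⟨ +-monoʳ-≤ (a * a) (+-mono-≤ cross (∑-square L f)) ⟩
      a * a + (l * (a * a) + q + l * q)     ≡⟨ collect (a * a) l q ⟩
      suc l * (a * a + q)                   ∎
      where
      open ≤-Reasoning
      a = f x
      s = ∑ L f
      l = length L
      q = ∑ L (λ y → f y * f y)
      expand : ∀ a s → (a + s) * (a + s) ≡ a * a + (2 * a * s + s * s)
      expand = solve-∀
      collect : ∀ b l q → b + (l * b + q + l * q) ≡ suc l * (b + q)
      collect = solve-∀
      two : ∀ a b → 2 * a * b ≤ a * a + b * b
      two a b with ≤-total a b
      ... | inj₁ a≤b with m≤n⇒∃[o]m+o≡n a≤b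
      ...   | o , refl = subst (2 * a * (a + o) ≤_) (e a o) (m≤m+n _ (o * o))
        where e : ∀ a o → 2 * a * (a + o) + o * o ≡ a * a + (a + o) * (a + o)
              e = solve-∀
      two a b | inj₂ b≤a with m≤n⇒∃[o]m+o≡n b≤a
      ... | o , refl = subst (2 * (b + o) * b ≤_) (e b o) (m≤m+n _ (o * o))
        where e : ∀ b o → 2 * (b + o) * b + o * o ≡ (b + o) * (b + o) + b * b
              e = solve-∀
      cross : 2 * a * s ≤ l * (a * a) + q
      cross = begin
        2 * a * s                         ≡⟨ ∑-*ˡ L (2 * a) f ⟨
        ∑ L (λ y → 2 * a * f y)           ≤⟨ ∑-mono L (λ {y} _ → two a (f y)) ⟩
        ∑ L (λ y → a * a + f y * f y)     ≡⟨ ∑-+ L (λ _ → a * a) (λ y → f y * f y) ⟩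
        ∑ L (λ _ → a * a) + q             ≡⟨ cong (_+ q) (∑-const L (a * a)) ⟩
        l * (a * a) + q                   ∎

    ∑-unique-⊆ : (xs ys : List A) (f : A → ℕ) → Unique xs → (∀ {x} → x ∈ xs → x ∈ ys) → ∑ xs f ≤ ∑ ys f
    ∑-unique-⊆ [] ys f u s = z≤n
    ∑-unique-⊆ (x ∷ xs) ys f (x∉ ∷ u) s with ∈-∃++ (s (here refl))
    ... | ps , qs , refl = begin
      f x + ∑ xs f                ≤⟨ +-monoʳ-≤ (f x) (∑-unique-⊆ xs (ps ++ qs) f u s′) ⟩
      f x + ∑ (ps ++ qs) f        ≡⟨ cong (f x +_) (∑-++ ps qs f) ⟩
      f x + (∑ ps f + ∑ qs f)     ≡⟨ move (f x) (∑ ps f) (∑ qs f) ⟩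
      ∑ ps f + (f x + ∑ qs f)     ≡⟨ ∑-++ ps (x ∷ qs) f ⟨
      ∑ (ps ++ x ∷ qs) f          ∎
      where
      open ≤-Reasoning
      move : ∀ a b c → a + (b + c) ≡ b + (a + c)
      move = solve-∀
      s′ : ∀ {y} → y ∈ xs → y ∈ ps ++ qs
      s′ {y} y∈ with ∈-++⁻ ps (s (there y∈))
      ... | inj₁ p = ∈-++⁺ˡ p
      ... | inj₂ (here refl) = ⊥-elim (All.lookup x∉ y∈ refl)
      ... | inj₂ (there q) = ∈-++⁺ʳ ps q

    unique-length : ∀ {n} (xs : List (Fin n)) → Unique xs → length xs ≤ n
    unique-length {n} xs u = begin
      length xs                ≡⟨ *-identityʳ _ ⟨
      length xs * 1            ≡⟨ ∑-const xs 1 ⟨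
      ∑ xs (λ _ → 1)           ≤⟨ ∑-unique-⊆ xs (allFin n) (λ _ → 1) u (λ _ → ∈-allFin _) ⟩
      ∑ (allFin n) (λ _ → 1)   ≡⟨ ∑-const (allFin n) 1 ⟩
      length (allFin n) * 1    ≡⟨ *-identityʳ _ ⟩
      length (allFin n)        ≡⟨ length-tabulate (λ x → x) ⟩
      n                        ∎
      where
      open ≤-Reasoning

    map-unique : (φ : A → B) (xs : List A) → (∀ {x y} → x ∈ xs → y ∈ xs → φ x ≡ φ y → x ≡ y) → Unique xs → Unique (map φ xs)
    map-unique φ [] inj u = []
    map-unique φ (x ∷ xs) inj (x∉ ∷ u) =
      All.tabulate (λ {y} y∈ e → let z , z∈ , y≡ = ∈-map⁻ φ y∈ in
        All.lookup x∉ z∈ (inj (here refl) (there z∈) (trans e y≡)))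
      ∷ map-unique φ xs (λ p q → inj (there p) (there q)) u

    ∑-map : (φ : A → B) (xs : List A) (f : B → ℕ) → ∑ (map φ xs) f ≡ ∑ xs (f ∘ φ)
    ∑-map φ xs f = cong sum (sym (map-∘ xs))

    ∑-injection : (φ : A → B) (xs : List A) (ys : List B) (f : B → ℕ) → Unique xs
      → (∀ {x y} → x ∈ xs → y ∈ xs → φ x ≡ φ y → x ≡ y) → (∀ {x} → x ∈ xs → φ x ∈ ys)
      → ∑ xs (f ∘ φ) ≤ ∑ ys f
    ∑-injection φ xs ys f u inj into = begin
      ∑ xs (f ∘ φ)      ≡⟨ ∑-map φ xs f ⟨
      ∑ (map φ xs) f    ≤⟨ ∑-unique-⊆ (map φ xs) ys f (map-unique φ xs inj u)
                             (λ y∈ → let z , z∈ , e = ∈-map⁻ φ y∈ in subst (_∈ ys) (sym e) (into z∈)) ⟩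
      ∑ ys f            ∎
      where open ≤-Reasoning

    ∑-filter : (p : A → Bool) (L : List A) (f : A → ℕ) → ∑ (filterᵇ p L) f ≡ ∑ L (λ x → 𝟙 (p x) * f x)
    ∑-filter p [] f = refl
    ∑-filter p (x ∷ L) f with p x
    ... | true = cong₂ _+_ (sym (+-identityʳ (f x))) (∑-filter p L f)
    ... | false = ∑-filter p L f

    ∑-count : (p : A → Bool) (L : List A) → ∑ L (𝟙 ∘ p) ≡ length (filterᵇ p L)
    ∑-count p [] = refl
    ∑-count p (x ∷ L) with p x
    ... | true = cong suc (∑-count p L)
    ... | false = ∑-count p L

  open FiniteSums public

  -- Edge lists and realisations

  T⇒≡ : ∀ {b} → T b → b ≡ true
  T⇒≡ = Equivalence.to T-≡

  ≡⇒T : ∀ {b} → b ≡ true → T b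
  ≡⇒T = Equivalence.from T-≡

  ∧⁻ : ∀ {a b} → a ∧ b ≡ true → a ≡ true × b ≡ true
  ∧⁻ {true} {true} _ = refl , refl

  ∨⁻ : ∀ {a b} → a ∨ b ≡ true → a ≡ true ⊎ b ≡ true
  ∨⁻ {true} _ = inj₁ refl
  ∨⁻ {false} e = inj₂ e

  ∨⁺ˡ : ∀ {a b} → a ≡ true → a ∨ b ≡ true
  ∨⁺ˡ refl = refl

  ∨⁺ʳ : ∀ a {b} → b ≡ true → a ∨ b ≡ true
  ∨⁺ʳ true e = refl
  ∨⁺ʳ false e = e

  not⁻ : ∀ {b} → not b ≡ true → b ≡ false
  not⁻ {false} _ = refl

  false≢true : ∀ {b} → b ≡ false → b ≡ true → ⊥
  false≢true refl ()

  ≢true⇒false : ∀ {b} → ¬ (b ≡ true) → b ≡ false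
  ≢true⇒false {true} h = ⊥-elim (h refl)
  ≢true⇒false {false} h = refl

  bool-cases : ∀ b → b ≡ true ⊎ b ≡ false
  bool-cases true = inj₁ refl
  bool-cases false = inj₂ refl

  bool-ext : ∀ {a b} → (a ≡ true → b ≡ true) → (b ≡ true → a ≡ true) → a ≡ b
  bool-ext {true} {b} f g = sym (f refl)
  bool-ext {false} {true} f g = g refl
  bool-ext {false} {false} f g = refl

  any⁻ : ∀ {A : Set} (p : A → Bool) xs → any p xs ≡ true → ∃ λ x → x ∈ xs × p x ≡ true
  any⁻ p (x ∷ xs) e with p x in eq
  ... | true = x , here refl , eq
  ... | false with any⁻ p xs e
  ...   | y , y∈ , q = y , there y∈ , q

  any⁺ : ∀ {A : Set} (p : A → Bool) {xs x} → x ∈ xs → p x ≡ true → any p xs ≡ true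
  any⁺ p (here refl) e rewrite e = refl
  any⁺ p {y ∷ _} (there q) e = ∨⁺ʳ (p y) (any⁺ p q e)

  all⁻ : ∀ {A : Set} (p : A → Bool) {xs x} → all p xs ≡ true → x ∈ xs → p x ≡ true
  all⁻ p e (here refl) = proj₁ (∧⁻ e)
  all⁻ p e (there q) = all⁻ p (proj₂ (∧⁻ e)) q

  all⁺ : ∀ {A : Set} (p : A → Bool) xs → (∀ {x} → x ∈ xs → p x ≡ true) → all p xs ≡ true
  all⁺ p [] h = refl
  all⁺ p (x ∷ xs) h rewrite h (here refl) = all⁺ p xs (h ∘ there)

  ∈-filterᵇ⁻ : ∀ {A : Set} (p : A → Bool) {x xs} → x ∈ filterᵇ p xs → x ∈ xs × p x ≡ true
  ∈-filterᵇ⁻ p m = let a , b = ∈-filter⁻ (T? ∘ p) m in a , T⇒≡ b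

  ∈-filterᵇ⁺ : ∀ {A : Set} (p : A → Bool) {x xs} → x ∈ xs → p x ≡ true → x ∈ filterᵇ p xs
  ∈-filterᵇ⁺ p m e = ∈-filter⁺ (T? ∘ p) m (≡⇒T e)

  module _ {n : ℕ} where
    =ᶠ⇒≡ : {i j : Fin n} → (i =ᶠ j) ≡ true → i ≡ j
    =ᶠ⇒≡ e = toℕ-injective (≡ᵇ⇒≡ _ _ (≡⇒T e))

    =ᶠ-refl : (i : Fin n) → (i =ᶠ i) ≡ true
    =ᶠ-refl i = T⇒≡ (≡⇒≡ᵇ (toℕ i) _ refl)

    ≢⇒=ᶠ : {i j : Fin n} → i ≢ j → (i =ᶠ j) ≡ false
    ≢⇒=ᶠ h = ≢true⇒false (h ∘ =ᶠ⇒≡)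

    δ : Fin n → Fin n → ℕ
    δ i j = 𝟙 (i =ᶠ j)

    δ-refl : ∀ i → δ i i ≡ 1
    δ-refl i = cong 𝟙 (=ᶠ-refl i)

    δ-≢ : ∀ {i j} → i ≢ j → δ i j ≡ 0
    δ-≢ h = cong 𝟙 (≢⇒=ᶠ h)

    δ-sym : ∀ i j → δ i j ≡ δ j i
    δ-sym i j with i ≟F j
    ... | yes refl = refl
    ... | no h = trans (δ-≢ h) (sym (δ-≢ (h ∘ sym)))

  ∑-δ : ∀ {n} (i : Fin n) (L : List (Fin n)) (f : Fin n → ℕ) → Unique L → i ∈ L → ∑ L (λ j → δ i j * f j) ≡ f i
  ∑-δ i (j ∷ L) f (j∉ ∷ u) (here refl) rewrite δ-refl i = trans (cong₂ _+_ (+-identityʳ (f i)) zero′) (+-identityʳ (f i))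
    where
    zero′ : ∑ L (λ j → δ i j * f j) ≡ 0
    zero′ = trans (∑-cong∈ L (λ {k} k∈ → cong (_* f k) (δ-≢ (All.lookup j∉ k∈)))) (∑-0 L)
  ∑-δ i (j ∷ L) f (j∉ ∷ u) (there i∈) rewrite δ-≢ {i = i} {j} (λ e → All.lookup j∉ i∈ (sym e)) = ∑-δ i L f u i∈

  ∑-δ-all : ∀ {n} (i : Fin n) → ∑ (allFin n) (δ i) ≡ 1
  ∑-δ-all {n} i = trans (∑-cong (allFin n) (λ j → sym (*-identityʳ (δ i j)))) (∑-δ i (allFin n) (λ _ → 1) (allFin⁺ n) (∈-allFin i))

  module _ {A : Set} where
    filter∈subsets : (p : A → Bool) (L : List A) → filterᵇ p L ∈ subsets L
    filter∈subsets p [] = here refl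
    filter∈subsets p (x ∷ L) with p x
    ... | true = ∈-++⁺ˡ (∈-map⁺ (x ∷_) (filter∈subsets p L))
    ... | false = ∈-++⁺ʳ _ (filter∈subsets p L)

    subsets-∷⁻ : ∀ {x : A} {L s} → s ∈ subsets (x ∷ L) → (∃ λ s′ → s′ ∈ subsets L × s ≡ x ∷ s′) ⊎ s ∈ subsets L
    subsets-∷⁻ {x} {L} s∈ with ∈-++⁻ (map (x ∷_) (subsets L)) s∈
    ... | inj₁ q = inj₁ (∈-map⁻ (x ∷_) q)
    ... | inj₂ q = inj₂ q

    subsets-⊆ : ∀ {L s} {e : A} → s ∈ subsets L → e ∈ s → e ∈ L
    subsets-⊆ {[]} (here refl) ()
    subsets-⊆ {x ∷ L} s∈ e∈ with subsets-∷⁻ {x} {L} s∈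
    ... | inj₂ q = there (subsets-⊆ q e∈)
    subsets-⊆ {x ∷ L} s∈ (here refl) | inj₁ (s′ , q , refl) = here refl
    subsets-⊆ {x ∷ L} s∈ (there e∈) | inj₁ (s′ , q , refl) = there (subsets-⊆ q e∈)

    subset-unique : ∀ {L s} → Unique L → s ∈ subsets L → Unique s
    subset-unique {[]} u (here refl) = []
    subset-unique {x ∷ L} (x∉ ∷ u) s∈ with subsets-∷⁻ {x} {L} s∈
    ... | inj₁ (s′ , q , refl) = All.tabulate (λ y∈ → All.lookup x∉ (subsets-⊆ q y∈)) ∷ subset-unique u q
    ... | inj₂ q = subset-unique u q

    -- By induction on `L`: membership decides for `s` and `t` alike whether the head was chosen. A
    -- realisation is thus determined by its edge set, which makes the passage to adjacency
    -- functions injective.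
    subsets-ext : ∀ {L s t} → Unique L → s ∈ subsets L → t ∈ subsets L → (∀ {e} → e ∈ s → e ∈ t) → (∀ {e} → e ∈ t → e ∈ s) → s ≡ t
    subsets-ext {[]} u (here refl) (here refl) f g = refl
    subsets-ext {x ∷ L} (x∉ ∷ u) s∈ t∈ f g with subsets-∷⁻ {x} {L} s∈ | subsets-∷⁻ {x} {L} t∈
    ... | inj₁ (s′ , p , refl) | inj₁ (t′ , q , refl) = cong (x ∷_) (subsets-ext u p q (tl q f p) (tl p g q))
      where
      tl : ∀ {a b} → b ∈ subsets L → (∀ {e} → e ∈ x ∷ a → e ∈ x ∷ b) → a ∈ subsets L → ∀ {e} → e ∈ a → e ∈ b
      tl q f p e∈ with f (there e∈)
      ... | here refl = ⊥-elim (All.lookup x∉ (subsets-⊆ p e∈) refl)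
      ... | there m = m
    ... | inj₁ (s′ , p , refl) | inj₂ q = ⊥-elim (All.lookup x∉ (subsets-⊆ q (f (here refl))) refl)
    ... | inj₂ p | inj₁ (t′ , q , refl) = ⊥-elim (All.lookup x∉ (subsets-⊆ p (g (here refl))) refl)
    ... | inj₂ p | inj₂ q = subsets-ext u p q f g

    subsets-unique : ∀ {L : List A} → Unique L → Unique (subsets L)
    subsets-unique {[]} u = [] ∷ []
    subsets-unique {x ∷ L} (x∉ ∷ u) = ++⁺ (map⁺ ∷-injectiveʳ (subsets-unique u)) (subsets-unique u)
      λ (p , q) → let s′ , _ , e = ∈-map⁻ (x ∷_) p in
        All.lookup x∉ (subsets-⊆ q (subst (x ∈_) (sym e) (here refl))) refl

  pairs-row : ∀ {n} → Fin n → List (Edge n)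
  pairs-row {n} i = map (λ j → (i , j)) (filterᵇ (λ j → toℕ i <ᵇ toℕ j) (allFin n))

  ∈-row⁻ : ∀ {n} {i s t : Fin n} → (s , t) ∈ pairs-row i → s ≡ i × toℕ s < toℕ t
  ∈-row⁻ {n} {i} m with ∈-map⁻ (λ j → (i , j)) m
  ... | j , j∈ , refl = refl , <ᵇ⇒< _ _ (≡⇒T (proj₂ (∈-filterᵇ⁻ _ {xs = allFin n} j∈)))

  ∈-concatMap : ∀ {A B : Set} (f : A → List B) (xs : List A) {y : B} → y ∈ concatMap f xs → ∃ λ x → x ∈ xs × y ∈ f x
  ∈-concatMap f (x ∷ xs) m with ∈-++⁻ (f x) m
  ... | inj₁ p = x , here refl , p
  ... | inj₂ q with ∈-concatMap f xs q
  ...   | z , z∈ , r = z , there z∈ , r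

  ∈-concatMap′ : ∀ {A B : Set} (f : A → List B) {xs : List A} {x : A} {y : B} → x ∈ xs → y ∈ f x → y ∈ concatMap f xs
  ∈-concatMap′ f (here refl) m = ∈-++⁺ˡ m
  ∈-concatMap′ f {z ∷ _} (there p) m = ∈-++⁺ʳ (f z) (∈-concatMap′ f p m)

  ∈-pairs⁻ : ∀ {n} {s t : Fin n} → (s , t) ∈ pairs n → toℕ s < toℕ t
  ∈-pairs⁻ {n} m = let i , _ , q = ∈-concatMap pairs-row (allFin n) m in proj₂ (∈-row⁻ {i = i} q)

  ∈-pairs⁺ : ∀ {n} {s t : Fin n} → toℕ s < toℕ t → (s , t) ∈ pairs n
  ∈-pairs⁺ {n} {s} {t} lt = ∈-concatMap′ pairs-row (∈-allFin s)
    (∈-map⁺ (λ j → (s , j)) (∈-filterᵇ⁺ _ (∈-allFin t) (T⇒≡ (<⇒<ᵇ lt))))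

  pairs-unique : ∀ n → Unique (pairs n)
  pairs-unique n = go (allFin n) (allFin⁺ n)
    where
    go : (xs : List (Fin n)) → Unique xs → Unique (concatMap pairs-row xs)
    go [] u = []
    go (i ∷ xs) (i∉ ∷ u) = ++⁺ (map⁺ (cong proj₂) (filter⁺ _ (allFin⁺ n))) (go xs u)
      λ { {s , t} (p , q) → let j , j∈ , r = ∈-concatMap pairs-row xs q in
        All.lookup i∉ j∈ (trans (sym (proj₁ (∈-row⁻ {i = i} p))) (proj₁ (∈-row⁻ {i = j} r))) }

  module Switching {n : ℕ} (D : DegSeq n) where
    V : List (Fin n)
    V = allFin n

    mem : Edge n → List (Edge n) → Bool
    mem e₀ = any (λ e → (proj₁ e =ᶠ proj₁ e₀) ∧ (proj₂ e =ᶠ proj₂ e₀))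

    mem⁻ : ∀ {e₀ es} → mem e₀ es ≡ true → e₀ ∈ es
    mem⁻ {e₀} {es} p with any⁻ (λ e → (proj₁ e =ᶠ proj₁ e₀) ∧ (proj₂ e =ᶠ proj₂ e₀)) es p
    ... | (s , t) , e∈ , q with ∧⁻ {s =ᶠ proj₁ e₀} q
    ...   | q₁ , q₂ = subst₂ (λ a b → (a , b) ∈ es) (=ᶠ⇒≡ q₁) (=ᶠ⇒≡ q₂) e∈

    mem⁺ : ∀ {e₀ es} → e₀ ∈ es → mem e₀ es ≡ true
    mem⁺ {s , t} m = any⁺ _ m (cong₂ _∧_ (=ᶠ-refl s) (=ᶠ-refl t))

    -- Switchings act on symmetric Boolean functions, where exchanging edges is an exclusive or. The
    -- order and orientation of the stored edges are restored by `realise`.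
    adj : List (Edge n) → Fin n → Fin n → Bool
    adj es i j = mem (i , j) es ∨ mem (j , i) es

    adj-sym : ∀ es i j → adj es i j ≡ true → adj es j i ≡ true
    adj-sym es i j p with ∨⁻ {mem (i , j) es} p
    ... | inj₁ q = ∨⁺ʳ (mem (j , i) es) q
    ... | inj₂ q = ∨⁺ˡ q

    adj⁺ : ∀ {es e} → e ∈ es → adj es (proj₁ e) (proj₂ e) ≡ true
    adj⁺ m = ∨⁺ˡ (mem⁺ m)

    real⁻ : ∀ {es} → es ∈ realisations D → es ∈ subsets (pairs n) × (∀ v → deg es v ≡ D v)
    real⁻ {es} m = let a , b = ∈-filterᵇ⁻ _ {xs = subsets (pairs n)} m in
      a , λ v → ≡ᵇ⇒≡ _ _ (≡⇒T (all⁻ (λ v → deg es v ≡ᵇ D v) b (∈-allFin v)))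

    real⁺ : ∀ {es} → es ∈ subsets (pairs n) → (∀ v → deg es v ≡ D v) → es ∈ realisations D
    real⁺ {es} m h = ∈-filterᵇ⁺ _ m (all⁺ _ (allFin n) λ {v} _ → T⇒≡ (≡⇒≡ᵇ (deg es v) (D v) (h v)))

    realisations-unique : Unique (realisations D)
    realisations-unique = filter⁺ _ (subsets-unique (pairs-unique n))

    subset-< : ∀ {es s t} → es ∈ subsets (pairs n) → (s , t) ∈ es → toℕ s < toℕ t
    subset-< m p = ∈-pairs⁻ (subsets-⊆ m p)

    adj-irrefl : ∀ {es} → es ∈ subsets (pairs n) → ∀ v → adj es v v ≡ false
    adj-irrefl {es} m v = ≢true⇒false λ p → <-irrefl refl (subset-< m (loop (∨⁻ {mem (v , v) es} p)))
      where
      loop : mem (v , v) es ≡ true ⊎ mem (v , v) es ≡ true → (v , v) ∈ es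
      loop (inj₁ q) = mem⁻ q
      loop (inj₂ q) = mem⁻ q

    mem-∑ : ∀ {es} (e₀ : Edge n) → Unique es → 𝟙 (mem e₀ es) ≡ ∑ es (λ e → δ (proj₁ e) (proj₁ e₀) * δ (proj₂ e) (proj₂ e₀))
    mem-∑ {[]} e₀ u = refl
    mem-∑ {(s , t) ∷ es} (s₀ , t₀) (e∉ ∷ u) with s ≟F s₀ | t ≟F t₀
    ... | yes refl | yes refl rewrite =ᶠ-refl s | =ᶠ-refl t = cong suc (sym (trans
          (∑-cong∈ es λ {f} f∈ → prod0 f (λ e → All.lookup e∉ f∈ (sym e))) (∑-0 es)))
      where
      prod0 : ∀ f → f ≢ (s , t) → δ (proj₁ f) s * δ (proj₂ f) t ≡ 0
      prod0 (s′ , t′) ne with s′ ≟F s | t′ ≟F t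
      ... | yes refl | yes refl = ⊥-elim (ne refl)
      ... | no h | _ rewrite δ-≢ h = refl
      ... | yes _ | no h rewrite δ-≢ h = *-zeroʳ (δ s′ s)
    ... | no h | _ rewrite ≢⇒=ᶠ h = mem-∑ (s₀ , t₀) u
    ... | yes refl | no h rewrite =ᶠ-refl s | ≢⇒=ᶠ h = mem-∑ (s , t₀) u

    -- A stored edge points to its larger end, so a pair is stored in at most one direction and the
    -- two membership counts add up without overlap.
    deg-adj : ∀ {es} → es ∈ subsets (pairs n) → ∀ v → ∑ V (λ t → 𝟙 (adj es v t)) ≡ deg es v
    deg-adj {es} m v = begin
      ∑ V (λ t → 𝟙 (adj es v t))                                  ≡⟨ ∑-cong V split ⟩
      ∑ V (λ t → 𝟙 (mem (v , t) es) + 𝟙 (mem (t , v) es))         ≡⟨ ∑-+ V _ _ ⟩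
      ∑ V (λ t → 𝟙 (mem (v , t) es)) + ∑ V (λ t → 𝟙 (mem (t , v) es))
        ≡⟨ cong₂ _+_ (side (λ t → (v , t)) proj₁ proj₂ (λ e t → *-comm (δ (proj₁ e) v) (δ (proj₂ e) t)))
                     (side (λ t → (t , v)) proj₂ proj₁ (λ e t → refl)) ⟩
      ∑ es (λ e → δ (proj₁ e) v) + ∑ es (λ e → δ (proj₂ e) v)     ≡⟨ ∑-+ es _ _ ⟨
      ∑ es (λ e → δ (proj₁ e) v + δ (proj₂ e) v)                  ∎
      where
      open ≡-Reasoning
      u : Unique es
      u = subset-unique (pairs-unique n) m
      split : ∀ t → 𝟙 (adj es v t) ≡ 𝟙 (mem (v , t) es) + 𝟙 (mem (t , v) es)
      split t with mem (v , t) es in p | mem (t , v) es in q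
      ... | false | _ = refl
      ... | true | false = refl
      ... | true | true = ⊥-elim (<-asym (subset-< m (mem⁻ p)) (subset-< m (mem⁻ q)))
      side : (mk : Fin n → Edge n) (π ρ : Edge n → Fin n)
        → (∀ e t → δ (proj₁ e) (proj₁ (mk t)) * δ (proj₂ e) (proj₂ (mk t)) ≡ δ (ρ e) t * δ (π e) v)
        → ∑ V (λ t → 𝟙 (mem (mk t) es)) ≡ ∑ es (λ e → δ (π e) v)
      side mk π ρ h = begin
        ∑ V (λ t → 𝟙 (mem (mk t) es))                              ≡⟨ ∑-cong V (λ t → mem-∑ (mk t) u) ⟩
        ∑ V (λ t → ∑ es (λ e → δ (proj₁ e) (proj₁ (mk t)) * δ (proj₂ e) (proj₂ (mk t))))
                                                                   ≡⟨ ∑-swap V es _ ⟩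
        ∑ es (λ e → ∑ V (λ t → δ (proj₁ e) (proj₁ (mk t)) * δ (proj₂ e) (proj₂ (mk t))))
                                                                   ≡⟨ ∑-cong es (λ e → ∑-cong V (h e)) ⟩
        ∑ es (λ e → ∑ V (λ t → δ (ρ e) t * δ (π e) v))             ≡⟨ ∑-cong es (λ e → ∑-*ʳ V (δ (π e) v) (δ (ρ e))) ⟩
        ∑ es (λ e → ∑ V (δ (ρ e)) * δ (π e) v)                     ≡⟨ ∑-cong es (λ e → trans (cong (_* δ (π e) v) (∑-δ-all (ρ e))) (*-identityˡ _)) ⟩
        ∑ es (λ e → δ (π e) v)                                     ∎

    -- rem counts (s , t) as one of the removed pairs ux, ay in either direction, add as one of the inserted pairs uy, ax.
    rem add : (u x a y s t : Fin n) → ℕ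
    rem u x a y s t = (δ u s * δ x t + δ x s * δ u t) + (δ a s * δ y t + δ y s * δ a t)
    add u x a y s t = rem u y a x s t

    record Switched (A A′ : Fin n → Fin n → Bool) (u x a y : Fin n) : Set where
      field
        ux : A u x ≡ true
        ay : A a y ≡ true
        ¬uy : A u y ≡ false
        uy′ : A′ u y ≡ true
        ax′ : A′ a x ≡ true
        u≢a : u ≢ a
        u≢x : u ≢ x
        u≢y : u ≢ y
        x≢a : x ≢ a
        a≢y : a ≢ y
        x≢y : x ≢ y
        keep : ∀ s t → A s t ≡ true → rem u x a y s t ≡ 0 → A′ s t ≡ true

    -- Distinctness of `u` and `a`, and of `x` and `y`, is implied: either equality would turn a
    -- forbidden pair into one of the two given edges.
    valid : (Fin n → Fin n → Bool) → (u x a y : Fin n) → Bool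
    valid A u x a y = (A u x ∧ A a y) ∧ ((not (A u y) ∧ not (A a x)) ∧ (not (u =ᶠ y) ∧ not (a =ᶠ x)))

  -- Switchings

  module Switches {n : ℕ} (D : DegSeq n) where
    open Switching D

    Adj : Set
    Adj = Fin n → Fin n → Bool

    ∑-rem : ∀ u x a y v → ∑ V (rem u x a y v) ≡ (δ u v + δ x v) + (δ a v + δ y v)
    ∑-rem u x a y v = begin
      ∑ V (rem u x a y v)  ≡⟨ ∑-+ V _ _ ⟩
      ∑ V (λ t → δ u v * δ x t + δ x v * δ u t) + ∑ V (λ t → δ a v * δ y t + δ y v * δ a t)
                           ≡⟨ cong₂ _+_ (two u x) (two a y) ⟩
      (δ u v + δ x v) + (δ a v + δ y v) ∎
      where
      open ≡-Reasoning
      one : ∀ c i → ∑ V (λ t → c * δ i t) ≡ c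
      one c i = trans (∑-*ˡ V c (δ i)) (trans (cong (c *_) (∑-δ-all i)) (*-identityʳ c))
      two : ∀ i j → ∑ V (λ t → δ i v * δ j t + δ j v * δ i t) ≡ δ i v + δ j v
      two i j = trans (∑-+ V _ _) (cong₂ _+_ (one (δ i v) j) (one (δ j v) i))

    ∑-rem-add : ∀ u x a y v → ∑ V (rem u x a y v) ≡ ∑ V (add u x a y v)
    ∑-rem-add u x a y v = trans (∑-rem u x a y v) (trans (p (δ u v) (δ x v) (δ a v) (δ y v)) (sym (∑-rem u y a x v)))
      where p : ∀ a b c d → (a + b) + (c + d) ≡ (a + d) + (c + b)
            p = solve-∀

    -- The pattern depends on the four vertices only and not on the graph. Hence it can be cancelled
    -- from an exclusive or, which gives injectivity without constructing the inverse switching.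
    toggled : (u x a y s t : Fin n) → Bool
    toggled u x a y s t = not (rem u x a y s t + add u x a y s t ≡ᵇ 0)

    module Switch (A : Adj) (A-sym : ∀ i j → A i j ≡ true → A j i ≡ true) (A-irr : ∀ v → A v v ≡ false)
      (u x a y : Fin n) (ok : valid A u x a y ≡ true) where

      A′ : Adj
      A′ s t = A s t xor toggled u x a y s t

      ux : A u x ≡ true
      ux = proj₁ (∧⁻ (proj₁ (∧⁻ {A u x ∧ A a y} ok)))
      ay : A a y ≡ true
      ay = proj₂ (∧⁻ {A u x} (proj₁ (∧⁻ {A u x ∧ A a y} ok)))
      private
        rest = proj₂ (∧⁻ {A u x ∧ A a y} ok)
      ¬uy : A u y ≡ false
      ¬uy = not⁻ (proj₁ (∧⁻ (proj₁ (∧⁻ {not (A u y) ∧ not (A a x)} rest))))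
      ¬ax : A a x ≡ false
      ¬ax = not⁻ (proj₂ (∧⁻ {not (A u y)} (proj₁ (∧⁻ {not (A u y) ∧ not (A a x)} rest))))
      u≢y : u ≢ y
      u≢y refl = false≢true (not⁻ (proj₁ (∧⁻ (proj₂ (∧⁻ {not (A u y) ∧ not (A a x)} rest))))) (=ᶠ-refl u)
      a≢x : a ≢ x
      a≢x refl = false≢true (not⁻ (proj₂ (∧⁻ {not (u =ᶠ y)} (proj₂ (∧⁻ {not (A u y) ∧ not (A a x)} rest))))) (=ᶠ-refl a)
      adj-≢ : ∀ {i j} → A i j ≡ true → i ≢ j
      adj-≢ {i} p refl = false≢true (A-irr i) p
      u≢x : u ≢ x
      u≢x = adj-≢ ux
      a≢y : a ≢ y
      a≢y = adj-≢ ay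
      u≢a : u ≢ a
      u≢a refl = false≢true ¬uy ay
      x≢y : x ≢ y
      x≢y refl = false≢true ¬uy ux

      data Tri (s t : Fin n) : Set where
        stay : rem u x a y s t ≡ 0 → add u x a y s t ≡ 0 → Tri s t
        del : rem u x a y s t ≡ 1 → add u x a y s t ≡ 0 → A s t ≡ true → Tri s t
        ins : rem u x a y s t ≡ 0 → add u x a y s t ≡ 1 → A s t ≡ false → Tri s t

      -- Each of the four vertices meets one removed pair, with partner `p`, and one inserted pair,
      -- with partner `q`. As the partners differ, `rem` and `add` are at most 1 and never positive
      -- together.
      row : ∀ {s t} p q → rem u x a y s t ≡ δ p t → add u x a y s t ≡ δ q t → p ≢ q → A s p ≡ true → A s q ≡ false → Tri s t
      row {s} {t} p q r d p≢q sp sq with p ≟F t | q ≟F t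
      ... | yes refl | _ = del (trans r (δ-refl p)) (trans d (δ-≢ (p≢q ∘ sym))) sp
      ... | no h | yes refl = ins (trans r (δ-≢ h)) (trans d (δ-refl q)) sq
      ... | no h | no h′ = stay (trans r (δ-≢ h)) (trans d (δ-≢ h′))

      vals : ∀ {s} (t : Fin n) {du dx da dy} → δ u s ≡ du → δ x s ≡ dx → δ a s ≡ da → δ y s ≡ dy
        → rem u x a y s t ≡ (du * δ x t + dx * δ u t) + (da * δ y t + dy * δ a t)
        × add u x a y s t ≡ (du * δ y t + dy * δ u t) + (da * δ x t + dx * δ a t)
      vals t refl refl refl refl = refl , refl

      ¬sym : ∀ {i j} → A i j ≡ false → A j i ≡ false
      ¬sym f = ≢true⇒false λ p → false≢true f (A-sym _ _ p)

      tri : ∀ s t → Tri s t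
      tri s t with u ≟F s | x ≟F s | a ≟F s | y ≟F s
      ... | yes refl | _ | _ | _ =
        let r , d = vals t (δ-refl u) (δ-≢ (u≢x ∘ sym)) (δ-≢ (u≢a ∘ sym)) (δ-≢ (u≢y ∘ sym))
        in row x y (trans r (e₁ (δ x t))) (trans d (e₁ (δ y t))) x≢y ux ¬uy
        where e₁ : ∀ p → (1 * p + 0) + 0 ≡ p
              e₁ = solve-∀
      ... | no _ | yes refl | _ | _ =
        let r , d = vals t (δ-≢ u≢x) (δ-refl x) (δ-≢ a≢x) (δ-≢ (x≢y ∘ sym))
        in row u a (trans r (e₁ (δ u t))) (trans d (e₂ (δ a t))) u≢a (A-sym _ _ ux) (¬sym ¬ax)
        where e₁ : ∀ p → (0 + 1 * p) + 0 ≡ p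
              e₁ = solve-∀
              e₂ : ∀ p → 0 + (0 + 1 * p) ≡ p
              e₂ = solve-∀
      ... | no _ | no _ | yes refl | _ =
        let r , d = vals t (δ-≢ u≢a) (δ-≢ (a≢x ∘ sym)) (δ-refl a) (δ-≢ (a≢y ∘ sym))
        in row y x (trans r (e₁ (δ y t))) (trans d (e₁ (δ x t))) (x≢y ∘ sym) ay ¬ax
        where e₁ : ∀ p → 0 + (1 * p + 0) ≡ p
              e₁ = solve-∀
      ... | no _ | no _ | no _ | yes refl =
        let r , d = vals t (δ-≢ u≢y) (δ-≢ x≢y) (δ-≢ a≢y) (δ-refl y)
        in row a u (trans r (e₂ (δ a t))) (trans d (e₁ (δ u t))) (u≢a ∘ sym) (A-sym _ _ ay) (¬sym ¬uy)
        where e₁ : ∀ p → (0 + 1 * p) + 0 ≡ p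
              e₁ = solve-∀
              e₂ : ∀ p → 0 + (0 + 1 * p) ≡ p
              e₂ = solve-∀
      ... | no h₁ | no h₂ | no h₃ | no h₄ =
        let r , d = vals t (δ-≢ h₁) (δ-≢ h₂) (δ-≢ h₃) (δ-≢ h₄) in stay r d

      tog-eq : ∀ s t {i j} → rem u x a y s t ≡ i → add u x a y s t ≡ j → toggled u x a y s t ≡ not (i + j ≡ᵇ 0)
      tog-eq s t refl refl = refl

      count : ∀ s t → 𝟙 (A′ s t) + rem u x a y s t ≡ 𝟙 (A s t) + add u x a y s t
      count s t with tri s t
      ... | stay r d rewrite tog-eq s t r d | r | d with A s t
      ...   | true = refl
      ...   | false = refl
      count s t | del r d e rewrite tog-eq s t r d | r | d | e = refl
      count s t | ins r d e rewrite tog-eq s t r d | r | d | e = refl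

      degree : ∀ v → ∑ V (λ t → 𝟙 (A′ v t)) ≡ ∑ V (λ t → 𝟙 (A v t))
      degree v = +-cancelʳ-≡ (∑ V (rem u x a y v)) _ _ (begin
        ∑ V (λ t → 𝟙 (A′ v t)) + ∑ V (rem u x a y v)   ≡⟨ ∑-+ V _ _ ⟨
        ∑ V (λ t → 𝟙 (A′ v t) + rem u x a y v t)       ≡⟨ ∑-cong V (count v) ⟩
        ∑ V (λ t → 𝟙 (A v t) + add u x a y v t)        ≡⟨ ∑-+ V _ _ ⟩
        ∑ V (λ t → 𝟙 (A v t)) + ∑ V (add u x a y v)    ≡⟨ cong (_ +_) (∑-rem-add u x a y v) ⟨
        ∑ V (λ t → 𝟙 (A v t)) + ∑ V (rem u x a y v)    ∎)
        where open ≡-Reasoning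

      A-comm : ∀ s t → A s t ≡ A t s
      A-comm s t = bool-ext (A-sym s t) (A-sym t s)

      A′-comm : ∀ s t → A′ s t ≡ A′ t s
      A′-comm s t = cong₂ _xor_ (A-comm s t) (cong (λ k → not (k ≡ᵇ 0)) (cong₂ _+_ (flip u x a y) (flip u y a x)))
        where
        p : ∀ a b c d e f g h → (a * b + c * d) + (e * f + g * h) ≡ (d * c + b * a) + (h * g + f * e)
        p = solve-∀
        flip : ∀ u x a y → rem u x a y s t ≡ rem u x a y t s
        flip u x a y = p (δ u s) (δ x t) (δ x s) (δ u t) (δ a s) (δ y t) (δ y s) (δ a t)

      A′-irr : ∀ v → A′ v v ≡ false
      A′-irr v with tri v v
      ... | stay r d rewrite tog-eq v v r d | A-irr v = refl
      ... | del r d e = ⊥-elim (false≢true (A-irr v) e)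
      -- On the diagonal the two directions of a pair coincide, so `add` is even and cannot be 1.
      ... | ins r d e = ⊥-elim (odd (δ u v * δ y v) (δ a v * δ x v) (trans (q (δ u v) (δ y v) (δ a v) (δ x v)) d))
        where
        q : ∀ a b c d → 2 * (a * b + c * d) ≡ (a * b + b * a) + (c * d + d * c)
        q = solve-∀
        odd : ∀ i j → 2 * (i + j) ≡ 1 → ⊥
        odd i j e with i + j
        ... | suc k rewrite +-suc k (k + 0) with e
        ...   | ()

      keep : ∀ s t → A s t ≡ true → rem u x a y s t ≡ 0 → A′ s t ≡ true
      keep s t st z with tri s t
      ... | stay r d rewrite tog-eq s t r d | st = refl
      ... | del r d e with trans (sym z) r
      ...   | ()
      keep s t st z | ins r d e = ⊥-elim (false≢true e st)

      uy′ : A′ u y ≡ true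
      uy′ with tri u y
      ... | ins r d e rewrite tog-eq u y r d | e = refl
      ... | del r d e = ⊥-elim (false≢true ¬uy e)
      ... | stay r d with m+n≡0⇒m≡0 (δ u u * δ y y) (m+n≡0⇒m≡0 (δ u u * δ y y + δ y u * δ u y) d)
      ...   | z with trans (sym z) (cong₂ _*_ (δ-refl u) (δ-refl y))
      ...     | ()

      ax′ : A′ a x ≡ true
      ax′ with tri a x
      ... | ins r d e rewrite tog-eq a x r d | e = refl
      ... | del r d e = ⊥-elim (false≢true ¬ax e)
      ... | stay r d with m+n≡0⇒m≡0 (δ a a * δ x x) (m+n≡0⇒n≡0 (δ u a * δ y x + δ y a * δ u x) d)
      ...   | z with trans (sym z) (cong₂ _*_ (δ-refl a) (δ-refl x))
      ...     | ()

      A′-ok : (B : Adj) → (∀ s t → B s t ≡ A′ s t) → Switched A B u x a y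
      A′-ok B h = record { ux = ux ; ay = ay ; ¬uy = ¬uy ; uy′ = trans (h u y) uy′ ; ax′ = trans (h a x) ax′
        ; u≢a = u≢a ; u≢x = u≢x ; u≢y = u≢y ; x≢a = a≢x ∘ sym ; a≢y = a≢y ; x≢y = x≢y
        ; keep = λ s t p q → trans (h s t) (keep s t p q) }

    realise : Adj → List (Edge n)
    realise B = filterᵇ (λ e → B (proj₁ e) (proj₂ e)) (pairs n)

    adj-realise : (B : Adj) → (∀ s t → B s t ≡ B t s) → (∀ v → B v v ≡ false) → ∀ s t → adj (realise B) s t ≡ B s t
    adj-realise B B-comm B-irr s t = bool-ext to from
      where
      mem-real : ∀ {s t} → mem (s , t) (realise B) ≡ true → B s t ≡ true
      mem-real m = proj₂ (∈-filterᵇ⁻ (λ e → B (proj₁ e) (proj₂ e)) {xs = pairs n} (mem⁻ m))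
      to : adj (realise B) s t ≡ true → B s t ≡ true
      to p with ∨⁻ {mem (s , t) (realise B)} p
      ... | inj₁ q = mem-real q
      ... | inj₂ q = trans (B-comm s t) (mem-real q)
      from : B s t ≡ true → adj (realise B) s t ≡ true
      from p with <-cmp (toℕ s) (toℕ t)
      ... | tri< lt _ _ = ∨⁺ˡ (mem⁺ (∈-filterᵇ⁺ _ (∈-pairs⁺ lt) p))
      ... | tri> _ _ gt = ∨⁺ʳ (mem (s , t) (realise B)) (mem⁺ (∈-filterᵇ⁺ _ (∈-pairs⁺ gt) (trans (B-comm t s) p)))
      ... | tri≈ _ e _ with toℕ-injective e
      ...   | refl = ⊥-elim (false≢true (B-irr s) p)

    subset-adj-ext : ∀ {es fs} → es ∈ subsets (pairs n) → fs ∈ subsets (pairs n) → (∀ s t → adj es s t ≡ adj fs s t) → es ≡ fs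
    subset-adj-ext {es} {fs} p q h = subsets-ext (pairs-unique n) p q (sub p q h) (sub q p (λ s t → sym (h s t)))
      where
      sub : ∀ {es fs} → es ∈ subsets (pairs n) → fs ∈ subsets (pairs n) → (∀ s t → adj es s t ≡ adj fs s t) → ∀ {e} → e ∈ es → e ∈ fs
      sub {es} {fs} p q h {s , t} m with ∨⁻ {mem (s , t) fs} (trans (sym (h s t)) (adj⁺ m))
      ... | inj₁ r = mem⁻ r
      ... | inj₂ r = ⊥-elim (<-asym (subset-< p m) (subset-< q (mem⁻ r)))

    xor-cancel : ∀ a b c → a xor c ≡ b xor c → a ≡ b
    xor-cancel false false c e = refl
    xor-cancel true true c e = refl
    xor-cancel false true true ()
    xor-cancel false true false ()
    xor-cancel true false true ()
    xor-cancel true false false ()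

    adj-deg : ∀ {es} → es ∈ realisations D → ∀ v → ∑ V (λ t → 𝟙 (adj es v t)) ≡ D v
    adj-deg m v = let a , b = real⁻ m in trans (deg-adj a v) (b v)

    -- For four fixed vertices the valid realisations are mapped injectively into all realisations,
    -- so a bound along the map becomes a bound between sums. Multiplicities do not arise, since the
    -- vertices are part of the index.
    switch-sum : ∀ u x a y (f f′ : List (Edge n) → ℕ)
      → (∀ {G G′} → G ∈ realisations D → G′ ∈ realisations D → Switched (adj G) (adj G′) u x a y → f G ≤ f′ G′)
      → ∑ (realisations D) (λ G → 𝟙 (valid (adj G) u x a y) * f G) ≤ ∑ (realisations D) f′
    switch-sum u x a y f f′ h = begin
      ∑ 𝒢 (λ G → 𝟙 (valid (adj G) u x a y) * f G)   ≡⟨ ∑-filter (λ G → valid (adj G) u x a y) 𝒢 f ⟨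
      ∑ 𝒢₁ f                                        ≤⟨ ∑-mono 𝒢₁ (λ m → h (proj₁ (split m)) (φ∈ m) (φ-ok m)) ⟩
      ∑ 𝒢₁ (f′ ∘ φ)                                 ≤⟨ ∑-injection φ 𝒢₁ 𝒢 f′ (filter⁺ _ realisations-unique) φ-inj φ∈ ⟩
      ∑ 𝒢 f′                                        ∎
      where
      open ≤-Reasoning
      𝒢 = realisations D
      𝒢₁ = filterᵇ (λ G → valid (adj G) u x a y) 𝒢
      B : List (Edge n) → Adj
      B G s t = adj G s t xor toggled u x a y s t
      φ : List (Edge n) → List (Edge n)
      φ G = realise (B G)
      split : ∀ {G} → G ∈ 𝒢₁ → G ∈ 𝒢 × valid (adj G) u x a y ≡ true
      split = ∈-filterᵇ⁻ (λ G → valid (adj G) u x a y) {xs = 𝒢}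
      module S {G} (m : G ∈ 𝒢₁) = Switch (adj G) (adj-sym G) (adj-irrefl (proj₁ (real⁻ (proj₁ (split m))))) u x a y (proj₂ (split m))
      adjφ : ∀ {G} (m : G ∈ 𝒢₁) → ∀ s t → adj (φ G) s t ≡ B G s t
      adjφ {G} m = adj-realise (B G) (S.A′-comm m) (S.A′-irr m)
      φ∈ : ∀ {G} → G ∈ 𝒢₁ → φ G ∈ 𝒢
      φ∈ {G} m = real⁺ sub λ v → trans (sym (deg-adj sub v)) (trans (∑-cong V (λ t → cong 𝟙 (adjφ m v t)))
                   (trans (S.degree m v) (adj-deg (proj₁ (split m)) v)))
        where sub = filter∈subsets (λ e → B G (proj₁ e) (proj₂ e)) (pairs n)
      φ-ok : ∀ {G} (m : G ∈ 𝒢₁) → Switched (adj G) (adj (φ G)) u x a y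
      φ-ok {G} m = S.A′-ok m (adj (φ G)) (adjφ m)
      φ-inj : ∀ {G H} → G ∈ 𝒢₁ → H ∈ 𝒢₁ → φ G ≡ φ H → G ≡ H
      φ-inj {G} {H} p q e = subset-adj-ext (proj₁ (real⁻ (proj₁ (split p)))) (proj₁ (real⁻ (proj₁ (split q)))) λ s t →
        xor-cancel (adj G s t) (adj H s t) (toggled u x a y s t)
          (trans (sym (adjφ p s t)) (trans (cong (λ K → adj K s t) e) (adjφ q s t)))

  -- Exploration from a dart

  module Explore {n : ℕ} (D : DegSeq n) (t : ℕ) where
    private
      V = allFin n
      open DecMem (_≟F_ {n}) using (_∈?_)

    -- Surv A f k vis x: some path of at most f vertices that starts at x and avoids vis
    -- either meets a vertex of degree above t or meets more than k vertices of degree other than 2.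
    data Surv (A : Fin n → Fin n → Bool) : ℕ → ℕ → List (Fin n) → Fin n → Set where
      big : ∀ {f k vis x} → x ∉ vis → t < D x → Surv A (suc f) k vis x
      zro : ∀ {f vis x} → x ∉ vis → D x ≢ 2 → Surv A (suc f) 0 vis x
      pass : ∀ {f k vis x z} → x ∉ vis → D x ≡ 2 → A x z ≡ true → Surv A f k (x ∷ vis) z → Surv A (suc f) k vis x
      branch : ∀ {f k vis x z} → x ∉ vis → D x ≢ 2 → A x z ≡ true → Surv A f k (x ∷ vis) z → Surv A (suc f) (suc k) vis x

    surv-∉ : ∀ {A f k vis x} → Surv A f k vis x → x ∉ vis
    surv-∉ (big h _) = h
    surv-∉ (zro h _) = h
    surv-∉ (pass h _ _ _) = h
    surv-∉ (branch h _ _ _) = h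

    surv-mono : ∀ {A f f′ k vis vis′ x} → f ≤ f′ → (∀ {z} → z ∈ vis′ → z ∈ vis) → Surv A f k vis x → Surv A f′ k vis′ x
    cons-⊆ : ∀ {x : Fin n} {vis vis′} → (∀ {z} → z ∈ vis′ → z ∈ vis) → ∀ {z} → z ∈ x ∷ vis′ → z ∈ x ∷ vis
    cons-⊆ h (here e) = here e
    cons-⊆ h (there p) = there (h p)
    surv-mono (s≤s l) h (big x∉ b) = big (x∉ ∘ h) b
    surv-mono (s≤s l) h (zro x∉ b) = zro (x∉ ∘ h) b
    surv-mono (s≤s l) h (pass x∉ e a s) = pass (x∉ ∘ h) e a (surv-mono l (cons-⊆ h) s)
    surv-mono (s≤s l) h (branch x∉ e a s) = branch (x∉ ∘ h) e a (surv-mono l (cons-⊆ h) s)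

    surv-pred : ∀ {A f k vis x} → Surv A f (suc k) vis x → Surv A f k vis x
    surv-pred (big h b) = big h b
    surv-pred (pass h e a s) = pass h e a (surv-pred s)
    surv-pred {k = zero} (branch h e a s) = zro h e
    surv-pred {k = suc k} (branch h e a s) = branch h e a (surv-pred s)

    surv? : ∀ A f k vis x → Dec (Surv A f k vis x)
    surv? A zero k vis x = no λ ()
    surv? A (suc f) k vis x with x ∈? vis
    ... | yes p = no λ s → surv-∉ s p
    ... | no x∉ with t <? D x
    ...   | yes b = yes (big x∉ b)
    ...   | no ¬b with D x ≟ℕ 2
    ...     | yes e with any? (λ z → (A x z ≟B true) ×-dec surv? A f k (x ∷ vis) z)
    ...       | yes (z , a , s) = yes (pass x∉ e a s)
    ...       | no h = no λ { (big _ b) → ¬b b ; (zro _ ne) → ne e ; (pass _ _ a s) → h (_ , a , s) ; (branch _ ne _ _) → ne e }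
    surv? A (suc f) zero vis x | no x∉ | no ¬b | no ne = yes (zro x∉ ne)
    surv? A (suc f) (suc k) vis x | no x∉ | no ¬b | no ne with any? (λ z → (A x z ≟B true) ×-dec surv? A f k (x ∷ vis) z)
    ... | yes (z , a , s) = yes (branch x∉ ne a s)
    ... | no h = no λ { (big _ b) → ¬b b ; (pass _ e _ _) → ne e ; (branch _ _ a s) → h (_ , a , s) }

    onward : (Fin n → Fin n → Bool) → Fin n → Fin n → (Fin n → ℕ) → ℕ
    onward A p x g = ∑ V (λ z → 𝟙 (A x z ∧ not (z =ᶠ p)) * g z)

    -- An upper bound for the number of ways in which the exploration behind Surv, entering x from p, visits w.
    -- It stops at vertices of degree above t, which keeps its total mass over w bounded by cap k.
    hits : (Fin n → Fin n → Bool) → ℕ → ℕ → Fin n → Fin n → Fin n → ℕ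
    hits A zero k p x w = 0
    hits A (suc f) zero p x w = if D x ≡ᵇ 2 then onward A p x (λ z → hits A f zero x z w) else δ x w
    hits A (suc f) (suc k) p x w =
      if D x ≡ᵇ 2 then onward A p x (λ z → hits A f (suc k) x z w)
      else δ x w + (if t <ᵇ D x then 0 else onward A p x (λ z → hits A f k x z w))

    -- This is 1 + t + ... + t^k, the size of a `t`-ary tree of depth `k`. Vertices of degree 2 do
    -- not branch, hence neither path lengths nor `n` enter.
    cap : ℕ → ℕ
    cap zero = 1
    cap (suc k) = 1 + t * cap k

    onward-∑ : ∀ A p x (g : Fin n → Fin n → ℕ) → ∑ V (λ w → onward A p x (λ z → g z w)) ≡ onward A p x (λ z → ∑ V (g z))
    onward-∑ A p x g = trans (∑-swap V V _) (∑-cong V (λ z → ∑-*ˡ V (𝟙 (A x z ∧ not (z =ᶠ p))) (g z)))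

    onward-≤ : ∀ A p x (g : Fin n → ℕ) c → (∀ z → A x z ≡ true → g z ≤ c) → onward A p x g ≤ ∑ V (λ z → 𝟙 (A x z ∧ not (z =ᶠ p))) * c
    onward-≤ A p x g c h = ≤-trans (∑-mono V λ {z} _ → le z) (≤-reflexive (∑-*ʳ V c _))
      where
      le : ∀ z → 𝟙 (A x z ∧ not (z =ᶠ p)) * g z ≤ 𝟙 (A x z ∧ not (z =ᶠ p)) * c
      le z with A x z in eq
      ... | true = *-monoʳ-≤ (𝟙 (not (z =ᶠ p))) (h z eq)
      ... | false = z≤n

    onward-pos : ∀ A p x z (g : Fin n → ℕ) → A x z ≡ true → z ≢ p → 1 ≤ g z → 1 ≤ onward A p x g
    onward-pos A p x z g a z≢p h = ≤-trans (subst (1 ≤_) (sym eq) h) (∑-term (λ z → 𝟙 (A x z ∧ not (z =ᶠ p)) * g z) (∈-allFin z))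
      where
      eq : 𝟙 (A x z ∧ not (z =ᶠ p)) * g z ≡ g z
      eq rewrite a | ≢⇒=ᶠ z≢p = +-identityʳ (g z)

    ≢2⇒ᵇ : ∀ {x} → D x ≢ 2 → (D x ≡ᵇ 2) ≡ false
    ≢2⇒ᵇ h = ≢true⇒false λ e → h (≡ᵇ⇒≡ _ _ (≡⇒T e))

    ≮⇒ᵇ : ∀ {x} → ¬ (t < D x) → (t <ᵇ D x) ≡ false
    ≮⇒ᵇ h = ≢true⇒false λ e → h (<ᵇ⇒< _ _ (≡⇒T e))

    hits-self : ∀ A f k p x → D x ≢ 2 → 1 ≤ hits A (suc f) k p x x
    hits-self A f zero p x h rewrite ≢2⇒ᵇ h | δ-refl x = s≤s z≤n
    hits-self A f (suc k) p x h rewrite ≢2⇒ᵇ h | δ-refl x = s≤s z≤n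

    hits-pass : ∀ A f k p x z w → D x ≡ 2 → A x z ≡ true → z ≢ p → 1 ≤ hits A f k x z w → 1 ≤ hits A (suc f) k p x w
    hits-pass A f zero p x z w e a z≢p h rewrite e = onward-pos A p x z (λ z → hits A f zero x z w) a z≢p h
    hits-pass A f (suc k) p x z w e a z≢p h rewrite e = onward-pos A p x z (λ z → hits A f (suc k) x z w) a z≢p h

    hits-branch : ∀ A f k p x z w → D x ≢ 2 → ¬ (t < D x) → A x z ≡ true → z ≢ p → 1 ≤ hits A f k x z w → 1 ≤ hits A (suc f) (suc k) p x w
    hits-branch A f k p x z w ne ¬b a z≢p h rewrite ≢2⇒ᵇ ne | ≮⇒ᵇ ¬b =
      ≤-trans (onward-pos A p x z (λ z → hits A f k x z w) a z≢p h) (m≤n+m _ (δ x w))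

    -- Every pair changed by a switching contains u or a, so a path that starts next to u and avoids a survives it,
    -- even if its first vertex changes from u to a.
    transfer : ∀ {A A′ : Fin n → Fin n → Bool} {u a} → D u ≢ 2 → D a ≢ 2
      → (∀ s z → s ≢ u → s ≢ a → z ≢ u → z ≢ a → A s z ≡ true → A′ s z ≡ true)
      → ∀ {f k vis vis′ p x} → u ∈ vis → a ∈ vis′ → (∀ {z} → z ∈ vis′ → z ≡ a ⊎ z ∈ vis) → p ∈ vis
      → Surv A f k vis x → Surv A′ f k vis′ x ⊎ 1 ≤ hits A f k p x a
    transfer {A} {A′} {u} {a} Du Da agree = go
      where
      out : ∀ {vis vis′ x} → (∀ {z} → z ∈ vis′ → z ≡ a ⊎ z ∈ vis) → x ∉ vis → x ≢ a → x ∉ vis′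
      out h x∉ x≢a x∈ with h x∈
      ... | inj₁ e = x≢a e
      ... | inj₂ q = x∉ q
      sub : ∀ {x vis vis′} → (∀ {z} → z ∈ vis′ → z ≡ a ⊎ z ∈ vis) → ∀ {z} → z ∈ x ∷ vis′ → z ≡ a ⊎ z ∈ x ∷ vis
      sub h (here e) = inj₂ (here e)
      sub h (there q) with h q
      ... | inj₁ e = inj₁ e
      ... | inj₂ r = inj₂ (there r)
      go : ∀ {f k vis vis′ p x} → u ∈ vis → a ∈ vis′ → (∀ {z} → z ∈ vis′ → z ≡ a ⊎ z ∈ vis) → p ∈ vis
        → Surv A f k vis x → Surv A′ f k vis′ x ⊎ 1 ≤ hits A f k p x a
      move : ∀ {f k vis vis′ x z} → u ∈ vis → a ∈ vis′ → (∀ {z} → z ∈ vis′ → z ≡ a ⊎ z ∈ vis) → x ∉ vis → x ≢ a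
        → A x z ≡ true → Surv A f k (x ∷ vis) z → (A′ x z ≡ true × Surv A′ f k (x ∷ vis′) z) ⊎ 1 ≤ hits A f k x z a
      move {x = x} {z} u∈ a∈ h x∉ x≢a xz s with go (there u∈) (there a∈) (sub h) (here refl) s
      ... | inj₂ q = inj₂ q
      ... | inj₁ s′ = inj₁ (agree x z (λ { refl → x∉ u∈ }) x≢a (λ { refl → surv-∉ s (there u∈) })
                              (λ { refl → surv-∉ s′ (there a∈) }) xz , s′)
      go {suc f} {k} {p = p} {x} u∈ a∈ h p∈ s with x ≟F a
      ... | yes refl = inj₂ (hits-self A f k p x Da)
      go u∈ a∈ h p∈ (big x∉ b) | no x≢a = inj₁ (big (out h x∉ x≢a) b)
      go u∈ a∈ h p∈ (zro x∉ b) | no x≢a = inj₁ (zro (out h x∉ x≢a) b)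
      go {suc f} {k} {p = p} {x} u∈ a∈ h p∈ (pass {z = z} x∉ e xz s) | no x≢a with move u∈ a∈ h x∉ x≢a xz s
      ... | inj₁ (xz′ , s′) = inj₁ (pass (out h x∉ x≢a) e xz′ s′)
      ... | inj₂ q = inj₂ (hits-pass A f k p x z a e xz (λ { refl → surv-∉ s (there p∈) }) q)
      go {suc f} {suc k} {p = p} {x} u∈ a∈ h p∈ (branch {z = z} x∉ ne xz s) | no x≢a with t <? D x
      ... | yes b = inj₁ (big (out h x∉ x≢a) b)
      ... | no ¬b with move u∈ a∈ h x∉ x≢a xz s
      ...   | inj₁ (xz′ , s′) = inj₁ (branch (out h x∉ x≢a) ne xz′ s′)
      ...   | inj₂ q = inj₂ (hits-branch A f k p x z a ne ¬b xz (λ { refl → surv-∉ s (there p∈) }) q)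

    data Path (A : Fin n → Fin n → Bool) (vis : List (Fin n)) (x : Fin n) : Fin n → Set where
      end : x ∉ vis → Path A vis x x
      step : ∀ {z w} → x ∉ vis → A x z ≡ true → Path A (x ∷ vis) z w → Path A vis x w

    path-∉ : ∀ {A vis x w} → Path A vis x w → x ∉ vis
    path-∉ (end h) = h
    path-∉ (step h _ _) = h

    path-mono : ∀ {A vis vis′ x w} → (∀ {z} → z ∈ vis′ → z ∈ vis) → Path A vis x w → Path A vis′ x w
    path-mono h (end x∉) = end (x∉ ∘ h)
    path-mono h (step x∉ a p) = step (x∉ ∘ h) a (path-mono (cons-⊆ h) p)

    -- If the path meets `u`, its remainder from there on is a path from `u`. This is the loop
    -- erasure with which `path-extend` puts `u` in front of a path.
    path-cut : ∀ {A vis x w} u → Path A vis x w → Path A (u ∷ vis) x w ⊎ Path A vis u w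
    path-cut {x = x} u p with x ≟F u
    ... | yes refl = inj₂ p
    path-cut u (end x∉) | no ne = inj₁ (end λ { (here e) → ne e ; (there q) → x∉ q })
    path-cut {x = x} u (step x∉ a p) | no ne with path-cut u p
    ... | inj₂ q = inj₂ (path-mono there q)
    ... | inj₁ q = inj₁ (step (λ { (here e) → ne e ; (there q) → x∉ q }) a
                     (path-mono (λ { (here e) → there (here e) ; (there (here e)) → here e ; (there (there r)) → there (there r) }) q))

    path-extend : ∀ {A u x w} → A u x ≡ true → Path A [] x w → Path A [] u w
    path-extend {u = u} a p with path-cut u p
    ... | inj₁ q = step (λ ()) a q
    ... | inj₂ q = q

    -- Along the path a vertex of degree above `t`, or one vertex too many of degree other than 2,
    -- would have let the exploration survive, so `hits` follows the path to its end. The fuel does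
    -- not run out because the visited vertices are distinct and at most `n`.
    path-hits : ∀ A f k {vis} p {x w} → Path A vis x w → ¬ Surv A f k vis x → n ≤ f + length vis → Unique vis → p ∈ vis → D w ≢ 2
      → D w ≤ t × 1 ≤ hits A f k p x w
    path-hits A zero k {vis} p {x} π ¬s l u p∈ ne =
      ⊥-elim (<-irrefl refl (≤-trans (unique-length (x ∷ vis) (All.tabulate (λ { z∈ refl → path-∉ π z∈ }) ∷ u)) l))
    path-hits A (suc f) k p {x} (end x∉) ¬s l u p∈ ne = ≮⇒≥ (λ b → ¬s (big x∉ b)) , hits-self A f k p x ne
    path-hits A (suc f) k {vis} p {x} {w} (step {z} x∉ a π) ¬s l u p∈ ne = cases k ¬s (D x ≟ℕ 2)
      where
      IH : ∀ k → ¬ Surv A f k (x ∷ vis) z → D w ≤ t × 1 ≤ hits A f k x z w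
      IH k ¬s′ = path-hits A f k x π ¬s′ (≤-trans l (≤-reflexive (sym (+-suc f (length vis)))))
                 (All.tabulate (λ { z∈ refl → x∉ z∈ }) ∷ u) (here refl) ne
      z≢p : z ≢ p
      z≢p = λ { refl → path-∉ π (there p∈) }
      cases : ∀ k → ¬ Surv A (suc f) k vis x → Dec (D x ≡ 2) → D w ≤ t × 1 ≤ hits A (suc f) k p x w
      cases k ¬s (yes e) = let b , h = IH k (λ s → ¬s (pass x∉ e a s)) in b , hits-pass A f k p x z w e a z≢p h
      cases zero ¬s (no ne) = ⊥-elim (¬s (zro x∉ ne))
      cases (suc k) ¬s (no ne) = let b , h = IH k (λ s → ¬s (branch x∉ ne a s)) in
        b , hits-branch A f k p x z w ne (λ b → ¬s (big x∉ b)) a z≢p h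

    module Bound (A : Fin n → Fin n → Bool) (A-sym : ∀ i j → A i j ≡ true → A j i ≡ true)
      (A-deg : ∀ v → ∑ V (λ z → 𝟙 (A v z)) ≡ D v) where

      onward-count : ∀ {x p} → A x p ≡ true → suc (∑ V (λ z → 𝟙 (A x z ∧ not (z =ᶠ p)))) ≤ D x
      onward-count {x} {p} a = begin
        1 + ∑ V (λ z → 𝟙 (A x z ∧ not (z =ᶠ p)))           ≡⟨ cong (_+ ∑ V (λ z → 𝟙 (A x z ∧ not (z =ᶠ p)))) (∑-δ-all p) ⟨
        ∑ V (δ p) + ∑ V (λ z → 𝟙 (A x z ∧ not (z =ᶠ p)))   ≡⟨ ∑-+ V _ _ ⟨
        ∑ V (λ z → δ p z + 𝟙 (A x z ∧ not (z =ᶠ p)))       ≤⟨ ∑-mono V (λ {z} _ → le z) ⟩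
        ∑ V (λ z → 𝟙 (A x z))                              ≡⟨ A-deg x ⟩
        D x                                                ∎
        where
        open ≤-Reasoning
        le : ∀ z → δ p z + 𝟙 (A x z ∧ not (z =ᶠ p)) ≤ 𝟙 (A x z)
        le z with p ≟F z
        ... | yes refl rewrite δ-refl p | a | =ᶠ-refl p = ≤-refl
        ... | no h rewrite δ-≢ h | ≢⇒=ᶠ (h ∘ sym) with A x z
        ...   | true = ≤-refl
        ...   | false = z≤n

      -- The edge back to `p` takes one from the degree. At degree 2 a single continuation remains,
      -- so chains of such vertices leave the mass unchanged; elsewhere there are at most `t`
      -- continuations, each with a smaller `k`.
      hits-bound : ∀ f k p x → A x p ≡ true → ∑ V (hits A f k p x) ≤ cap k
      pass-bound : ∀ f k p x → A x p ≡ true → D x ≡ 2 → ∑ V (λ w → onward A p x (λ z → hits A f k x z w)) ≤ cap k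
      pass-bound f k p x a e = begin
        ∑ V (λ w → onward A p x (λ z → hits A f k x z w))   ≡⟨ onward-∑ A p x (hits A f k x) ⟩
        onward A p x (λ z → ∑ V (hits A f k x z))           ≤⟨ onward-≤ A p x _ (cap k) (λ z xz → hits-bound f k x z (A-sym x z xz)) ⟩
        ∑ V (λ z → 𝟙 (A x z ∧ not (z =ᶠ p))) * cap k        ≤⟨ *-monoˡ-≤ (cap k) (ℕ.s≤s⁻¹ (≤-trans (onward-count a) (≤-reflexive e))) ⟩
        1 * cap k                                           ≡⟨ *-identityˡ (cap k) ⟩
        cap k                                               ∎
        where open ≤-Reasoning
      hits-bound zero k p x a = ≤-trans (≤-reflexive (∑-0 V)) z≤n
      hits-bound (suc f) zero p x a with D x ≡ᵇ 2 in eq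
      ... | true = pass-bound f zero p x a (≡ᵇ⇒≡ _ _ (≡⇒T eq))
      ... | false = ≤-reflexive (∑-δ-all x)
      hits-bound (suc f) (suc k) p x a with D x ≡ᵇ 2 in eq
      ... | true = pass-bound f (suc k) p x a (≡ᵇ⇒≡ _ _ (≡⇒T eq))
      ... | false with t <ᵇ D x in eq₂
      ...   | true = ≤-trans (≤-reflexive (trans (∑-cong V (λ w → +-identityʳ (δ x w))) (∑-δ-all x))) (s≤s z≤n)
      ...   | false = begin
        ∑ V (λ w → δ x w + onward A p x (λ z → hits A f k x z w))     ≡⟨ ∑-+ V _ _ ⟩
        ∑ V (δ x) + ∑ V (λ w → onward A p x (λ z → hits A f k x z w)) ≡⟨ cong₂ _+_ (∑-δ-all x) (onward-∑ A p x (hits A f k x)) ⟩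
        1 + onward A p x (λ z → ∑ V (hits A f k x z))                 ≤⟨ s≤s (onward-≤ A p x _ (cap k) (λ z xz → hits-bound f k x z (A-sym x z xz))) ⟩
        1 + ∑ V (λ z → 𝟙 (A x z ∧ not (z =ᶠ p))) * cap k              ≤⟨ s≤s (*-monoˡ-≤ (cap k) (≤-trans (n≤1+n _) (≤-trans (onward-count a) Dx≤t))) ⟩
        1 + t * cap k                                                 ∎
        where
        open ≤-Reasoning
        Dx≤t : D x ≤ t
        Dx≤t = ≮⇒≥ λ b → false≢true eq₂ (T⇒≡ (<⇒<ᵇ b))

  -- Surviving darts at a vertex and in a graph

  𝟙≤1 : ∀ b → 𝟙 b ≤ 1
  𝟙≤1 true = ≤-refl
  𝟙≤1 false = z≤n

  𝟙-pos : ∀ {b} → 1 ≤ 𝟙 b → b ≡ true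
  𝟙-pos {true} _ = refl

  sg : ℕ → ℕ
  sg zero = 0
  sg (suc _) = 1

  sg≤1 : ∀ m → sg m ≤ 1
  sg≤1 zero = z≤n
  sg≤1 (suc _) = ≤-refl

  sg≤ : ∀ m → sg m ≤ m
  sg≤ zero = z≤n
  sg≤ (suc m) = s≤s z≤n

  sg-pos : ∀ {m} → 1 ≤ m → sg m ≡ 1
  sg-pos (s≤s _) = refl

  ≤1-cases : ∀ {m} → m ≤ 1 → m ≡ 0 ⊎ m ≡ 1
  ≤1-cases z≤n = inj₁ refl
  ≤1-cases (s≤s z≤n) = inj₂ refl

  -- b marks the darts that have a marked dart beside them. The trivial bound for ∑ b is (d ∸ 1) * c; the surplus ∑ a b,
  -- due to vertices with two marked darts, is what makes survival decay although the expected offspring may be 1.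
  module Marked {n : ℕ} (A : Fin n → Bool) (a : Fin n → ℕ) (a≤A : ∀ x → a x ≤ 𝟙 (A x)) where
    private
      V = allFin n
    others : Fin n → ℕ
    others x = ∑ V (λ z → 𝟙 (not (z =ᶠ x)) * a z)
    b : Fin n → ℕ
    b x = 𝟙 (A x) * sg (others x)
    d c : ℕ
    d = ∑ V (λ x → 𝟙 (A x))
    c = ∑ V a

    others+ : ∀ x → others x + a x ≡ c
    others+ x = begin
      others x + a x                                           ≡⟨ cong (others x +_) (∑-δ x V a (allFin⁺ n) (∈-allFin x)) ⟨
      others x + ∑ V (λ z → δ x z * a z)                       ≡⟨ ∑-+ V _ _ ⟨
      ∑ V (λ z → 𝟙 (not (z =ᶠ x)) * a z + δ x z * a z)         ≡⟨ ∑-cong V pt ⟩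
      c                                                        ∎
      where
      open ≡-Reasoning
      pt : ∀ z → 𝟙 (not (z =ᶠ x)) * a z + δ x z * a z ≡ a z
      pt z with x ≟F z
      ... | yes refl rewrite =ᶠ-refl x = +-identityʳ (a x)
      ... | no h rewrite ≢⇒=ᶠ h | ≢⇒=ᶠ (h ∘ sym) = trans (+-identityʳ _) (+-identityʳ (a z))

    b≤A : ∀ x → b x ≤ 𝟙 (A x)
    b≤A x = ≤-trans (*-monoʳ-≤ (𝟙 (A x)) (sg≤1 (others x))) (≤-reflexive (*-identityʳ _))

    a≤1 : ∀ x → a x ≤ 1
    a≤1 x = ≤-trans (a≤A x) (𝟙≤1 (A x))

    a*b≤a : ∀ x → a x * b x ≤ a x
    a*b≤a x = ≤-trans (*-monoʳ-≤ (a x) (≤-trans (b≤A x) (𝟙≤1 (A x)))) (≤-reflexive (*-identityʳ (a x)))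

    -- By the number `c` of marked darts. With none, both sums on the left vanish. With one, that
    -- dart has no marked dart beside it, so at most d - 1 darts are counted and none of them is
    -- marked. With two or more, `b` is at most 1 on each of the `d` darts, and 2d + c ≤ 2(d - 1)c
    -- since then d ≥ 3. This is an equality for d = 3 and c = 2 and fails for d = c = 2.
    surplus : d ≢ 2 → 2 * ∑ V b + ∑ V (λ x → a x * b x) ≤ 2 * ((d ∸ 1) * c)
    surplus d≢2 = by c refl
      where
      open ≤-Reasoning
      by : ∀ m → c ≡ m → 2 * ∑ V b + ∑ V (λ x → a x * b x) ≤ 2 * ((d ∸ 1) * c)
      by zero e = ≤-trans (≤-reflexive (cong₂ (λ p q → 2 * p + q) (trans (∑-cong V b0) (∑-0 V))
                    (trans (∑-cong V (λ x → trans (cong (a x *_) (b0 x)) (*-zeroʳ (a x)))) (∑-0 V)))) z≤n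
        where
        b0 : ∀ x → b x ≡ 0
        b0 x rewrite m+n≡0⇒m≡0 (others x) (trans (others+ x) e) = *-zeroʳ (𝟙 (A x))
      by (suc zero) e = begin
        2 * ∑ V b + ∑ V (λ x → a x * b x)  ≡⟨ cong (2 * ∑ V b +_) (trans (∑-cong V ab0) (∑-0 V)) ⟩
        2 * ∑ V b + 0                      ≡⟨ +-identityʳ _ ⟩
        2 * ∑ V b                          ≤⟨ *-monoʳ-≤ 2 (∸-monoˡ-≤ 1 plus) ⟩
        2 * (d ∸ 1)                        ≡⟨ cong (2 *_) (trans (cong ((d ∸ 1) *_) e) (*-identityʳ (d ∸ 1))) ⟨
        2 * ((d ∸ 1) * c)                  ∎
        where
        pt : ∀ x → a x ≡ 0 ⊎ (a x ≡ 1 × b x ≡ 0)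
        pt x with ≤1-cases (a≤1 x)
        ... | inj₁ z = inj₁ z
        ... | inj₂ o = inj₂ (o , trans (cong (λ k → 𝟙 (A x) * sg k) (+-cancelʳ-≡ (a x) (others x) 0
                         (trans (others+ x) (trans e (sym o))))) (*-zeroʳ (𝟙 (A x))))
        ab0 : ∀ x → a x * b x ≡ 0
        ab0 x with pt x
        ... | inj₁ z rewrite z = refl
        ... | inj₂ (_ , z) = trans (cong (a x *_) z) (*-zeroʳ (a x))
        le : ∀ x → a x + b x ≤ 𝟙 (A x)
        le x with pt x
        ... | inj₁ z = ≤-trans (≤-reflexive (cong (_+ b x) z)) (b≤A x)
        ... | inj₂ (_ , z) = ≤-trans (≤-reflexive (trans (cong (a x +_) z) (+-identityʳ (a x)))) (a≤A x)
        plus : suc (∑ V b) ≤ d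
        plus = begin
          1 + ∑ V b              ≡⟨ cong (_+ ∑ V b) e ⟨
          c + ∑ V b              ≡⟨ ∑-+ V a b ⟨
          ∑ V (λ x → a x + b x)  ≤⟨ ∑-mono V (λ {x} _ → le x) ⟩
          d                      ∎
      by (suc (suc m)) e = begin
        2 * ∑ V b + ∑ V (λ x → a x * b x)  ≤⟨ +-mono-≤ (*-monoʳ-≤ 2 (∑-mono V (λ {x} _ → b≤A x))) (∑-mono V (λ {x} _ → a*b≤a x)) ⟩
        2 * d + c                          ≤⟨ arith d c d≢2 (≤-trans (s≤s (s≤s z≤n)) (≤-reflexive (sym e))) (∑-mono V (λ {x} _ → a≤A x)) ⟩
        2 * ((d ∸ 1) * c)                  ∎
        where
        poly : ∀ p q → 2 * (3 + p) + (2 + q) + (3 * q + 2 * p + 2 * (p * q)) ≡ 2 * ((2 + p) * (2 + q))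
        poly = solve-∀
        arith : ∀ d c → d ≢ 2 → 2 ≤ c → c ≤ d → 2 * d + c ≤ 2 * ((d ∸ 1) * c)
        arith zero c ne l₁ l₂ = ⊥-elim (<⇒≱ (≤-trans (s≤s z≤n) l₁) l₂)
        arith (suc zero) c ne l₁ l₂ = ⊥-elim (<-irrefl refl (≤-trans l₁ l₂))
        arith (suc (suc zero)) c ne l₁ l₂ = ⊥-elim (ne refl)
        arith (suc (suc (suc p))) (suc (suc q)) ne _ _ = ≤-trans (m≤m+n _ _) (≤-reflexive (poly p q))
        arith (suc (suc (suc p))) (suc zero) ne (s≤s ()) _

  module Count {n : ℕ} (D : DegSeq n) (t : ℕ) where
    open Explore D t
    private
      V = allFin n

    Adj : Set
    Adj = Fin n → Fin n → Bool

    -- Pairs (u , x) stand for darts, i.e. edges with a direction. α tells that the exploration along a dart survives k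
    -- branchings, β that the exploration from its tail along some other dart does.
    α β : Adj → ℕ → Fin n → Fin n → ℕ
    α A k u x = 𝟙 (A u x) * 𝟙 ⌊ surv? A n k (u ∷ []) x ⌋
    β A k u x = 𝟙 (A u x) * sg (∑ V (λ z → 𝟙 (not (z =ᶠ x)) * α A k u z))

    α≤A : ∀ A k u x → α A k u x ≤ 𝟙 (A u x)
    α≤A A k u x = ≤-trans (*-monoʳ-≤ (𝟙 (A u x)) (𝟙≤1 ⌊ surv? A n k (u ∷ []) x ⌋)) (≤-reflexive (*-identityʳ _))

    α⁺ : ∀ {A k u x} → A u x ≡ true → Surv A n k (u ∷ []) x → α A k u x ≡ 1
    α⁺ {A} {k} {u} {x} a s = trans (cong (λ b → 𝟙 b * 𝟙 ⌊ surv? A n k (u ∷ []) x ⌋) a)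
      (trans (+-identityʳ _) (cong 𝟙 (T⇒≡ (fromWitness {a? = surv? A n k (u ∷ []) x} s))))

    α⁻ : ∀ {A k u x} → 1 ≤ α A k u x → A u x ≡ true × Surv A n k (u ∷ []) x
    α⁻ {A} {k} {u} {x} p with A u x
    ... | true = refl , toWitness (≡⇒T (𝟙-pos (≤-trans p (≤-reflexive (+-identityʳ _)))))

    α-pred : ∀ A k u x → α A (suc k) u x ≤ α A k u x
    α-pred A k u x with ≤1-cases (≤-trans (α≤A A (suc k) u x) (𝟙≤1 _))
    ... | inj₁ z = ≤-trans (≤-reflexive z) z≤n
    ... | inj₂ o with α⁻ {A} {suc k} (≤-reflexive (sym o))
    ...   | a , s = ≤-trans (≤-reflexive o) (≤-reflexive (sym (α⁺ a (surv-pred s))))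

    β⁺ : ∀ {A k u x z} → A u x ≡ true → z ≢ x → 1 ≤ α A k u z → β A k u x ≡ 1
    β⁺ {A} {k} {u} {x} {z} a z≢x h = trans (cong (λ b → 𝟙 b * sg (∑ V (λ z → 𝟙 (not (z =ᶠ x)) * α A k u z))) a)
      (trans (+-identityʳ _) (sg-pos (≤-trans (subst (1 ≤_) (sym e) h) (∑-term (λ z → 𝟙 (not (z =ᶠ x)) * α A k u z) (∈-allFin z)))))
      where
      e : 𝟙 (not (z =ᶠ x)) * α A k u z ≡ α A k u z
      e rewrite ≢⇒=ᶠ z≢x = +-identityʳ _

    β⁻ : ∀ {A k u x} → 1 ≤ β A k u x → A u x ≡ true × ∃ λ z → z ≢ x × A u z ≡ true × Surv A n k (u ∷ []) z
    β⁻ {A} {k} {u} {x} p with A u x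
    ... | true with ∑-pos V (λ z → 𝟙 (not (z =ᶠ x)) * α A k u z) (≤-trans p (≤-trans (≤-reflexive (+-identityʳ _)) (sg≤ _)))
    ...   | z , _ , q with z ≟F x
    ...     | yes refl rewrite =ᶠ-refl z with q
    ...       | ()
    β⁻ {A} {k} {u} {x} p | true | z , _ , q | no h rewrite ≢⇒=ᶠ h = refl , z , h , α⁻ (≤-trans q (≤-reflexive (+-identityʳ _)))

    β≤A : ∀ A k u x → β A k u x ≤ 𝟙 (A u x)
    β≤A A k u x = ≤-trans (*-monoʳ-≤ (𝟙 (A u x)) (sg≤1 _)) (≤-reflexive (*-identityʳ _))

    non2 small : Fin n → ℕ
    non2 u = 𝟙 (not (D u ≡ᵇ 2))
    small u = 𝟙 (not (t <ᵇ D u)) * non2 u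

    large : ℕ → Fin n → ℕ
    large s u = 𝟙 (s <ᵇ D u)

    -- `Q` sums d (d - 1) over the degrees from 3 to `t`, because degree 1 contributes 0. Thus Q / M
    -- is the size-biased mean number of onward darts, with the degrees above `t` left out.
    M Q : ℕ
    M = ∑ V (λ u → non2 u * D u)
    Q = ∑ V (λ u → (small u * (D u ∸ 1)) * D u)

    Big : ℕ → ℕ
    Big s = ∑ V (λ u → large s u * D u)

    -- X / M is the fraction of surviving darts in a single graph. `Bᵏ` counts the darts at small
    -- tails that have a survivor beside them, `Z` those among them that survive themselves, and `Y`
    -- is the bound for `Bᵏ` that counts every survivor with all darts beside it.
    X Bᵏ Z Y : Adj → ℕ → ℕ
    X A k = ∑ V (λ u → non2 u * ∑ V (α A k u))
    Bᵏ A k = ∑ V (λ u → small u * ∑ V (β A k u))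
    Z A k = ∑ V (λ u → small u * ∑ V (λ x → α A k u x * β A k u x))
    Y A k = ∑ V (λ u → (small u * (D u ∸ 1)) * ∑ V (α A k u))

    small≤non2 : ∀ u → small u ≤ non2 u
    small≤non2 u = ≤-trans (*-monoˡ-≤ (non2 u) (𝟙≤1 (not (t <ᵇ D u)))) (≤-reflexive (+-identityʳ _))

    small≤1 : ∀ u → small u ≤ 1
    small≤1 u = ≤-trans (small≤non2 u) (𝟙≤1 _)

    small⁻ : ∀ {u} → 1 ≤ small u → D u ≤ t × D u ≢ 2
    small⁻ {u} p with t <ᵇ D u in e₁ | D u ≡ᵇ 2 in e₂
    ... | false | false = ≮⇒≥ (λ b → false≢true e₁ (T⇒≡ (<⇒<ᵇ b))) , λ e → false≢true e₂ (T⇒≡ (≡⇒≡ᵇ _ _ e))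

    small⁺ : ∀ {u} → D u ≤ t → D u ≢ 2 → small u ≡ 1
    small⁺ {u} l ne with t <ᵇ D u in e₁ | D u ≡ᵇ 2 in e₂
    ... | false | false = refl
    ... | true | _ = ⊥-elim (<-irrefl refl (≤-trans (<ᵇ⇒< t (D u) (≡⇒T e₁)) l))
    ... | false | true = ⊥-elim (ne (≡ᵇ⇒≡ (D u) 2 (≡⇒T e₂)))

    non2⁺ : ∀ {u} → D u ≢ 2 → non2 u ≡ 1
    non2⁺ {u} ne with D u ≡ᵇ 2 in e
    ... | false = refl
    ... | true = ⊥-elim (ne (≡ᵇ⇒≡ (D u) 2 (≡⇒T e)))

    non2⁻ : ∀ {u} → 1 ≤ non2 u → D u ≢ 2
    non2⁻ {u} p e with D u ≡ᵇ 2 in q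
    ... | false = false≢true q (T⇒≡ (≡⇒≡ᵇ _ _ e))

    module Graph (2≤t : 2 ≤ t) (A : Adj) (A-sym : ∀ i j → A i j ≡ true → A j i ≡ true) (A-irr : ∀ v → A v v ≡ false)
      (A-deg : ∀ v → ∑ V (λ z → 𝟙 (A v z)) ≡ D v) where
      open Bound A A-sym A-deg

      ∑α≤D : ∀ k u → ∑ V (α A k u) ≤ D u
      ∑α≤D k u = ≤-trans (∑-mono V (λ {x} _ → α≤A A k u x)) (≤-reflexive (A-deg u))

      X≤M : ∀ k → X A k ≤ M
      X≤M k = ∑-mono V λ {u} _ → *-monoʳ-≤ (non2 u) (∑α≤D k u)

      X-pred : ∀ k → X A (suc k) ≤ X A k
      X-pred k = ∑-mono V λ {u} _ → *-monoʳ-≤ (non2 u) (∑-mono V (λ {x} _ → α-pred A k u x))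

      surplus-total : ∀ k → 2 * Bᵏ A k + Z A k ≤ 2 * Y A k
      surplus-total k = begin
        2 * Bᵏ A k + Z A k  ≡⟨ cong (_+ Z A k) (∑-*ˡ V 2 _) ⟨
        ∑ V (λ u → 2 * (small u * ∑ V (β A k u))) + Z A k   ≡⟨ ∑-+ V _ _ ⟨
        ∑ V (λ u → 2 * (small u * ∑ V (β A k u)) + small u * ∑ V (λ x → α A k u x * β A k u x))  ≤⟨ ∑-mono V (λ {u} _ → pt u) ⟩
        ∑ V (λ u → 2 * ((small u * (D u ∸ 1)) * ∑ V (α A k u)))  ≡⟨ ∑-*ˡ V 2 _ ⟩
        2 * Y A k ∎
        where
        open ≤-Reasoning
        pt : ∀ u → 2 * (small u * ∑ V (β A k u)) + small u * ∑ V (λ x → α A k u x * β A k u x) ≤ 2 * ((small u * (D u ∸ 1)) * ∑ V (α A k u))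
        pt u with ≤1-cases (small≤1 u)
        ... | inj₁ z rewrite z = z≤n
        ... | inj₂ o = scale o (A-deg u) (Marked.surplus (A u) (α A k u) (α≤A A k u)
                         (λ e → proj₂ (small⁻ {u} (≤-reflexive (sym o))) (trans (sym (A-deg u)) e)))
          where
          scale : ∀ {o d d′ b z c} → o ≡ 1 → d ≡ d′ → 2 * b + z ≤ 2 * ((d ∸ 1) * c) → 2 * (o * b) + o * z ≤ 2 * ((o * (d′ ∸ 1)) * c)
          scale {d = d} {b = b} {z} {c} refl refl h = subst₂ _≤_ (cong₂ (λ p q → 2 * p + q) (sym (*-identityˡ b)) (sym (*-identityˡ z)))
            (cong (λ p → 2 * (p * c)) (sym (*-identityˡ (d ∸ 1)))) h

      -- Reversing darts equates the sums over all heads and all tails. The darts with a tail of degree 2 contribute to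
      -- both and cancel, so that paths through vertices of degree 2 need not be followed to their ends.
      reversal : ∀ k → X A (suc k) ≤ Big t + Bᵏ A k
      reversal k = +-cancelˡ-≤ (∑ V (λ x → two x * out x)) _ _ (begin
        ∑ V (λ x → two x * out x) + X A (suc k)                       ≡⟨ ∑-+ V _ _ ⟨
        ∑ V (λ x → two x * out x + non2 x * out x)                    ≡⟨ ∑-cong V two+non2 ⟩
        ∑ V out                                                       ≡⟨ ∑-swap V V (α A (suc k)) ⟩
        ∑ V (λ x → ∑ V (λ u → α A (suc k) u x))                       ≤⟨ ∑-mono V (λ {x} _ → pt x) ⟩
        ∑ V (λ x → two x * out x + (large t x * D x + small x * ∑ V (β A k x))) ≡⟨ trans (∑-+ V _ _) (cong (∑ V (λ x → two x * out x) +_) (∑-+ V _ _)) ⟩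
        ∑ V (λ x → two x * out x) + (Big t + Bᵏ A k)                  ∎)
        where
        open ≤-Reasoning
        two out : Fin n → ℕ
        two x = 𝟙 (D x ≡ᵇ 2)
        out x = ∑ V (α A (suc k) x)
        two+non2 : ∀ x → two x * out x + non2 x * out x ≡ out x
        two+non2 x with D x ≡ᵇ 2
        ... | true = trans (+-identityʳ _) (+-identityʳ _)
        ... | false = +-identityʳ _
        -- A survivor that enters `x` from `u` leaves to the other neighbour `z`. Passing `x` costs
        -- no branching, so the dart from `x` to `z` survives at the same level, and each `z` arises
        -- from at most one `u`.
        through2 : ∀ x → D x ≡ 2 → ∑ V (λ u → α A (suc k) u x) ≤ out x
        through2 x e = begin
          ∑ V (λ u → α A (suc k) u x)                                           ≤⟨ ∑-mono V (λ {u} _ → one u) ⟩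
          ∑ V (λ u → ∑ V (λ z → 𝟙 (A x u ∧ not (u =ᶠ z)) * α A (suc k) x z))    ≡⟨ ∑-swap V V _ ⟩
          ∑ V (λ z → ∑ V (λ u → 𝟙 (A x u ∧ not (u =ᶠ z)) * α A (suc k) x z))    ≡⟨ ∑-cong V (λ z → ∑-*ʳ V (α A (suc k) x z) _) ⟩
          ∑ V (λ z → ∑ V (λ u → 𝟙 (A x u ∧ not (u =ᶠ z))) * α A (suc k) x z)    ≤⟨ ∑-mono V (λ {z} _ → two′ z) ⟩
          out x                                                                 ∎
          where
          one : ∀ u → α A (suc k) u x ≤ ∑ V (λ z → 𝟙 (A x u ∧ not (u =ᶠ z)) * α A (suc k) x z)
          one u with ≤1-cases (≤-trans (α≤A A (suc k) u x) (𝟙≤1 _))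
          ... | inj₁ z = ≤-trans (≤-reflexive z) z≤n
          ... | inj₂ o with α⁻ {A} {suc k} (≤-reflexive (sym o))
          ...   | a , s = ≤-trans (≤-reflexive o) (via s refl)
            where
            via : ∀ {f} → Surv A f (suc k) (u ∷ []) x → f ≡ n → 1 ≤ ∑ V (λ z → 𝟙 (A x u ∧ not (u =ᶠ z)) * α A (suc k) x z)
            via (big _ b) _ = ⊥-elim (<-irrefl refl (≤-trans (≤-trans b (≤-reflexive e)) 2≤t))
            via (branch _ ne _ _) _ = ⊥-elim (ne e)
            via (pass {z = z} x∉ _ xz s′) refl = ≤-trans (≤-reflexive (sym val)) (∑-term (λ z → 𝟙 (A x u ∧ not (u =ᶠ z)) * α A (suc k) x z) (∈-allFin z))
              where
              val : 𝟙 (A x u ∧ not (u =ᶠ z)) * α A (suc k) x z ≡ 1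
              val rewrite A-sym u x a | ≢⇒=ᶠ {i = u} {z} (λ { refl → surv-∉ s′ (there (here refl)) }) =
                trans (+-identityʳ _) (α⁺ xz (surv-mono (n≤1+n _) (λ { (here q) → here q }) s′))
          two′ : ∀ z → ∑ V (λ u → 𝟙 (A x u ∧ not (u =ᶠ z))) * α A (suc k) x z ≤ α A (suc k) x z
          two′ z with ≤1-cases (≤-trans (α≤A A (suc k) x z) (𝟙≤1 _))
          ... | inj₁ q rewrite q = ≤-reflexive (*-zeroʳ (∑ V (λ u → 𝟙 (A x u ∧ not (u =ᶠ z)))))
          ... | inj₂ o with α⁻ {A} {suc k} (≤-reflexive (sym o))
          ...   | a , _ = ≤-trans (*-monoˡ-≤ (α A (suc k) x z) (ℕ.s≤s⁻¹ (≤-trans (onward-count a) (≤-reflexive e)))) (≤-reflexive (*-identityˡ _))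
        in≤ : ∀ x → ∑ V (λ u → α A (suc k) u x) ≤ D x
        in≤ x = ≤-trans (∑-mono V (λ {u} _ → ≤-trans (α≤A A (suc k) u x) (≤-reflexive (cong 𝟙 (bool-ext (A-sym u x) (A-sym x u)))))) (≤-reflexive (A-deg x))
        pt : ∀ x → ∑ V (λ u → α A (suc k) u x) ≤ two x * out x + (large t x * D x + small x * ∑ V (β A k x))
        pt x with D x ≡ᵇ 2 in e₁ | t <ᵇ D x in e₂
        ... | true | _ = ≤-trans (through2 x (≡ᵇ⇒≡ _ _ (≡⇒T e₁))) (≤-trans (≤-reflexive (sym (+-identityʳ _))) (m≤m+n (out x + 0) _))
        ... | false | true = ≤-trans (in≤ x) (≤-trans (≤-reflexive (sym (+-identityʳ (D x)))) (m≤m+n _ _))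
        ... | false | false = ≤-trans (∑-mono V (λ {u} _ → one u)) (≤-reflexive (sym (+-identityʳ _)))
          where
          one : ∀ u → α A (suc k) u x ≤ β A k x u
          one u with ≤1-cases (≤-trans (α≤A A (suc k) u x) (𝟙≤1 _))
          ... | inj₁ z = ≤-trans (≤-reflexive z) z≤n
          ... | inj₂ o with α⁻ {A} {suc k} (≤-reflexive (sym o))
          ...   | a , s = ≤-trans (≤-reflexive o) (via s refl)
            where
            via : ∀ {f} → Surv A f (suc k) (u ∷ []) x → f ≡ n → 1 ≤ β A k x u
            via (big _ b) _ = ⊥-elim (false≢true e₂ (T⇒≡ (<⇒<ᵇ b)))
            via (pass _ e _ _) _ = ⊥-elim (false≢true e₁ (T⇒≡ (≡⇒≡ᵇ _ _ e)))
            -- The branching at `x` uses up one level: this is where `suc k` on the left turns into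
            -- `k` on the right.
            via (branch {z = z} x∉ _ xz s′) refl = ≤-reflexive (sym (β⁺ {A} {k} (A-sym u x a) (λ { refl → surv-∉ s′ (there (here refl)) })
              (≤-reflexive (sym (α⁺ xz (surv-mono (n≤1+n _) (λ { (here q) → here q }) s′))))))

  -- Double counting of pairs of darts

  module Pairs {n : ℕ} (D : DegSeq n) (t : ℕ) (2≤t : 2 ≤ t) (t₂ : ℕ) (k : ℕ) where
    open Switching D
    open Switches D hiding (Adj)
    open Explore D t
    open Count D t

    Γ : Set
    Γ = List (Edge n)

    𝒢 : List Γ
    𝒢 = realisations D

    ∑⁴ : (Fin n → Fin n → Fin n → Fin n → ℕ) → ℕ
    ∑⁴ f = ∑ V λ u → ∑ V λ x → ∑ V λ a → ∑ V λ y → f u x a y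

    ∑⁴-mono : ∀ {f g : Fin n → Fin n → Fin n → Fin n → ℕ} → (∀ u x a y → f u x a y ≤ g u x a y) → ∑⁴ f ≤ ∑⁴ g
    ∑⁴-mono h = ∑-mono V λ {u} _ → ∑-mono V λ {x} _ → ∑-mono V λ {a} _ → ∑-mono V λ {y} _ → h u x a y

    ∑⁴-cong : ∀ {f g : Fin n → Fin n → Fin n → Fin n → ℕ} → (∀ u x a y → f u x a y ≡ g u x a y) → ∑⁴ f ≡ ∑⁴ g
    ∑⁴-cong h = ∑-cong V λ u → ∑-cong V λ x → ∑-cong V λ a → ∑-cong V λ y → h u x a y

    ∑⁴-+ : ∀ f g → ∑⁴ (λ u x a y → f u x a y + g u x a y) ≡ ∑⁴ f + ∑⁴ g
    ∑⁴-+ f g = trans (∑-cong V λ u → trans (∑-cong V λ x → trans (∑-cong V λ a → ∑-+ V _ _) (∑-+ V _ _)) (∑-+ V _ _)) (∑-+ V _ _)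

    ∑⁴-* : ∀ c f → ∑⁴ (λ u x a y → c * f u x a y) ≡ c * ∑⁴ f
    ∑⁴-* c f = trans (∑-cong V λ u → trans (∑-cong V λ x → trans (∑-cong V λ a → ∑-*ˡ V c _) (∑-*ˡ V c _)) (∑-*ˡ V c _)) (∑-*ˡ V c _)

    ∑⁴-product : ∀ (f g : Fin n → Fin n → ℕ) → ∑⁴ (λ u x a y → f u x * g a y) ≡ ∑ V (λ u → ∑ V (f u)) * ∑ V (λ a → ∑ V (g a))
    ∑⁴-product f g = trans (∑-cong V λ u → trans (∑-cong V λ x → trans (∑-cong V λ a → ∑-*ˡ V (f u x) (g a)) (∑-*ˡ V (f u x) _))
      (∑-*ʳ V _ (f u))) (∑-*ʳ V _ (λ u → ∑ V (f u)))

    ∑⁴-exchange : ∀ f → ∑⁴ (λ u x a y → f u y a x) ≡ ∑⁴ f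
    ∑⁴-exchange f = ∑-cong V λ u → trans (∑-swap V V _) (trans (∑-cong V λ a → ∑-swap V V _) (∑-swap V V _))

    ∑𝒢-∑⁴ : ∀ (f : Γ → Fin n → Fin n → Fin n → Fin n → ℕ) → ∑ 𝒢 (λ G → ∑⁴ (f G)) ≡ ∑⁴ (λ u x a y → ∑ 𝒢 (λ G → f G u x a y))
    ∑𝒢-∑⁴ f = trans (∑-swap 𝒢 V _) (∑-cong V λ u → trans (∑-swap 𝒢 V _) (∑-cong V λ x → trans (∑-swap 𝒢 V _) (∑-cong V λ a → ∑-swap 𝒢 V _)))

    -- After the switching the darts are `u y` and `a x`, so `F′` is read with the heads exchanged,
    -- which a sum over all quadruples does not notice. Quadruples that cannot be switched are
    -- charged to `E`.
    transport : ∀ (F F′ E : Γ → Fin n → Fin n → Fin n → Fin n → ℕ)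
      → (∀ {G G′} u x a y → G ∈ 𝒢 → G′ ∈ 𝒢 → Switched (adj G) (adj G′) u x a y → F G u x a y ≤ F′ G′ u y a x + E G u x a y)
      → (∀ {G} u x a y → G ∈ 𝒢 → valid (adj G) u x a y ≡ false → F G u x a y ≤ E G u x a y)
      → ∑ 𝒢 (λ G → ∑⁴ (F G)) ≤ ∑ 𝒢 (λ G → ∑⁴ (F′ G)) + ∑ 𝒢 (λ G → ∑⁴ (E G))
    transport F F′ E h h₂ = begin
      ∑ 𝒢 (λ G → ∑⁴ (F G))                                        ≡⟨ ∑𝒢-∑⁴ F ⟩
      ∑⁴ (λ u x a y → ∑ 𝒢 (λ G → F G u x a y))                    ≤⟨ ∑⁴-mono fixed ⟩
      ∑⁴ (λ u x a y → ∑ 𝒢 (λ G → F′ G u y a x) + ∑ 𝒢 (λ G → E G u x a y))  ≡⟨ ∑⁴-+ (λ u x a y → ∑ 𝒢 (λ G → F′ G u y a x)) _ ⟩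
      ∑⁴ (λ u x a y → ∑ 𝒢 (λ G → F′ G u y a x)) + ∑⁴ (λ u x a y → ∑ 𝒢 (λ G → E G u x a y))
        ≡⟨ cong₂ _+_ (trans (∑⁴-exchange (λ u x a y → ∑ 𝒢 (λ G → F′ G u x a y))) (sym (∑𝒢-∑⁴ F′))) (sym (∑𝒢-∑⁴ E)) ⟩
      ∑ 𝒢 (λ G → ∑⁴ (F′ G)) + ∑ 𝒢 (λ G → ∑⁴ (E G))                ∎
      where
      open ≤-Reasoning
      fixed : ∀ u x a y → ∑ 𝒢 (λ G → F G u x a y) ≤ ∑ 𝒢 (λ G → F′ G u y a x) + ∑ 𝒢 (λ G → E G u x a y)
      fixed u x a y = begin
        -- `E` belongs to the graph before the switching and must stay with it, so only the excess
        -- of `F` over `E` is transported.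
        ∑ 𝒢 (λ G → F G u x a y)                                   ≤⟨ ∑-mono 𝒢 le ⟩
        ∑ 𝒢 (λ G → ok G * (F G u x a y ∸ E G u x a y) + E G u x a y)  ≡⟨ ∑-+ 𝒢 _ _ ⟩
        ∑ 𝒢 (λ G → ok G * (F G u x a y ∸ E G u x a y)) + ∑ 𝒢 (λ G → E G u x a y)
          ≤⟨ +-monoˡ-≤ _ (switch-sum u x a y _ (λ G → F′ G u y a x) (λ {G} {G′} m m′ sw →
               ≤-trans (∸-monoˡ-≤ (E G u x a y) (h u x a y m m′ sw)) (≤-reflexive (m+n∸n≡m (F′ G′ u y a x) (E G u x a y))))) ⟩
        ∑ 𝒢 (λ G → F′ G u y a x) + ∑ 𝒢 (λ G → E G u x a y)       ∎
        where
        ok : Γ → ℕ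
        ok G = 𝟙 (valid (adj G) u x a y)
        le : ∀ {G} → G ∈ 𝒢 → F G u x a y ≤ ok G * (F G u x a y ∸ E G u x a y) + E G u x a y
        le {G} m with valid (adj G) u x a y in eq
        ... | false = h₂ u x a y m eq
        ... | true = ≤-trans (m≤n+m∸n (F G u x a y) (E G u x a y)) (≤-reflexive (trans (+-comm (E G u x a y) _) (cong (_+ E G u x a y) (sym (+-identityʳ _)))))

    sm₂ : Fin n → ℕ
    sm₂ v = 𝟙 (not (t₂ <ᵇ D v))

    sm₂+large : ∀ v → large t₂ v + sm₂ v ≡ 1
    sm₂+large v with t₂ <ᵇ D v
    ... | true = refl
    ... | false = refl

    sm₂-≤ : ∀ v → sm₂ v * D v ≤ sm₂ v * t₂
    sm₂-≤ v with t₂ <ᵇ D v in e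
    ... | true = z≤n
    ... | false = *-monoʳ-≤ 1 (≮⇒≥ λ b → false≢true e (T⇒≡ (<⇒<ᵇ b)))

    -- The first dart starts at a degree of at most `t`, so that the explorations along all darts at
    -- `u` have bounded total mass. The second may start at any degree other than 2, because summing
    -- over it has to yield `M` or `X`.
    tail : Adj → Fin n → Fin n → ℕ
    tail A u x = small u * 𝟙 (A u x)
    head : Adj → Fin n → Fin n → ℕ
    head A a y = non2 a * 𝟙 (A a y)

    -- All neighbours `z` of `u` are explored and not only `x`, because `β` at `u x` rests on a
    -- survivor along another dart.
    H : Adj → Fin n → Fin n → ℕ
    H A u a = ∑ V (λ z → 𝟙 (A u z) * hits A n k u z a)

    -- Reasons for which a pair of darts cannot be switched or a surviving path is disturbed. Degrees above t₂ are charged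
    -- to obstruction₇, so that each of the others affects a bounded number of darts for a fixed partner.
    obstruction₃ obstruction₄ obstruction₅ obstruction₆ obstruction₇ obstruction : Adj → Fin n → Fin n → Fin n → Fin n → ℕ
    obstruction₃ A u x a y = sm₂ y * (δ u y + 𝟙 (A u y))
    obstruction₄ A u x a y = sm₂ x * (sm₂ a * (δ x a + 𝟙 (A x a)))
    obstruction₅ A u x a y = sm₂ a * H A u a
    obstruction₆ A u x a y = hits A n k a y u
    obstruction₇ A u x a y = large t₂ a + (large t₂ x + large t₂ y)
    obstruction A u x a y = obstruction₃ A u x a y + (obstruction₄ A u x a y + (obstruction₅ A u x a y + (obstruction₆ A u x a y + obstruction₇ A u x a y)))

    -- The leading `t` dominates the weight `D u ∸ 1` in `F₁`.
    error : Γ → Fin n → Fin n → Fin n → Fin n → ℕ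
    error G u x a y = t * (tail (adj G) u x * (head (adj G) a y * obstruction (adj G) u x a y))

    1≤pick : ∀ p q r → p + q ≡ 1 → 1 ≤ r → 1 ≤ q * r + p
    1≤pick zero q r refl h = ≤-trans h (≤-reflexive (sym (trans (+-identityʳ _) (+-identityʳ r))))
    1≤pick (suc p) q r e h = ≤-trans (s≤s z≤n) (m≤n+m (suc p) (q * r))

    1≤pick₂ : ∀ p₁ q₁ p₂ q₂ r → p₁ + q₁ ≡ 1 → p₂ + q₂ ≡ 1 → 1 ≤ r → 1 ≤ q₁ * (q₂ * r) + (p₂ + p₁)
    1≤pick₂ p₁ q₁ p₂ q₂ r e e′ h with 1≤pick p₂ q₂ r e′ h
    ... | g with q₂ * r
    ...   | suc m = ≤-trans (1≤pick p₁ q₁ (suc m) e (s≤s z≤n)) (+-monoʳ-≤ (q₁ * suc m) (m≤n+m p₁ p₂))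
    ...   | zero = ≤-trans g (≤-trans (m≤m+n p₂ p₁) (m≤n+m (p₂ + p₁) (q₁ * 0)))

    module _ (A : Adj) (u x a y : Fin n) where
      private
        o₃ = obstruction₃ A u x a y
        o₄ = obstruction₄ A u x a y
        o₅ = obstruction₅ A u x a y
        o₆ = obstruction₆ A u x a y
        la = large t₂ a
        lx = large t₂ x
        ly = large t₂ y
      blocked-y : 1 ≤ δ u y + 𝟙 (A u y) → 1 ≤ obstruction A u x a y
      blocked-y h = ≤-trans (1≤pick ly (sm₂ y) (δ u y + 𝟙 (A u y)) (sm₂+large y) h) (≤-trans (m≤m+n (o₃ + ly) _) (≤-reflexive (p o₃ o₄ o₅ o₆ la lx ly)))
        where p : ∀ o₃ o₄ o₅ o₆ la lx ly → (o₃ + ly) + (o₄ + o₅ + o₆ + la + lx) ≡ o₃ + (o₄ + (o₅ + (o₆ + (la + (lx + ly)))))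
              p = solve-∀
      blocked-a : 1 ≤ δ x a + 𝟙 (A x a) → 1 ≤ obstruction A u x a y
      blocked-a h = ≤-trans (1≤pick₂ lx (sm₂ x) la (sm₂ a) (δ x a + 𝟙 (A x a)) (sm₂+large x) (sm₂+large a) h) (≤-trans (m≤m+n (o₄ + (la + lx)) _) (≤-reflexive (p o₃ o₄ o₅ o₆ la lx ly)))
        where p : ∀ o₃ o₄ o₅ o₆ la lx ly → (o₄ + (la + lx)) + (o₃ + o₅ + o₆ + ly) ≡ o₃ + (o₄ + (o₅ + (o₆ + (la + (lx + ly)))))
              p = solve-∀
      blocked-H : 1 ≤ H A u a → 1 ≤ obstruction A u x a y
      blocked-H h = ≤-trans (1≤pick la (sm₂ a) (H A u a) (sm₂+large a) h) (≤-trans (m≤m+n (o₅ + la) _) (≤-reflexive (p o₃ o₄ o₅ o₆ la lx ly)))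
        where p : ∀ o₃ o₄ o₅ o₆ la lx ly → (o₅ + la) + (o₃ + o₄ + o₆ + lx + ly) ≡ o₃ + (o₄ + (o₅ + (o₆ + (la + (lx + ly)))))
              p = solve-∀
      blocked-u : 1 ≤ hits A n k a y u → 1 ≤ obstruction A u x a y
      blocked-u h = ≤-trans h (≤-trans (m≤m+n o₆ _) (≤-reflexive (p o₃ o₄ o₅ o₆ la lx ly)))
        where p : ∀ o₃ o₄ o₅ o₆ la lx ly → o₆ + (o₃ + o₄ + o₅ + la + lx + ly) ≡ o₃ + (o₄ + (o₅ + (o₆ + (la + (lx + ly)))))
              p = solve-∀

    1≤H : ∀ A u z a → A u z ≡ true → 1 ≤ hits A n k u z a → 1 ≤ H A u a
    1≤H A u z a uz h = ≤-trans (subst (1 ≤_) (sym (trans (cong (λ b → 𝟙 b * hits A n k u z a) uz) (+-identityʳ _))) h)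
      (∑-term (λ z → 𝟙 (A u z) * hits A n k u z a) (∈-allFin z))

    blocked : ∀ A u x a y → (∀ i j → A i j ≡ true → A j i ≡ true) → valid A u x a y ≡ false
      → A u x ≡ false ⊎ A a y ≡ false ⊎ 1 ≤ obstruction A u x a y
    blocked A u x a y A-sym v with bool-cases (A u x) | bool-cases (A a y) | bool-cases (A u y) | bool-cases (A a x) | u ≟F y | a ≟F x
    ... | inj₂ ux | _ | _ | _ | _ | _ = inj₁ ux
    ... | inj₁ _ | inj₂ ay | _ | _ | _ | _ = inj₂ (inj₁ ay)
    ... | inj₁ _ | inj₁ _ | inj₁ uy | _ | _ | _ = inj₂ (inj₂ (blocked-y A u x a y (subst (λ b → 1 ≤ δ u y + 𝟙 b) (sym uy) (m≤n+m 1 (δ u y)))))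
    ... | inj₁ _ | inj₁ _ | inj₂ _ | inj₁ ax | _ | _ = inj₂ (inj₂ (blocked-a A u x a y (subst (λ b → 1 ≤ δ x a + 𝟙 b) (sym (A-sym a x ax)) (m≤n+m 1 (δ x a)))))
    ... | inj₁ _ | inj₁ _ | inj₂ _ | inj₂ _ | yes refl | _ = inj₂ (inj₂ (blocked-y A u x a y (subst (λ k → 1 ≤ k + 𝟙 (A u y)) (sym (δ-refl u)) (s≤s z≤n))))
    ... | inj₁ _ | inj₁ _ | inj₂ _ | inj₂ _ | no _ | yes refl = inj₂ (inj₂ (blocked-a A u x a y (subst (λ k → 1 ≤ k + 𝟙 (A x a)) (sym (δ-refl x)) (s≤s z≤n))))
    ... | inj₁ ux | inj₁ ay | inj₂ uy | inj₂ ax | no h | no h′ = ⊥-elim (false≢true v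
          (cong₂ _∧_ (cong₂ _∧_ ux ay) (cong₂ _∧_ (cong₂ _∧_ (cong not uy) (cong not ax)) (cong₂ _∧_ (cong not (≢⇒=ᶠ h)) (cong not (≢⇒=ᶠ h′))))))

    module _ {A A′ : Adj} {u x a y} (sw : Switched A A′ u x a y) (du : D u ≢ 2) (da : D a ≢ 2) where
      open Switched sw

      private
        rem0 : ∀ {s z} → s ≢ u → s ≢ a → z ≢ u → z ≢ a → rem u x a y s z ≡ 0
        rem0 {s} {z} su sa zu za rewrite δ-≢ (su ∘ sym) | δ-≢ (sa ∘ sym) | δ-≢ (zu ∘ sym) | δ-≢ (za ∘ sym) | *-zeroʳ (δ x s) | *-zeroʳ (δ y s) = refl
        remu : ∀ {z} → z ≢ x → rem u x a y u z ≡ 0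
        remu {z} zx rewrite δ-≢ (zx ∘ sym) | δ-≢ (u≢x ∘ sym) | δ-≢ (u≢a ∘ sym) | δ-≢ (u≢y ∘ sym) | *-zeroʳ (δ u u) = refl
        agree : ∀ s z → s ≢ u → s ≢ a → z ≢ u → z ≢ a → A s z ≡ true → A′ s z ≡ true
        agree s z su sa zu za p = keep s z p (rem0 su sa zu za)

      moved-front : Surv A n k (u ∷ []) x → α A′ k a x ≡ 1 ⊎ 1 ≤ obstruction A u x a y
      moved-front s with transfer {A} {A′} du da agree {vis′ = a ∷ []} {p = u} (here refl) (here refl) (λ { (here e) → inj₁ e }) (here refl) s
      ... | inj₁ s′ = inj₁ (α⁺ ax′ s′)
      ... | inj₂ h = inj₂ (blocked-H A u x a y (1≤H A u x a ux h))

      moved-back : Surv A n k (a ∷ []) y → α A′ k u y ≡ 1 ⊎ 1 ≤ obstruction A u x a y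
      moved-back s with transfer {A} {A′} da du (λ s z sa su za zu → agree s z su sa zu za) {vis′ = u ∷ []} {p = a} (here refl) (here refl) (λ { (here e) → inj₁ e }) (here refl) s
      ... | inj₁ s′ = inj₁ (α⁺ uy′ s′)
      ... | inj₂ h = inj₂ (blocked-u A u x a y h)

      -- The only edge that `u` loses is `u x`, so `u z` persists, and `z` differs from `y` because
      -- `u y` was no edge. The survivor is carried over with both `a` and `u` forbidden; forgetting
      -- `a` leaves the exploration along `u z`.
      unmoved : ∀ {z} → z ≢ x → A u z ≡ true → Surv A n k (u ∷ []) z → β A′ k u y ≡ 1 ⊎ 1 ≤ obstruction A u x a y
      unmoved {z} zx uz s with transfer {A} {A′} du da agree {vis′ = a ∷ u ∷ []} {p = u} (here refl) (here refl)
                                 (λ { (here e) → inj₁ e ; (there q) → inj₂ q }) (here refl) s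
      ... | inj₁ s′ = inj₁ (β⁺ {A′} {k} uy′ (λ { refl → false≢true ¬uy uz })
                         (≤-reflexive (sym (α⁺ (keep u z uz (remu zx)) (surv-mono ≤-refl there s′)))))
      ... | inj₂ h = inj₂ (blocked-H A u x a y (1≤H A u z a uz h))

    -- After the switching `x` hangs at `a` and `y` at `u`. From `F₁` to `F₁′` the survivor leaves
    -- the tail `u` that carries the weight. From `F₂` to `F₂′` the survivor at `a` moves to `u`,
    -- next to the one that is already there.
    F₁ F₁′ F₂ F₂′ : Γ → Fin n → Fin n → Fin n → Fin n → ℕ
    F₁ G u x a y = ((small u * (D u ∸ 1)) * α (adj G) k u x) * (non2 a * 𝟙 (adj G a y))
    F₁′ G u x a y = ((small u * (D u ∸ 1)) * 𝟙 (adj G u x)) * (non2 a * α (adj G) k a y)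
    F₂ G u x a y = (small u * β (adj G) k u x) * (non2 a * α (adj G) k a y)
    F₂′ G u x a y = (small u * (α (adj G) k u x * β (adj G) k u x)) * (non2 a * 𝟙 (adj G a y))

    within-error : ∀ {F} G u x a y → F ≤ t * (tail (adj G) u x * head (adj G) a y) → 1 ≤ obstruction (adj G) u x a y → F ≤ error G u x a y
    within-error G u x a y h o = ≤-trans h (*-monoʳ-≤ t (*-monoʳ-≤ (tail (adj G) u x)
      (≤-trans (≤-reflexive (sym (*-identityʳ _))) (*-monoʳ-≤ (head (adj G) a y) o))))

    small-t : ∀ u → small u * (D u ∸ 1) ≤ t * small u
    small-t u with ≤1-cases (small≤1 u)
    ... | inj₁ z rewrite z = z≤n
    ... | inj₂ o rewrite o = ≤-trans (≤-reflexive (+-identityʳ _)) (≤-trans (m∸n≤m (D u) 1)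
          (≤-trans (proj₁ (small⁻ {u} (≤-reflexive (sym o)))) (≤-reflexive (sym (*-identityʳ t)))))

    F₁-≤ : ∀ G u x a y → F₁ G u x a y ≤ t * (tail (adj G) u x * head (adj G) a y)
    F₁-≤ G u x a y = ≤-trans (*-monoˡ-≤ (head (adj G) a y) (*-mono-≤ (small-t u) (α≤A (adj G) k u x)))
      (≤-reflexive (p t (small u) (𝟙 (adj G u x)) (head (adj G) a y)))
      where p : ∀ t s e h → t * s * e * h ≡ t * ((s * e) * h)
            p = solve-∀

    F₂-≤ : ∀ G u x a y → F₂ G u x a y ≤ t * (tail (adj G) u x * head (adj G) a y)
    F₂-≤ G u x a y = ≤-trans (*-mono-≤ (*-monoʳ-≤ (small u) (β≤A (adj G) k u x)) (*-monoʳ-≤ (non2 a) (α≤A (adj G) k a y)))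
      (≤-trans (≤-reflexive (sym (+-identityʳ _))) (*-monoˡ-≤ (tail (adj G) u x * head (adj G) a y) (≤-trans (s≤s z≤n) 2≤t)))

    F₁-0 : ∀ G u x a y → adj G u x ≡ false ⊎ adj G a y ≡ false → t * (tail (adj G) u x * head (adj G) a y) ≡ 0
    F₁-0 G u x a y (inj₁ e) rewrite e | *-zeroʳ (small u) = *-zeroʳ t
    F₁-0 G u x a y (inj₂ e) rewrite e | *-zeroʳ (non2 a) | *-zeroʳ (tail (adj G) u x) = *-zeroʳ t

    invalid : ∀ {F} G u x a y → valid (adj G) u x a y ≡ false → F ≤ t * (tail (adj G) u x * head (adj G) a y) → F ≤ error G u x a y
    invalid G u x a y v h with blocked (adj G) u x a y (adj-sym G) v
    ... | inj₂ (inj₂ o) = within-error G u x a y h o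
    ... | inj₁ e = ≤-trans (≤-trans h (≤-reflexive (F₁-0 G u x a y (inj₁ e)))) z≤n
    ... | inj₂ (inj₁ e) = ≤-trans (≤-trans h (≤-reflexive (F₁-0 G u x a y (inj₂ e)))) z≤n

    private
      or-error : ∀ {F F′} G u x a y → F ≤ t * (tail (adj G) u x * head (adj G) a y) → F ≤ F′ ⊎ 1 ≤ obstruction (adj G) u x a y → F ≤ F′ + error G u x a y
      or-error G u x a y h (inj₁ l) = ≤-trans l (m≤m+n _ _)
      or-error {F′ = F′} G u x a y h (inj₂ o) = ≤-trans (within-error G u x a y h o) (m≤n+m _ F′)

    valid₁ : ∀ {G G′} u x a y → G ∈ 𝒢 → G′ ∈ 𝒢 → Switched (adj G) (adj G′) u x a y → F₁ G u x a y ≤ F₁′ G′ u y a x + error G u x a y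
    valid₁ {G} {G′} u x a y _ _ sw = or-error G u x a y (F₁-≤ G u x a y) go
      where
      go : F₁ G u x a y ≤ F₁′ G′ u y a x ⊎ 1 ≤ obstruction (adj G) u x a y
      go with ≤1-cases (small≤1 u) | ≤1-cases (𝟙≤1 (not (D a ≡ᵇ 2))) | ≤1-cases (≤-trans (α≤A (adj G) k u x) (𝟙≤1 _))
      ... | inj₁ z | _ | _ rewrite z = inj₁ z≤n
      ... | inj₂ _ | inj₁ z | _ rewrite z | *-zeroʳ (small u * (D u ∸ 1) * α (adj G) k u x) = inj₁ z≤n
      ... | inj₂ _ | inj₂ _ | inj₁ z rewrite z | *-zeroʳ (small u * (D u ∸ 1)) = inj₁ z≤n
      ... | inj₂ o₁ | inj₂ o₂ | inj₂ o₃ with moved-front sw (proj₂ (small⁻ {u} (≤-reflexive (sym o₁)))) (non2⁻ {a} (≤-reflexive (sym o₂))) (proj₂ (α⁻ {adj G} {k} (≤-reflexive (sym o₃))))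
      ...   | inj₂ o = inj₂ o
      ...   | inj₁ e = inj₁ (*-mono-≤ (*-monoʳ-≤ (small u * (D u ∸ 1)) (≤-reflexive (trans o₃ (sym (cong 𝟙 (Switched.uy′ sw))))))
                           (*-monoʳ-≤ (non2 a) (≤-trans (𝟙≤1 _) (≤-reflexive (sym e)))))

    valid₂ : ∀ {G G′} u x a y → G ∈ 𝒢 → G′ ∈ 𝒢 → Switched (adj G) (adj G′) u x a y → F₂ G u x a y ≤ F₂′ G′ u y a x + error G u x a y
    valid₂ {G} {G′} u x a y _ _ sw = or-error G u x a y (F₂-≤ G u x a y) go
      where
      go : F₂ G u x a y ≤ F₂′ G′ u y a x ⊎ 1 ≤ obstruction (adj G) u x a y
      go with ≤1-cases (small≤1 u) | ≤1-cases (𝟙≤1 (not (D a ≡ᵇ 2))) | ≤1-cases (≤-trans (β≤A (adj G) k u x) (𝟙≤1 _)) | ≤1-cases (≤-trans (α≤A (adj G) k a y) (𝟙≤1 _))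
      ... | inj₁ z | _ | _ | _ rewrite z = inj₁ z≤n
      ... | inj₂ _ | inj₁ z | _ | _ rewrite z | *-zeroʳ (small u * β (adj G) k u x) = inj₁ z≤n
      ... | inj₂ _ | inj₂ _ | inj₁ z | _ rewrite z | *-zeroʳ (small u) = inj₁ z≤n
      ... | inj₂ _ | inj₂ _ | inj₂ _ | inj₁ z rewrite z | *-zeroʳ (non2 a) | *-zeroʳ (small u * β (adj G) k u x) = inj₁ z≤n
      ... | inj₂ o₁ | inj₂ o₂ | inj₂ o₃ | inj₂ o₄ with β⁻ {adj G} {k} {u} {x} (≤-reflexive (sym o₃))
      ...   | _ , z , zx , uz , s with unmoved sw (proj₂ (small⁻ {u} (≤-reflexive (sym o₁)))) (non2⁻ {a} (≤-reflexive (sym o₂))) zx uz s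
                                    | moved-back sw (proj₂ (small⁻ {u} (≤-reflexive (sym o₁)))) (non2⁻ {a} (≤-reflexive (sym o₂))) (proj₂ (α⁻ {adj G} {k} (≤-reflexive (sym o₄))))
      ...     | inj₂ o | _ = inj₂ o
      ...     | inj₁ _ | inj₂ o = inj₂ o
      ...     | inj₁ b | inj₁ e = inj₁ (*-mono-≤ (*-monoʳ-≤ (small u) (≤-reflexive (trans o₃ (sym (cong₂ _*_ e b)))))
                           (*-monoʳ-≤ (non2 a) (≤-reflexive (trans o₄ (sym (cong 𝟙 (Switched.ax′ sw)))))))

  -- The error terms and the two decorrelation inequalities

  module Comparison {n : ℕ} (D : DegSeq n) (t : ℕ) (2≤t : 2 ≤ t) (t₂ : ℕ) (k : ℕ) where
    open Switching D
    open Switches D hiding (Adj)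
    open Explore D t
    open Count D t
    open Pairs D t 2≤t t₂ k

    -- The summands follow the order of the obstructions: with one dart of the pair fixed, each
    -- bounds the weighted number of partners.
    loss : ℕ
    loss = t₂ * (1 + t) + (t₂ * (1 + t₂) + (t₂ * (t * cap k) + (t * cap k + (Big t₂ + (Big t₂ + Big t₂)))))

    module OneGraph (A : Adj) (A-sym : ∀ i j → A i j ≡ true → A j i ≡ true) (A-deg : ∀ v → ∑ V (λ z → 𝟙 (A v z)) ≡ D v) where
      open Bound A A-sym A-deg

      row : ∀ (w g : Fin n → ℕ) → ∑ V (λ a → ∑ V (λ y → (w a * 𝟙 (A a y)) * g a)) ≡ ∑ V (λ a → w a * (D a * g a))
      row w g = ∑-cong V λ a → trans (∑-*ʳ V (g a) _) (trans (cong (_* g a) (trans (∑-*ˡ V (w a) _) (cong (w a *_) (A-deg a)))) (*-assoc (w a) (D a) (g a)))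

      col : ∀ (w g : Fin n → ℕ) → (∀ a → w a ≤ 1) → ∑ V (λ a → ∑ V (λ y → (w a * 𝟙 (A a y)) * g y)) ≤ ∑ V (λ y → D y * g y)
      col w g w≤1 = begin
        ∑ V (λ a → ∑ V (λ y → (w a * 𝟙 (A a y)) * g y))   ≡⟨ ∑-swap V V _ ⟩
        ∑ V (λ y → ∑ V (λ a → (w a * 𝟙 (A a y)) * g y))   ≤⟨ ∑-mono V (λ {y} _ → ∑-mono V (λ {a} _ → *-monoˡ-≤ (g y) (one a y))) ⟩
        ∑ V (λ y → ∑ V (λ a → 𝟙 (A y a) * g y))           ≡⟨ ∑-cong V (λ y → trans (∑-*ʳ V (g y) _) (cong (_* g y) (A-deg y))) ⟩
        ∑ V (λ y → D y * g y)                             ∎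
        where
        open ≤-Reasoning
        one : ∀ a y → w a * 𝟙 (A a y) ≤ 𝟙 (A y a)
        one a y = ≤-trans (*-monoˡ-≤ (𝟙 (A a y)) (w≤1 a)) (≤-reflexive (trans (+-identityʳ _) (cong 𝟙 (bool-ext (A-sym a y) (A-sym y a)))))

      ∑head : ∑ V (λ a → ∑ V (head A a)) ≡ M
      ∑head = ∑-cong V λ a → trans (∑-*ˡ V (non2 a) _) (cong (non2 a *_) (A-deg a))

      ∑tail : ∑ V (λ u → ∑ V (tail A u)) ≤ M
      ∑tail = ≤-trans (∑-mono V λ {u} _ → ∑-mono V λ {x} _ → *-monoˡ-≤ (𝟙 (A u x)) (small≤non2 u)) (≤-reflexive ∑head)

      weighted : (Fin n → Fin n → Fin n → Fin n → ℕ) → ℕ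
      weighted i = ∑⁴ (λ u x a y → tail A u x * (head A a y * i u x a y))

      weighted-+ : ∀ i j → weighted (λ u x a y → i u x a y + j u x a y) ≡ weighted i + weighted j
      weighted-+ i j = trans (∑⁴-cong λ u x a y → p (tail A u x) (head A a y) (i u x a y) (j u x a y)) (∑⁴-+ _ _)
        where p : ∀ s h i j → s * (h * (i + j)) ≡ s * (h * i) + s * (h * j)
              p = solve-∀

      weighted-tail : ∀ i c → (∀ u x → D u ≤ t → ∑ V (λ a → ∑ V (λ y → head A a y * i u x a y)) ≤ c) → weighted i ≤ M * c
      weighted-tail i c h = begin
        weighted i                                        ≡⟨ ∑-cong V (λ u → ∑-cong V (λ x → trans (∑-cong V (λ a → ∑-*ˡ V (tail A u x) _)) (∑-*ˡ V (tail A u x) _))) ⟩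
        ∑ V (λ u → ∑ V (λ x → tail A u x * inner u x))    ≤⟨ ∑-mono V (λ {u} _ → ∑-mono V (λ {x} _ → le u x)) ⟩
        ∑ V (λ u → ∑ V (λ x → tail A u x * c))            ≡⟨ trans (∑-cong V (λ u → ∑-*ʳ V c _)) (∑-*ʳ V c _) ⟩
        ∑ V (λ u → ∑ V (tail A u)) * c                    ≤⟨ *-monoˡ-≤ c ∑tail ⟩
        M * c                                             ∎
        where
        open ≤-Reasoning
        inner : Fin n → Fin n → ℕ
        inner u x = ∑ V (λ a → ∑ V (λ y → head A a y * i u x a y))
        le : ∀ u x → tail A u x * inner u x ≤ tail A u x * c
        le u x with ≤1-cases (small≤1 u)
        ... | inj₁ z rewrite z = z≤n
        ... | inj₂ o = *-monoʳ-≤ (tail A u x) (h u x (proj₁ (small⁻ {u} (≤-reflexive (sym o)))))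

      weighted-head : ∀ i c → (∀ a y → A a y ≡ true → ∑ V (λ u → ∑ V (λ x → tail A u x * i u x a y)) ≤ c) → weighted i ≤ M * c
      weighted-head i c h = begin
        weighted i                                        ≡⟨ trans (∑-cong V λ u → trans (∑-swap V V _) (∑-cong V λ a → ∑-swap V V _)) (trans (∑-swap V V _) (∑-cong V λ a → ∑-swap₃ a)) ⟩
        ∑ V (λ a → ∑ V (λ y → ∑ V (λ u → ∑ V (λ x → tail A u x * (head A a y * i u x a y)))))
          ≡⟨ ∑-cong V (λ a → ∑-cong V (λ y → trans (∑-cong V (λ u → trans (∑-cong V (λ x → p (tail A u x) (head A a y) (i u x a y))) (∑-*ˡ V (head A a y) _))) (∑-*ˡ V (head A a y) _))) ⟩
        ∑ V (λ a → ∑ V (λ y → head A a y * inner a y))    ≤⟨ ∑-mono V (λ {a} _ → ∑-mono V (λ {y} _ → le a y)) ⟩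
        ∑ V (λ a → ∑ V (λ y → head A a y * c))            ≡⟨ trans (∑-cong V (λ u → ∑-*ʳ V c _)) (∑-*ʳ V c _) ⟩
        ∑ V (λ a → ∑ V (head A a)) * c                    ≡⟨ cong (_* c) ∑head ⟩
        M * c                                             ∎
        where
        open ≤-Reasoning
        inner : Fin n → Fin n → ℕ
        inner a y = ∑ V (λ u → ∑ V (λ x → tail A u x * i u x a y))
        ∑-swap₃ : ∀ a → ∑ V (λ u → ∑ V (λ y → ∑ V (λ x → tail A u x * (head A a y * i u x a y)))) ≡ ∑ V (λ y → ∑ V (λ u → ∑ V (λ x → tail A u x * (head A a y * i u x a y))))
        ∑-swap₃ a = ∑-swap V V _
        p : ∀ s h i → s * (h * i) ≡ h * (s * i)
        p = solve-∀
        le : ∀ a y → head A a y * inner a y ≤ head A a y * c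
        le a y with bool-cases (A a y)
        ... | inj₂ z = ≤-trans (≤-reflexive (cong (_* inner a y) (trans (cong (λ b → non2 a * 𝟙 b) z) (*-zeroʳ (non2 a))))) z≤n
        ... | inj₁ o = *-monoʳ-≤ (head A a y) (h a y o)

      non2≤1 : ∀ a → non2 a ≤ 1
      non2≤1 a = 𝟙≤1 (not (D a ≡ᵇ 2))

      near : ∀ v → ∑ V (λ y → δ v y + 𝟙 (A v y)) ≡ 1 + D v
      near v = trans (∑-+ V _ _) (cong₂ _+_ (∑-δ-all v) (A-deg v))

      capped : ∀ (g : Fin n → ℕ) → ∑ V (λ y → D y * (sm₂ y * g y)) ≤ t₂ * ∑ V g
      capped g = ≤-trans (∑-mono V λ {y} _ → le y) (≤-reflexive (∑-*ˡ V t₂ g))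
        where
        open ≤-Reasoning
        q : ∀ d s g → d * (s * g) ≡ (s * d) * g
        q = solve-∀
        le : ∀ y → D y * (sm₂ y * g y) ≤ t₂ * g y
        le y = begin
          D y * (sm₂ y * g y)   ≡⟨ q (D y) (sm₂ y) (g y) ⟩
          (sm₂ y * D y) * g y   ≤⟨ *-monoˡ-≤ (g y) (sm₂-≤ y) ⟩
          (sm₂ y * t₂) * g y    ≤⟨ *-monoˡ-≤ (g y) (*-monoˡ-≤ t₂ (𝟙≤1 (not (t₂ <ᵇ D y)))) ⟩
          (1 * t₂) * g y        ≡⟨ cong (_* g y) (*-identityˡ t₂) ⟩
          t₂ * g y              ∎

      drop-w : ∀ (w g : Fin n → ℕ) → (∀ a → w a ≤ 1) → ∑ V (λ a → w a * g a) ≤ ∑ V g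
      drop-w w g w≤1 = ∑-mono V λ {a} _ → ≤-trans (*-monoˡ-≤ (g a) (w≤1 a)) (≤-reflexive (*-identityˡ (g a)))

      bound₃ : weighted (obstruction₃ A) ≤ M * (t₂ * (1 + t))
      bound₃ = weighted-tail _ _ λ u x du → ≤-trans (col non2 (λ y → sm₂ y * (δ u y + 𝟙 (A u y))) non2≤1)
        (≤-trans (capped _) (*-monoʳ-≤ t₂ (≤-trans (≤-reflexive (near u)) (s≤s du))))

      -- The head `x` of the first dart may have any degree. The factor `sm₂ x` limits the number of
      -- candidates for `a` around it, and `sm₂ a` the number of darts that leave each of them.
      bound₄ : weighted (obstruction₄ A) ≤ M * (t₂ * (1 + t₂))
      bound₄ = weighted-tail _ _ λ u x du → ≤-trans (≤-reflexive (row non2 (λ a → sm₂ x * (sm₂ a * (δ x a + 𝟙 (A x a))))))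
        (≤-trans (drop-w non2 _ non2≤1) (≤-trans (≤-reflexive (trans (∑-cong V (λ a → p (D a) (sm₂ x) (sm₂ a * (δ x a + 𝟙 (A x a))))) (∑-*ˡ V (sm₂ x) _)))
        (≤-trans (*-monoʳ-≤ (sm₂ x) (≤-trans (capped _) (≤-reflexive (cong (t₂ *_) (near x))))) (last x))))
        where
        p : ∀ d s g → d * (s * g) ≡ s * (d * g)
        p = solve-∀
        last : ∀ x → sm₂ x * (t₂ * (1 + D x)) ≤ t₂ * (1 + t₂)
        last x with t₂ <ᵇ D x in e
        ... | true = z≤n
        ... | false = ≤-trans (≤-reflexive (+-identityʳ _)) (*-monoʳ-≤ t₂ (s≤s (≮⇒≥ λ b → false≢true e (T⇒≡ (<⇒<ᵇ b)))))

      H-bound : ∀ u → D u ≤ t → ∑ V (H A u) ≤ t * cap k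
      H-bound u du = begin
        ∑ V (H A u)                                              ≡⟨ trans (∑-swap V V _) (∑-cong V λ z → ∑-*ˡ V (𝟙 (A u z)) _) ⟩
        ∑ V (λ z → 𝟙 (A u z) * ∑ V (hits A n k u z))             ≤⟨ ∑-mono V (λ {z} _ → le z) ⟩
        ∑ V (λ z → 𝟙 (A u z) * cap k)                            ≡⟨ trans (∑-*ʳ V (cap k) _) (cong (_* cap k) (A-deg u)) ⟩
        D u * cap k                                              ≤⟨ *-monoˡ-≤ (cap k) du ⟩
        t * cap k                                                ∎
        where
        open ≤-Reasoning
        le : ∀ z → 𝟙 (A u z) * ∑ V (hits A n k u z) ≤ 𝟙 (A u z) * cap k
        le z with A u z in e
        ... | true = *-monoʳ-≤ 1 (hits-bound n k u z (A-sym u z e))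
        ... | false = z≤n

      bound₅ : weighted (obstruction₅ A) ≤ M * (t₂ * (t * cap k))
      bound₅ = weighted-tail _ _ λ u x du → ≤-trans (≤-reflexive (row non2 (λ a → sm₂ a * H A u a)))
        (≤-trans (drop-w non2 _ non2≤1) (≤-trans (capped (H A u)) (*-monoʳ-≤ t₂ (H-bound u du))))

      -- Here the second dart is the fixed one. The degree of `a` may be large, so only the
      -- exploration along `a y` is charged, and every tail `u` that it hits has degree at most `t`.
      bound₆ : weighted (obstruction₆ A) ≤ M * (t * cap k)
      bound₆ = weighted-head _ _ λ a y ay → ≤-trans (≤-reflexive (row small (λ u → hits A n k a y u)))
        (≤-trans (∑-mono V λ {u} _ → le u (hits A n k a y u)) (≤-trans (≤-reflexive (∑-*ˡ V t _)) (*-monoʳ-≤ t (hits-bound n k a y (A-sym a y ay)))))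
        where
        le : ∀ u h → small u * (D u * h) ≤ t * h
        le u h with ≤1-cases (small≤1 u)
        ... | inj₁ z rewrite z = z≤n
        ... | inj₂ o = ≤-trans (≤-reflexive (trans (cong (_* (D u * h)) o) (*-identityˡ _))) (*-monoˡ-≤ h (proj₁ (small⁻ {u} (≤-reflexive (sym o)))))

      Big-comm : ∑ V (λ y → D y * large t₂ y) ≡ Big t₂
      Big-comm = ∑-cong V λ y → *-comm (D y) (large t₂ y)

      bound₇ : weighted (obstruction₇ A) ≤ M * (Big t₂ + (Big t₂ + Big t₂))
      bound₇ = begin
        weighted (obstruction₇ A)  ≡⟨ trans (weighted-+ _ _) (cong (weighted (λ u x a y → large t₂ a) +_) (weighted-+ _ _)) ⟩
        weighted (λ u x a y → large t₂ a) + (weighted (λ u x a y → large t₂ x) + weighted (λ u x a y → large t₂ y))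
          ≤⟨ +-mono-≤ (weighted-tail _ (Big t₂) λ u x du → ≤-trans (≤-reflexive (row non2 (large t₂))) (≤-trans (drop-w non2 _ non2≤1) (≤-reflexive Big-comm)))
            (+-mono-≤ (weighted-head _ (Big t₂) λ a y ay → ≤-trans (col small (large t₂) small≤1) (≤-reflexive Big-comm))
                      (weighted-tail _ (Big t₂) λ u x du → ≤-trans (col non2 (large t₂) non2≤1) (≤-reflexive Big-comm))) ⟩
        M * Big t₂ + (M * Big t₂ + M * Big t₂)  ≡⟨ p M (Big t₂) ⟩
        M * (Big t₂ + (Big t₂ + Big t₂)) ∎
        where
        open ≤-Reasoning
        p : ∀ m b → m * b + (m * b + m * b) ≡ m * (b + (b + b))
        p = solve-∀

      weighted-obstruction : weighted (obstruction A) ≤ M * loss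
      weighted-obstruction = begin
        weighted (obstruction A)
          ≡⟨ trans (weighted-+ (obstruction₃ A) _) (cong (weighted (obstruction₃ A) +_)
            (trans (weighted-+ (obstruction₄ A) _) (cong (weighted (obstruction₄ A) +_)
            (trans (weighted-+ (obstruction₅ A) _) (cong (weighted (obstruction₅ A) +_) (weighted-+ (obstruction₆ A) (obstruction₇ A))))))) ⟩
        weighted (obstruction₃ A) + (weighted (obstruction₄ A) + (weighted (obstruction₅ A) + (weighted (obstruction₆ A) + weighted (obstruction₇ A))))
          ≤⟨ +-mono-≤ bound₃ (+-mono-≤ bound₄ (+-mono-≤ bound₅ (+-mono-≤ bound₆ bound₇))) ⟩
        M * c₃ + (M * c₄ + (M * c₅ + (M * c₆ + M * c₇)))  ≡⟨ p M c₃ c₄ c₅ c₆ c₇ ⟩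
        M * loss ∎
        where
        open ≤-Reasoning
        c₃ = t₂ * (1 + t)
        c₄ = t₂ * (1 + t₂)
        c₅ = t₂ * (t * cap k)
        c₆ = t * cap k
        c₇ = Big t₂ + (Big t₂ + Big t₂)
        p : ∀ m a b c d e → m * a + (m * b + (m * c + (m * d + m * e))) ≡ m * (a + (b + (c + (d + e))))
        p = solve-∀

    N : ℕ
    N = length 𝒢

    ∑-error : ∑ 𝒢 (λ G → ∑⁴ (error G)) ≤ N * (t * (M * loss))
    ∑-error = ≤-trans (∑-mono 𝒢 λ {G} m → ≤-trans (≤-reflexive (∑⁴-* t _))
      (*-monoʳ-≤ t (OneGraph.weighted-obstruction (adj G) (adj-sym G) (adj-deg m)))) (≤-reflexive (∑-const 𝒢 _))

    private
      pull : ∀ (w : Fin n → ℕ) (f : Fin n → Fin n → ℕ) → ∑ V (λ u → ∑ V (λ x → w u * f u x)) ≡ ∑ V (λ u → w u * ∑ V (f u))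
      pull w f = ∑-cong V λ u → ∑-*ˡ V (w u) (f u)

    -- Exchanging the heads moves the survivor to the tail `a`, while `u` keeps its weight. On the
    -- scale of M², degree and survival thus become independent.
    decorrelate-degree : ∑ 𝒢 (λ G → Y (adj G) k * M) ≤ ∑ 𝒢 (λ G → Q * X (adj G) k) + N * (t * (M * loss))
    decorrelate-degree = begin
      ∑ 𝒢 (λ G → Y (adj G) k * M)      ≡⟨ ∑-cong∈ 𝒢 (λ {G} m → sym (trans (∑⁴-product _ _) (cong₂ _*_ (pull (λ u → small u * (D u ∸ 1)) (α (adj G) k)) (heads m)))) ⟩
      ∑ 𝒢 (λ G → ∑⁴ (F₁ G))            ≤⟨ transport F₁ F₁′ error valid₁ (λ {G} u x a y m v → invalid G u x a y v (F₁-≤ G u x a y)) ⟩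
      ∑ 𝒢 (λ G → ∑⁴ (F₁′ G)) + ∑ 𝒢 (λ G → ∑⁴ (error G))
        ≤⟨ +-mono-≤ (≤-reflexive (∑-cong∈ 𝒢 λ {G} m → trans (∑⁴-product _ _) (cong₂ _*_ (tails m) (pull non2 (α (adj G) k))))) ∑-error ⟩
      ∑ 𝒢 (λ G → Q * X (adj G) k) + N * (t * (M * loss)) ∎
      where
      open ≤-Reasoning
      heads : ∀ {G} → G ∈ 𝒢 → ∑ V (λ a → ∑ V (head (adj G) a)) ≡ M
      heads {G} m = OneGraph.∑head (adj G) (adj-sym G) (adj-deg m)
      tails : ∀ {G} → G ∈ 𝒢 → ∑ V (λ u → ∑ V (λ x → (small u * (D u ∸ 1)) * 𝟙 (adj G u x))) ≡ Q
      tails {G} m = trans (pull (λ u → small u * (D u ∸ 1)) (λ u x → 𝟙 (adj G u x))) (∑-cong V λ u → cong ((small u * (D u ∸ 1)) *_) (adj-deg m u))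

    -- The survivor of a second, unrelated dart is brought to a tail that already has a survivor
    -- elsewhere. Hence coincidences of two survivors are at least as frequent as independence
    -- predicts, up to the error.
    decorrelate-sides : ∑ 𝒢 (λ G → Bᵏ (adj G) k * X (adj G) k) ≤ ∑ 𝒢 (λ G → Z (adj G) k * M) + N * (t * (M * loss))
    decorrelate-sides = begin
      ∑ 𝒢 (λ G → Bᵏ (adj G) k * X (adj G) k)  ≡⟨ ∑-cong 𝒢 (λ G → sym (trans (∑⁴-product _ _) (cong₂ _*_ (pull small (β (adj G) k)) (pull non2 (α (adj G) k))))) ⟩
      ∑ 𝒢 (λ G → ∑⁴ (F₂ G))                   ≤⟨ transport F₂ F₂′ error valid₂ (λ {G} u x a y m v → invalid G u x a y v (F₂-≤ G u x a y)) ⟩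
      ∑ 𝒢 (λ G → ∑⁴ (F₂′ G)) + ∑ 𝒢 (λ G → ∑⁴ (error G))
        ≤⟨ +-mono-≤ (≤-reflexive (∑-cong∈ 𝒢 λ {G} m → trans (∑⁴-product _ _)
             (cong₂ _*_ (pull small (λ u x → α (adj G) k u x * β (adj G) k u x)) (OneGraph.∑head (adj G) (adj-sym G) (adj-deg m))))) ∑-error ⟩
      ∑ 𝒢 (λ G → Z (adj G) k * M) + N * (t * (M * loss)) ∎
      where open ≤-Reasoning

  -- Decay of the survival probability

  square-cancel : ∀ a b → a * a ≤ b * b → a ≤ b
  square-cancel a b h with a ≤? b
  ... | yes p = p
  ... | no ¬p = ⊥-elim (<⇒≱ (*-mono-< (≰⇒> ¬p) (≰⇒> ¬p)) h)

  -- When the inequalities are added, `f` cancels, and each of the `K` squares is at least the last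
  -- one because `x` decreases.
  telescope : ∀ (f x : ℕ → ℕ) W K → (∀ k → k < K → f (suc k) + x (suc k) * x (suc k) ≤ f k + W) → (∀ k → x (suc k) ≤ x k)
    → K * (x K * x K) ≤ f 0 + K * W
  telescope f x W K h dec = ≤-trans (m≤n+m _ (f K)) (go K ≤-refl)
    where
    open ≤-Reasoning
    x-≤ : ∀ j d → x (d + j) ≤ x j
    x-≤ j zero = ≤-refl
    x-≤ j (suc d) = ≤-trans (dec (d + j)) (x-≤ j d)
    xK≤ : ∀ j → j ≤ K → x K ≤ x j
    xK≤ j l with m≤n⇒∃[o]m+o≡n l
    ... | d , e = subst (λ m → x m ≤ x j) (trans (+-comm d j) e) (x-≤ j d)
    p : ∀ a s m → a + (s + m * s) ≡ (a + s) + m * s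
    p = solve-∀
    p′ : ∀ a w m → (a + w) + m ≡ (a + m) + w
    p′ = solve-∀
    p″ : ∀ a w m → (a + m * w) + w ≡ a + (w + m * w)
    p″ = solve-∀
    go : ∀ j → j ≤ K → f j + j * (x K * x K) ≤ f 0 + j * W
    go zero l = ≤-refl
    go (suc j) l = begin
      f (suc j) + (x K * x K + j * (x K * x K))    ≡⟨ p (f (suc j)) (x K * x K) j ⟩
      (f (suc j) + x K * x K) + j * (x K * x K)    ≤⟨ +-monoˡ-≤ _ (+-monoʳ-≤ (f (suc j)) (*-mono-≤ (xK≤ (suc j) l) (xK≤ (suc j) l))) ⟩
      (f (suc j) + x (suc j) * x (suc j)) + j * (x K * x K)  ≤⟨ +-monoˡ-≤ _ (h j l) ⟩
      (f j + W) + j * (x K * x K)                  ≡⟨ p′ (f j) W (j * (x K * x K)) ⟩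
      (f j + j * (x K * x K)) + W                  ≤⟨ +-monoˡ-≤ W (go j (≤-trans (n≤1+n j) l)) ⟩
      (f 0 + j * W) + W                            ≡⟨ p″ (f 0) W j ⟩
      f 0 + (W + j * W)                            ∎

  module Decay {n : ℕ} (D : DegSeq n) (t : ℕ) (2≤t : 2 ≤ t) (t₂ : ℕ) (q : ℕ) (K : ℕ) where
    open Switching D using (adj; adj-sym; adj-irrefl; real⁻)
    open Switches D using (adj-deg)
    open Explore D t using (cap)
    open Count D t

    Γ : Set
    Γ = List (Edge n)
    𝒢 : List Γ
    𝒢 = realisations D
    N : ℕ
    N = length 𝒢

    loss : ℕ → ℕ
    loss k = Comparison.loss D t 2≤t t₂ k

    private
      module Gr {G : Γ} (m : G ∈ 𝒢) = Graph 2≤t (adj G) (adj-sym G) (adj-irrefl (proj₁ (real⁻ m))) (adj-deg m)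

    cap-mono : ∀ {j k} → j ≤ k → cap j ≤ cap k
    cap-mono {zero} {zero} l = ≤-refl
    cap-mono {zero} {suc k} l = s≤s z≤n
    cap-mono (s≤s l) = s≤s (*-monoʳ-≤ t (cap-mono l))

    loss-mono : ∀ {j k} → j ≤ k → loss j ≤ loss k
    loss-mono l = +-monoʳ-≤ (t₂ * (1 + t)) (+-monoʳ-≤ (t₂ * (1 + t₂)) (+-mono-≤ (*-monoʳ-≤ t₂ (*-monoʳ-≤ t (cap-mono l)))
      (+-monoˡ-≤ _ (*-monoʳ-≤ t (cap-mono l)))))

    -- `e` bounds the switching error relative to N M. In one step `e` and `Big t` occur twice in
    -- the linear part and once in the quadratic part, and the allowed excess `q` of `Q` over `M`
    -- occurs twice.
    e w : ℕ
    e = t * loss K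
    w = 3 * (e + Big t) + 2 * q

    X̄ B̄ Z̄ Ȳ : ℕ → ℕ
    X̄ k = ∑ 𝒢 (λ G → X (adj G) k)
    B̄ k = ∑ 𝒢 (λ G → Bᵏ (adj G) k)
    Z̄ k = ∑ 𝒢 (λ G → Z (adj G) k)
    Ȳ k = ∑ 𝒢 (λ G → Y (adj G) k)

    X̄≤ : ∀ k → X̄ k ≤ N * M
    X̄≤ k = ≤-trans (∑-mono 𝒢 λ m → Gr.X≤M m k) (≤-reflexive (∑-const 𝒢 M))

    X̄-pred : ∀ k → X̄ (suc k) ≤ X̄ k
    X̄-pred k = ∑-mono 𝒢 λ m → Gr.X-pred m k

    X̄-reversal : ∀ k → X̄ (suc k) ≤ N * Big t + B̄ k
    X̄-reversal k = ≤-trans (∑-mono 𝒢 λ m → Gr.reversal m k) (≤-reflexive (trans (∑-+ 𝒢 _ _) (cong (_+ B̄ k) (∑-const 𝒢 (Big t)))))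

    surplus̄ : ∀ k → 2 * B̄ k + Z̄ k ≤ 2 * Ȳ k
    surplus̄ k = begin
      2 * B̄ k + Z̄ k                                          ≡⟨ cong (_+ Z̄ k) (∑-*ˡ 𝒢 2 _) ⟨
      ∑ 𝒢 (λ G → 2 * Bᵏ (adj G) k) + Z̄ k                      ≡⟨ ∑-+ 𝒢 _ _ ⟨
      ∑ 𝒢 (λ G → 2 * Bᵏ (adj G) k + Z (adj G) k)              ≤⟨ ∑-mono 𝒢 (λ m → Gr.surplus-total m k) ⟩
      ∑ 𝒢 (λ G → 2 * Y (adj G) k)                             ≡⟨ ∑-*ˡ 𝒢 2 _ ⟩
      2 * Ȳ k                                                 ∎
      where open ≤-Reasoning

    N-error : ∀ k → k ≤ K → N * (t * (M * loss k)) ≤ N * M * e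
    N-error k l = ≤-trans (*-monoʳ-≤ N (*-monoʳ-≤ t (*-monoʳ-≤ M (loss-mono l)))) (≤-reflexive (p N t M (loss K)))
      where p : ∀ n t m l → n * (t * (m * l)) ≡ n * m * (t * l)
            p = solve-∀

    ȲM : ∀ k → k ≤ K → Ȳ k * M ≤ Q * X̄ k + N * M * e
    ȲM k l = begin
      Ȳ k * M                                    ≡⟨ ∑-*ʳ 𝒢 M _ ⟨
      ∑ 𝒢 (λ G → Y (adj G) k * M)                ≤⟨ Comparison.decorrelate-degree D t 2≤t t₂ k ⟩
      ∑ 𝒢 (λ G → Q * X (adj G) k) + N * (t * (M * loss k)) ≤⟨ +-mono-≤ (≤-reflexive (∑-*ˡ 𝒢 Q _)) (N-error k l) ⟩
      Q * X̄ k + N * M * e                        ∎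
      where open ≤-Reasoning

    BX : ∀ k → k ≤ K → ∑ 𝒢 (λ G → Bᵏ (adj G) k * X (adj G) k) ≤ Z̄ k * M + N * M * e
    BX k l = ≤-trans (Comparison.decorrelate-sides D t 2≤t t₂ k) (+-mono-≤ (≤-reflexive (∑-*ʳ 𝒢 M _)) (N-error k l))

    -- The coincidences are controlled inside each graph, so the square of the mean is first passed
    -- to the mean of squares. Of the two factors one is replaced through `reversal` and the other
    -- through monotonicity in `k`; this produces the product that `decorrelate-sides` bounds.
    X̄-square : ∀ k → k ≤ K → X̄ (suc k) * X̄ (suc k) ≤ N * (N * (Big t * M) + (Z̄ k * M + N * M * e))
    X̄-square k l = begin
      X̄ (suc k) * X̄ (suc k)                                                      ≤⟨ ∑-square 𝒢 _ ⟩
      N * ∑ 𝒢 (λ G → X (adj G) (suc k) * X (adj G) (suc k))                      ≤⟨ *-monoʳ-≤ N (∑-mono 𝒢 le) ⟩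
      N * ∑ 𝒢 (λ G → Big t * M + Bᵏ (adj G) k * X (adj G) k)                     ≡⟨ cong (N *_) (trans (∑-+ 𝒢 _ _) (cong (_+ ∑ 𝒢 (λ G → Bᵏ (adj G) k * X (adj G) k)) (∑-const 𝒢 (Big t * M)))) ⟩
      N * (N * (Big t * M) + ∑ 𝒢 (λ G → Bᵏ (adj G) k * X (adj G) k))             ≤⟨ *-monoʳ-≤ N (+-monoʳ-≤ _ (BX k l)) ⟩
      N * (N * (Big t * M) + (Z̄ k * M + N * M * e))                              ∎
      where
      open ≤-Reasoning
      le : ∀ {G} → G ∈ 𝒢 → X (adj G) (suc k) * X (adj G) (suc k) ≤ Big t * M + Bᵏ (adj G) k * X (adj G) k
      le {G} m = ≤-trans (*-mono-≤ (Gr.reversal m k) (Gr.X-pred m k))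
        (≤-trans (≤-reflexive (*-distribʳ-+ (X (adj G) k) (Big t) (Bᵏ (adj G) k))) (+-monoˡ-≤ _ (*-monoʳ-≤ (Big t) (Gr.X≤M m k))))

    module Small (Q≤ : Q ≤ M + q) where

      QX̄ : ∀ k → Q * X̄ k ≤ M * X̄ k + q * (N * M)
      QX̄ k = ≤-trans (*-monoˡ-≤ (X̄ k) Q≤) (≤-trans (≤-reflexive (*-distribʳ-+ (X̄ k) M q)) (+-monoʳ-≤ _ (*-monoʳ-≤ q (X̄≤ k))))

      -- The linear term contributes `B̄` twice and the square contributes `Z̄`, exactly the
      -- combination that `surplus̄` bounds by `Ȳ`. Decorrelation returns from `Ȳ` to `X̄ k`, since
      -- `Q` is nearly `M`. The common scale is N² M².
      one-step : ∀ k → k < K → 2 * (M * N) * X̄ (suc k) + X̄ (suc k) * X̄ (suc k) ≤ 2 * (M * N) * X̄ k + N * N * M * w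
      one-step k l = begin
        2 * (M * N) * X̄ (suc k) + X̄ (suc k) * X̄ (suc k)
          ≤⟨ +-mono-≤ (*-monoʳ-≤ (2 * (M * N)) (X̄-reversal k)) (X̄-square k (<⇒≤ l)) ⟩
        2 * (M * N) * (N * Big t + B̄ k) + N * (N * (Big t * M) + (Z̄ k * M + N * M * e))
          ≡⟨ p₁ M N (Big t) (B̄ k) (Z̄ k) e ⟩
        N * M * (2 * B̄ k + Z̄ k) + N * N * M * (3 * Big t + e)
          ≤⟨ +-monoˡ-≤ _ (*-monoʳ-≤ (N * M) (surplus̄ k)) ⟩
        N * M * (2 * Ȳ k) + N * N * M * (3 * Big t + e)
          ≡⟨ p₂ M N (Ȳ k) (Big t) e ⟩
        2 * N * (Ȳ k * M) + N * N * M * (3 * Big t + e)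
          ≤⟨ +-monoˡ-≤ _ (*-monoʳ-≤ (2 * N) (≤-trans (ȲM k (<⇒≤ l)) (+-monoˡ-≤ _ (QX̄ k)))) ⟩
        2 * N * ((M * X̄ k + q * (N * M)) + N * M * e) + N * N * M * (3 * Big t + e)
          ≡⟨ p₃ M N (X̄ k) q (Big t) e ⟩
        2 * (M * N) * X̄ k + N * N * M * w ∎
        where
        open ≤-Reasoning
        p₁ : ∀ m n b s z e → 2 * (m * n) * (n * b + s) + n * (n * (b * m) + (z * m + n * m * e)) ≡ n * m * (2 * s + z) + n * n * m * (3 * b + e)
        p₁ = solve-∀
        p₂ : ∀ m n y b e → n * m * (2 * y) + n * n * m * (3 * b + e) ≡ 2 * n * (y * m) + n * n * m * (3 * b + e)
        p₂ = solve-∀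
        p₃ : ∀ m n x q b e → 2 * n * ((m * x + q * (n * m)) + n * m * e) + n * n * m * (3 * b + e) ≡ 2 * (m * n) * x + n * n * m * (3 * (e + b) + 2 * q)
        p₃ = solve-∀

      -- In terms of ρ the telescoped sum reads K ρ² ≤ 2 + K w / M. With K = 4 H² the hypothesis on
      -- `w` makes the last summand at most 2, whence H ρ ≤ 1.
      decay : ∀ H → 1 ≤ H → K ≡ 4 * (H * H) → 2 * (H * H) * w ≤ M → H * X̄ K ≤ N * M
      decay H (s≤s z≤n) K≡ small-w = square-cancel _ _ (*-cancelˡ-≤ 4 (begin
        4 * (H * X̄ K * (H * X̄ K))                       ≡⟨ p₁ H (X̄ K) ⟩
        4 * (H * H) * (X̄ K * X̄ K)                       ≡⟨ cong (_* (X̄ K * X̄ K)) K≡ ⟨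
        K * (X̄ K * X̄ K)                                 ≤⟨ telescope (λ k → 2 * (M * N) * X̄ k) X̄ (N * N * M * w) K one-step X̄-pred ⟩
        2 * (M * N) * X̄ 0 + K * (N * N * M * w)         ≤⟨ +-mono-≤ (*-monoʳ-≤ (2 * (M * N)) (X̄≤ 0)) (≤-reflexive (cong (_* (N * N * M * w)) K≡)) ⟩
        2 * (M * N) * (N * M) + 4 * (H * H) * (N * N * M * w)  ≡⟨ p₂ M N H w ⟩
        2 * (M * N) * (N * M) + 2 * (N * N * M) * (2 * (H * H) * w)  ≤⟨ +-monoʳ-≤ _ (*-monoʳ-≤ (2 * (N * N * M)) small-w) ⟩
        2 * (M * N) * (N * M) + 2 * (N * N * M) * M     ≡⟨ p₃ M N ⟩
        4 * (N * M * (N * M))                           ∎))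
        where
        open ≤-Reasoning
        p₁ : ∀ h x → 4 * (h * x * (h * x)) ≡ 4 * (h * h) * (x * x)
        p₁ = solve-∀
        p₂ : ∀ m n h w → 2 * (m * n) * (n * m) + 4 * (h * h) * (n * n * m * w) ≡ 2 * (m * n) * (n * m) + 2 * (n * n * m) * (2 * (h * h) * w)
        p₂ = solve-∀
        p₃ : ∀ m n → 2 * (m * n) * (n * m) + 2 * (n * n * m) * m ≡ 4 * (n * m * (n * m))
        p₃ = solve-∀

      -- Markov's inequality for X + Bᵏ + Big t, where `B̄` is at most `X̄` up to errors. With H = 8
      -- g h the main part and the error part each contribute at most N M. The factor 2 in the
      -- conclusion later turns a weak inequality into a strict one.
      few-bad : ∀ g h → 1 ≤ g → 1 ≤ h → K ≡ 4 * (8 * (g * h) * (8 * (g * h))) → 2 * (8 * (g * h) * (8 * (g * h))) * w ≤ M → 1 ≤ M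
        → (bad : Γ → Bool) → (∀ {G} → G ∈ 𝒢 → bad G ≡ true → M ≤ g * (X (adj G) K + Bᵏ (adj G) K + Big t))
        → 2 * (h * ∑ 𝒢 (𝟙 ∘ bad)) ≤ N
      few-bad g h 1≤g 1≤h K≡ small-w 1≤M bad bad⇒ = *-cancelʳ-≤ _ _ (2 * M) {{ℕ.>-nonZero (*-mono-≤ {1} {2} {1} {M} (s≤s z≤n) 1≤M)}} (begin
        2 * (h * nb) * (2 * M)                        ≡⟨ p₁ h nb M ⟩
        4 * h * (nb * M)                              ≤⟨ *-monoʳ-≤ (4 * h) nbM ⟩
        4 * h * (g * (X̄ K + B̄ K + N * Big t))         ≤⟨ *-monoʳ-≤ (4 * h) (*-monoʳ-≤ g (+-monoˡ-≤ _ (+-monoʳ-≤ (X̄ K) B̄≤))) ⟩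
        4 * h * (g * (X̄ K + (X̄ K + N * (q + e)) + N * Big t))  ≤⟨ *-monoʳ-≤ (4 * h) (*-monoʳ-≤ g X≤) ⟩
        4 * h * (g * (2 * X̄ K + N * w))               ≡⟨ p₂ g h (X̄ K) N w ⟩
        8 * (g * h) * X̄ K + N * (4 * (g * h) * w)     ≤⟨ +-mono-≤ (decay (8 * (g * h)) 1≤H K≡ small-w) (*-monoʳ-≤ N (≤-trans (*-monoˡ-≤ w coef) small-w)) ⟩
        N * M + N * M                                 ≡⟨ p₃ N M ⟩
        N * (2 * M)                                   ∎)
        where
        open ≤-Reasoning
        nb = ∑ 𝒢 (𝟙 ∘ bad)
        gh≥1 : 1 ≤ g * h
        gh≥1 = *-mono-≤ 1≤g 1≤h
        1≤H : 1 ≤ 8 * (g * h)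
        1≤H = *-mono-≤ {1} {8} (s≤s z≤n) gh≥1
        coef : 4 * (g * h) ≤ 2 * (8 * (g * h) * (8 * (g * h)))
        coef = ≤-trans (≤-reflexive (c₁ (g * h))) (≤-trans (*-monoʳ-≤ (4 * (g * h)) (≤-trans gh≥1 (m≤n*m (g * h) 32))) (≤-reflexive (c₂ (g * h))))
          where c₁ : ∀ a → 4 * a ≡ 4 * a * 1
                c₁ = solve-∀
                c₂ : ∀ a → 4 * a * (32 * a) ≡ 2 * (8 * a * (8 * a))
                c₂ = solve-∀
        p₁ : ∀ h b m → 2 * (h * b) * (2 * m) ≡ 4 * h * (b * m)
        p₁ = solve-∀
        p₂ : ∀ g h x n w → 4 * h * (g * (2 * x + n * w)) ≡ 8 * (g * h) * x + n * (4 * (g * h) * w)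
        p₂ = solve-∀
        p₃ : ∀ n m → n * m + n * m ≡ n * (2 * m)
        p₃ = solve-∀
        p₄ : ∀ x n q e b → (x + (x + n * (q + e)) + n * b) + n * (2 * e + 2 * b + q) ≡ 2 * x + n * (3 * (e + b) + 2 * q)
        p₄ = solve-∀
        X≤ : X̄ K + (X̄ K + N * (q + e)) + N * Big t ≤ 2 * X̄ K + N * w
        X≤ = ≤-trans (m≤m+n _ _) (≤-reflexive (p₄ (X̄ K) N q e (Big t)))
        nbM : nb * M ≤ g * (X̄ K + B̄ K + N * Big t)
        nbM = begin
          nb * M                                                   ≡⟨ ∑-*ʳ 𝒢 M _ ⟨
          ∑ 𝒢 (λ G → 𝟙 (bad G) * M)                                ≤⟨ ∑-mono 𝒢 le ⟩
          ∑ 𝒢 (λ G → g * (X (adj G) K + Bᵏ (adj G) K + Big t))     ≡⟨ trans (∑-*ˡ 𝒢 g _) (cong (g *_) (trans (∑-+ 𝒢 _ _) (cong₂ _+_ (∑-+ 𝒢 _ _) (∑-const 𝒢 (Big t))))) ⟩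
          g * (X̄ K + B̄ K + N * Big t)                              ∎
          where
          le : ∀ {G} → G ∈ 𝒢 → 𝟙 (bad G) * M ≤ g * (X (adj G) K + Bᵏ (adj G) K + Big t)
          le {G} m with bad G in eq
          ... | true = ≤-trans (≤-reflexive (*-identityˡ M)) (bad⇒ m eq)
          ... | false = z≤n
        B̄≤Ȳ : B̄ K ≤ Ȳ K
        B̄≤Ȳ = *-cancelˡ-≤ 2 (≤-trans (m≤m+n _ (Z̄ K)) (surplus̄ K))
        B̄≤ : B̄ K ≤ X̄ K + N * (q + e)
        B̄≤ = *-cancelʳ-≤ _ _ M {{ℕ.>-nonZero 1≤M}} (begin
          B̄ K * M                                        ≤⟨ *-monoˡ-≤ M B̄≤Ȳ ⟩
          Ȳ K * M                                        ≤⟨ ȲM K ≤-refl ⟩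
          Q * X̄ K + N * M * e                            ≤⟨ +-monoˡ-≤ _ (QX̄ K) ⟩
          M * X̄ K + q * (N * M) + N * M * e              ≡⟨ p M (X̄ K) q N e ⟩
          (X̄ K + N * (q + e)) * M                        ∎)
          where p : ∀ m x q n e → m * x + q * (n * m) + n * m * e ≡ (x + n * (q + e)) * m
                p = solve-∀

  -- Components

  Conn : ∀ {n} → (Fin n → Fin n → Bool) → Fin n → Fin n → Set
  Conn A = Star (λ i j → A i j ≡ true)

  module Spread {n : ℕ} (D : DegSeq n) (t : ℕ) (2≤t : 2 ≤ t) (K : ℕ) where
    open Switching D
    open Switches D hiding (Adj)
    open Explore D t
    open Count D t

    path : ∀ {A u w} → Conn A u w → Path A [] u w
    path ε = end (λ ())
    path (a ◅ s) = path-extend a (path s)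

    -- If no dart at `u` survives, 1 + t * cap K bounds the number of vertices of degree other than
    -- 2 that are reached from `u`, itself included. The outer `t` bounds their degrees.
    threshold : ℕ
    threshold = t * (1 + t * cap K)

    -- If no dart at some `u` in `W` of degree at most `t` survived, all of `W` would lie among the
    -- few vertices explored from `u`. So a survivor leaves `u`: `α` accounts for it, and `β` for
    -- every other dart at `u`, as the survivor lies beside it. Degrees above `t` are absorbed by
    -- `Big t`.
    spread : ∀ {G} → G ∈ realisations D → (W : Fin n → Bool) → (∀ {u} → W u ≡ true → D u ≢ 2)
      → (∀ {u w} → W u ≡ true → W w ≡ true → Conn (adj G) u w)
      → threshold < ∑ V (λ u → 𝟙 (W u) * D u) → ∑ V (λ u → 𝟙 (W u) * D u) ≤ X (adj G) K + Bᵏ (adj G) K + Big t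
    spread {G} m W W≢2 W-conn big-W = begin
      ∑ V (λ u → 𝟙 (W u) * D u)   ≤⟨ ∑-mono V (λ {u} _ → pt u) ⟩
      ∑ V (λ u → (non2 u * ∑ V (α A K u) + small u * ∑ V (β A K u)) + large t u * D u)   ≡⟨ trans (∑-+ V _ _) (cong (_+ Big t) (∑-+ V _ _)) ⟩
      X A K + Bᵏ A K + Big t ∎
      where
      open ≤-Reasoning
      A : Adj
      A = adj G
      escapes : ∀ {u} → W u ≡ true → D u ≤ t → ∃ λ z → A u z ≡ true × Surv A n K (u ∷ []) z
      escapes {u} Wu Du with any? (λ z → (A u z ≟B true) ×-dec surv? A n K (u ∷ []) z)
      ... | yes p = p
      ... | no none = ⊥-elim (<⇒≱ big-W (begin
        ∑ V (λ w → 𝟙 (W w) * D w)                       ≤⟨ ∑-mono V (λ {w} _ → le w) ⟩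
        ∑ V (λ w → t * (δ u w + H w))                   ≡⟨ trans (∑-*ˡ V t _) (cong (t *_) (trans (∑-+ V _ _) (cong (_+ ∑ V H) (∑-δ-all u)))) ⟩
        t * (1 + ∑ V H)                                 ≤⟨ *-monoʳ-≤ t (s≤s (Comparison.OneGraph.H-bound D t 2≤t 0 K A (adj-sym G) (adj-deg m) u Du)) ⟩
        threshold                                       ∎))
        where
        H : Fin n → ℕ
        H = Pairs.H D t 2≤t 0 K A u
        reached : ∀ w → W w ≡ true → D w ≤ t × 1 ≤ δ u w + H w
        reached w Ww with path (W-conn Wu Ww)
        ... | end _ = Du , ≤-trans (≤-reflexive (sym (δ-refl u))) (m≤m+n _ _)
        ... | step {z} _ uz π with path-hits A n K u π (λ s → none (z , uz , s)) (m≤m+n n 1) ([] ∷ []) (here refl) (W≢2 Ww)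
        ...   | Dw , h = Dw , ≤-trans (Pairs.1≤H D t 2≤t 0 K A u z w uz h) (m≤n+m _ (δ u w))
        le : ∀ w → 𝟙 (W w) * D w ≤ t * (δ u w + H w)
        le w with W w in eq
        ... | false = z≤n
        ... | true with reached w eq
        ...   | Dw , h = ≤-trans (≤-reflexive (+-identityʳ (D w))) (≤-trans Dw (≤-trans (≤-reflexive (sym (*-identityʳ t))) (*-monoʳ-≤ t h)))
      pt : ∀ u → 𝟙 (W u) * D u ≤ (non2 u * ∑ V (α A K u) + small u * ∑ V (β A K u)) + large t u * D u
      pt u with W u in eq | t <? D u
      ... | false | _ = z≤n
      ... | true | yes b = ≤-trans (≤-reflexive (cong (_* D u) (sym (cong 𝟙 (T⇒≡ (<⇒<ᵇ b)))))) (m≤n+m _ (non2 u * ∑ V (α A K u) + small u * ∑ V (β A K u)))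
      ... | true | no ¬b with escapes eq (≮⇒≥ ¬b)
      ...   | z , uz , s = begin
        1 * D u                                                    ≡⟨ *-identityˡ (D u) ⟩
        D u                                                        ≡⟨ adj-deg m u ⟨
        ∑ V (λ x → 𝟙 (A u x))                                      ≤⟨ ∑-mono V (λ {x} _ → one x) ⟩
        ∑ V (λ x → α A K u x + β A K u x)                          ≡⟨ ∑-+ V _ _ ⟩
        ∑ V (α A K u) + ∑ V (β A K u)                              ≡⟨ cong₂ _+_ (scale (non2⁺ (W≢2 eq))) (scale (small⁺ (≮⇒≥ ¬b) (W≢2 eq))) ⟩
        non2 u * ∑ V (α A K u) + small u * ∑ V (β A K u)           ≤⟨ m≤m+n _ _ ⟩
        (non2 u * ∑ V (α A K u) + small u * ∑ V (β A K u)) + large t u * D u  ∎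
        where
        scale : ∀ {c b} → c ≡ 1 → b ≡ c * b
        scale {b = b} refl = sym (*-identityˡ b)
        one : ∀ x → 𝟙 (A u x) ≤ α A K u x + β A K u x
        one x with bool-cases (A u x) | z ≟F x
        ... | inj₂ no-ux | _ rewrite no-ux = z≤n
        ... | inj₁ ux | yes refl = ≤-trans (𝟙≤1 (A u z)) (≤-trans (≤-reflexive (sym (α⁺ uz s))) (m≤m+n _ _))
        ... | inj₁ ux | no z≢x = ≤-trans (𝟙≤1 (A u x)) (≤-trans (≤-reflexive (sym (β⁺ {A} {K} ux z≢x (≤-reflexive (sym (α⁺ uz s)))))) (m≤n+m _ (α A K u x)))

  module Component {n : ℕ} (es : List (Edge n)) where
    private
      V = allFin n
    Closed : (Fin n → Bool) → Set
    Closed S = ∀ {s z} → (s , z) ∈ es → (S s ≡ true → S z ≡ true) × (S z ≡ true → S s ≡ true)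

    F : (Fin n → Bool) → Fin n → Bool
    F = stepReach es

    hit : (Fin n → Bool) → Fin n → Edge n → Bool
    hit S u e = (S (proj₁ e) ∧ (proj₂ e =ᶠ u)) ∨ (S (proj₂ e) ∧ (proj₁ e =ᶠ u))

    F-⊇ : ∀ S {u} → S u ≡ true → F S u ≡ true
    F-⊇ S p = ∨⁺ˡ p

    F-edge : ∀ S {s z} → (s , z) ∈ es → (S s ≡ true → F S z ≡ true) × (S z ≡ true → F S s ≡ true)
    F-edge S {s} {z} m = (λ p → ∨⁺ʳ (S z) (any⁺ (hit S z) m (∨⁺ˡ (cong₂ _∧_ p (=ᶠ-refl z)))))
                       , (λ p → ∨⁺ʳ (S s) (any⁺ (hit S s) m (∨⁺ʳ (S s ∧ (z =ᶠ s)) (cong₂ _∧_ p (=ᶠ-refl s)))))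

    F⁻ : ∀ (P : Fin n → Set) S → (∀ {u} → S u ≡ true → P u) → (∀ {s z} → (s , z) ∈ es → (P s → P z) × (P z → P s)) → ∀ {u} → F S u ≡ true → P u
    F⁻ P S S⊆P cl {u} p with ∨⁻ {S u} p
    ... | inj₁ q = S⊆P q
    ... | inj₂ q with any⁻ (hit S u) es q
    ...   | (s , z) , m , r with ∨⁻ {S s ∧ (z =ᶠ u)} r
    ...     | inj₁ l = subst P (=ᶠ⇒≡ {i = z} {u} (proj₂ (∧⁻ {S s} l))) (proj₁ (cl m) (S⊆P (proj₁ (∧⁻ {S s} l))))
    ...     | inj₂ l = subst P (=ᶠ⇒≡ {i = s} {u} (proj₂ (∧⁻ {S z} l))) (proj₂ (cl m) (S⊆P (proj₁ (∧⁻ {S z} l))))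

    F-closed : ∀ S → Closed S → Closed (F S)
    F-closed S cl m = (λ p → F-⊇ S (proj₁ (cl m) (F⁻ (λ u → S u ≡ true) S (λ q → q) cl p)))
                    , (λ p → F-⊇ S (proj₂ (cl m) (F⁻ (λ u → S u ≡ true) S (λ q → q) cl p)))

    iter-least : ∀ (P : Fin n → Set) S k → (∀ {u} → S u ≡ true → P u) → (∀ {s z} → (s , z) ∈ es → (P s → P z) × (P z → P s)) → ∀ {u} → iter k F S u ≡ true → P u
    iter-least P S zero h cl p = h p
    iter-least P S (suc k) h cl p = F⁻ P (iter k F S) (iter-least P S k h cl) cl p

    component-least : ∀ (P : Fin n → Set) v → P v → (∀ {s z} → (s , z) ∈ es → (P s → P z) × (P z → P s)) → ∀ {u} → component es v u ≡ true → P u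
    component-least P v Pv = iter-least P (λ u → u =ᶠ v) n (λ p → subst P (sym (=ᶠ⇒≡ p)) Pv)

    iter-⊇ : ∀ S k {u} → S u ≡ true → iter k F S u ≡ true
    iter-⊇ S zero p = p
    iter-⊇ S (suc k) p = F-⊇ (iter k F S) (iter-⊇ S k p)

    component-self : ∀ v → component es v v ≡ true
    component-self v = iter-⊇ (λ u → u =ᶠ v) n (=ᶠ-refl v)

    size : (Fin n → Bool) → ℕ
    size S = ∑ V (𝟙 ∘ S)

    -- A step that leaves the set unchanged proves it closed, and any other step adds a vertex.
    -- After `n` steps the second alternative would need more than `n` vertices.
    grow : ∀ v k → Closed (iter k F (λ u → u =ᶠ v)) ⊎ suc k ≤ size (iter k F (λ u → u =ᶠ v))
    grow v zero = inj₂ (≤-reflexive (sym (trans (∑-cong V (λ u → δ-sym u v)) (∑-δ-all v))))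
    grow v (suc k) with grow v k
    ... | inj₁ cl = inj₁ (F-closed _ cl)
    ... | inj₂ l with any? (λ u → (F (iter k F (λ u → u =ᶠ v)) u ≟B true) ×-dec (iter k F (λ u → u =ᶠ v) u ≟B false))
    ...   | no none = inj₁ (F-closed S λ m → (λ p → stays (proj₁ (F-edge S m) p)) , (λ p → stays (proj₂ (F-edge S m) p)))
      where
      S = iter k F (λ u → u =ᶠ v)
      stays : ∀ {u} → F S u ≡ true → S u ≡ true
      stays {u} p with bool-cases (S u)
      ... | inj₁ q = q
      ... | inj₂ q = ⊥-elim (none (u , p , q))
    ...   | yes (u , p , q) = inj₂ (≤-trans (s≤s l) (begin
        suc (size S)                       ≡⟨ cong (_+ size S) (∑-δ-all u) ⟨
        ∑ V (δ u) + size S                 ≡⟨ ∑-+ V _ _ ⟨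
        ∑ V (λ w → δ u w + 𝟙 (S w))        ≤⟨ ∑-mono V (λ {w} _ → le w) ⟩
        size (F S)                         ∎))
      where
      open ≤-Reasoning
      S = iter k F (λ u → u =ᶠ v)
      le : ∀ w → δ u w + 𝟙 (S w) ≤ 𝟙 (F S w)
      le w with u ≟F w
      ... | yes refl = ≤-reflexive (trans (cong₂ _+_ (δ-refl u) (cong 𝟙 q)) (cong 𝟙 (sym p)))
      ... | no h with bool-cases (S w)
      ...   | inj₁ r = ≤-reflexive (trans (cong₂ _+_ (δ-≢ h) (cong 𝟙 r)) (cong 𝟙 (sym (F-⊇ S r))))
      ...   | inj₂ r = ≤-trans (≤-reflexive (cong₂ _+_ (δ-≢ h) (cong 𝟙 r))) z≤n

    component-closed : ∀ v → Closed (component es v)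
    component-closed v with grow v n
    ... | inj₁ cl = cl
    ... | inj₂ l = ⊥-elim (<-irrefl refl (≤-trans l (≤-trans (∑-mono V λ {u} _ → 𝟙≤1 _)
                     (≤-reflexive (trans (∑-const V 1) (trans (*-identityʳ _) (length-tabulate (λ x → x))))))))

    component-edge : ∀ {s z} → (s , z) ∈ es → ∀ u → component es s u ≡ component es z u
    component-edge {s} {z} m u = bool-ext
      (component-least (λ u → component es z u ≡ true) s (proj₂ (component-closed z m) (component-self z)) (component-closed z))
      (component-least (λ u → component es s u ≡ true) z (proj₁ (component-closed s m) (component-self s)) (component-closed s))

    cycle-edge : ∀ {s z} → (s , z) ∈ es → inCycleComp es s ≡ inCycleComp es z
    cycle-edge {s} {z} m = bool-ext (go s z (component-edge m)) (go z s (λ u → sym (component-edge m u)))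
      where
      go : ∀ s z → (∀ u → component es s u ≡ component es z u) → inCycleComp es s ≡ true → inCycleComp es z ≡ true
      go s z h p = all⁺ _ V λ {u} _ → subst (λ b → not b ∨ (deg es u ≡ᵇ 2) ≡ true) (h u) (all⁻ (λ u → not (component es s u) ∨ (deg es u ≡ᵇ 2)) p (∈-allFin u))

  -- Suppression of vertices of degree 2

  ends : ∀ {n} → Fin n → Edge n → ℕ
  ends u e = δ (proj₁ e) u + δ (proj₂ e) u

  incident⁻ : ∀ {n} {v : Fin n} {e} → incident v e ≡ true → proj₁ e ≡ v ⊎ proj₂ e ≡ v
  incident⁻ {v = v} {e} p with ∨⁻ {proj₁ e =ᶠ v} p
  ... | inj₁ q = inj₁ (=ᶠ⇒≡ q)
  ... | inj₂ q = inj₂ (=ᶠ⇒≡ q)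

  incident₁ : ∀ {n} (e : Edge n) → incident (proj₁ e) e ≡ true
  incident₁ e = ∨⁺ˡ (=ᶠ-refl (proj₁ e))

  incident₂ : ∀ {n} (e : Edge n) → incident (proj₂ e) e ≡ true
  incident₂ e = ∨⁺ʳ (proj₁ e =ᶠ proj₂ e) (=ᶠ-refl (proj₂ e))

  ends-other : ∀ {n} {v u : Fin n} {e} → incident v e ≡ true → u ≢ v → ends u e ≡ δ (other v e) u
  ends-other {v = v} {u} {s , z} p u≢v with s ≟F v
  ... | yes refl rewrite =ᶠ-refl s = cong (_+ δ z u) (δ-≢ (u≢v ∘ sym))
  ... | no h rewrite ≢⇒=ᶠ h with =ᶠ⇒≡ {i = z} {v} p
  ...   | refl = trans (cong (δ s u +_) (δ-≢ (u≢v ∘ sym))) (+-identityʳ _)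

  ends-pos : ∀ {n} {v : Fin n} {e} → incident v e ≡ true → 1 ≤ ends v e
  ends-pos {v = v} {s , z} p with incident⁻ {v = v} {s , z} p
  ... | inj₁ refl = ≤-trans (≤-reflexive (sym (δ-refl s))) (m≤m+n _ _)
  ... | inj₂ refl = ≤-trans (≤-reflexive (sym (δ-refl z))) (m≤n+m _ (δ s z))

  other-loop : ∀ {n} {v : Fin n} {e} → incident v e ≡ true → other v e ≡ v → 2 ≤ ends v e
  other-loop {v = v} {s , z} p q with s ≟F v
  ... | yes refl rewrite =ᶠ-refl s | q | =ᶠ-refl s = ≤-refl
  ... | no h rewrite ≢⇒=ᶠ h = ⊥-elim (h q)

  loop-of-ends : ∀ {n} {v : Fin n} {e} → 2 ≤ ends v e → e ≡ (v , v)
  loop-of-ends {v = v} {s , z} p with s ≟F v | z ≟F v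
  ... | yes refl | yes refl = refl
  ... | no h | _ rewrite ≢⇒=ᶠ h = ⊥-elim (<⇒≱ p (𝟙≤1 (z =ᶠ v)))
  ... | yes refl | no h rewrite ≢⇒=ᶠ h | +-identityʳ (δ s s) = ⊥-elim (<⇒≱ p (𝟙≤1 (s =ᶠ s)))

  other-end : ∀ {n} {v : Fin n} {e} → incident v e ≡ true → (proj₁ e ≡ v × proj₂ e ≡ other v e) ⊎ (proj₂ e ≡ v × proj₁ e ≡ other v e)
  other-end {v = v} {s , z} p with s ≟F v
  ... | yes refl rewrite =ᶠ-refl s = inj₁ (refl , refl)
  ... | no h rewrite ≢⇒=ᶠ h = inj₂ (=ᶠ⇒≡ p , refl)

  deg-filter : ∀ {n} (u : Fin n) (p : Edge n → Bool) es → deg es u ≡ deg (filterᵇ p es) u + deg (filterᵇ (not ∘ p) es) u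
  deg-filter u p [] = refl
  deg-filter u p (e ∷ es) with p e
  ... | true = trans (cong (ends u e +_) (deg-filter u p es)) (sym (+-assoc (ends u e) _ _))
  ... | false = trans (cong (ends u e +_) (deg-filter u p es)) (q (ends u e) (deg (filterᵇ p es) u) (deg (filterᵇ (not ∘ p) es) u))
    where q : ∀ a b c → a + (b + c) ≡ b + (a + c)
          q = solve-∀

  deg-filter-none : ∀ {n} (v : Fin n) h → deg (filterᵇ (not ∘ incident v) h) v ≡ 0
  deg-filter-none v [] = refl
  deg-filter-none v (e ∷ h) with proj₁ e =ᶠ v in p | proj₂ e =ᶠ v in q
  ... | true | _ = deg-filter-none v h
  ... | false | true = deg-filter-none v h
  ... | false | false rewrite p | q = deg-filter-none v h

  -- A loop is all that suppress can leave at a vertex of degree 2, and through it no other vertex is reached.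
  Isolated : ∀ {n} → List (Edge n) → Fin n → Set
  Isolated h u = ∀ {e} → e ∈ h → incident u e ≡ true → e ≡ (u , u)

  module Suppress {n : ℕ} (v : Fin n) (h : List (Edge n)) where
    f r : List (Edge n)
    f = filterᵇ (incident v) h
    r = filterᵇ (not ∘ incident v) h

    data View : List (Edge n) → Set where
      same : (∀ {e₁ e₂} → f ≢ e₁ ∷ e₂ ∷ []) → View h
      joined : ∀ {e₁ e₂} → f ≡ e₁ ∷ e₂ ∷ [] → View ((other v e₁ , other v e₂) ∷ r)

    view : View (suppress v h)
    view with filterᵇ (incident v) h in eq
    ... | [] = same λ e → case eq e
      where case : ∀ {e₁ e₂} → f ≡ [] → f ≢ e₁ ∷ e₂ ∷ []
            case p q with trans (sym p) q
            ... | ()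
    ... | _ ∷ [] = same λ e → case eq e
      where case : ∀ {x e₁ e₂} → f ≡ x ∷ [] → f ≢ e₁ ∷ e₂ ∷ []
            case p q with trans (sym p) q
            ... | ()
    ... | _ ∷ _ ∷ _ ∷ _ = same λ e → case eq e
      where case : ∀ {x y z w e₁ e₂} → f ≡ x ∷ y ∷ z ∷ w → f ≢ e₁ ∷ e₂ ∷ []
            case p q with trans (sym p) q
            ... | ()
    ... | _ ∷ _ ∷ [] = joined eq

    f⁻ : ∀ {e} → e ∈ f → e ∈ h × incident v e ≡ true
    f⁻ = ∈-filterᵇ⁻ (incident v)

    f⁺ : ∀ {e} → e ∈ h → incident v e ≡ true → e ∈ f
    f⁺ = ∈-filterᵇ⁺ (incident v)

    r⁻ : ∀ {e} → e ∈ r → e ∈ h × incident v e ≡ false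
    r⁻ m = let a , b = ∈-filterᵇ⁻ (not ∘ incident v) {xs = h} m in a , not⁻ b

    deg-f : deg h v ≡ deg f v
    deg-f = trans (deg-filter v (incident v) h) (trans (cong (deg f v +_) (deg-filter-none v h)) (+-identityʳ _))

    deg-other : ∀ {u} → u ≢ v → deg (suppress v h) u ≡ deg h u
    deg-other {u} u≢v = go view
      where
      go : ∀ {h′} → View h′ → deg h′ u ≡ deg h u
      go (same _) = refl
      go (joined {e₁} {e₂} eq) = begin
        (δ (other v e₁) u + δ (other v e₂) u) + deg r u   ≡⟨ cong (_+ deg r u) (cong₂ _+_ (sym (ends-other {e = e₁} (inc (here refl)) u≢v)) (sym (ends-other {e = e₂} (inc (there (here refl))) u≢v))) ⟩
        (ends u e₁ + ends u e₂) + deg r u                 ≡⟨ p (ends u e₁) (ends u e₂) (deg r u) ⟩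
        deg (e₁ ∷ e₂ ∷ []) u + deg r u                    ≡⟨ cong (λ k → deg k u + deg r u) eq ⟨
        deg f u + deg r u                                 ≡⟨ deg-filter u (incident v) h ⟨
        deg h u                                           ∎
        where
        open ≡-Reasoning
        inc : ∀ {e} → e ∈ e₁ ∷ e₂ ∷ [] → incident v e ≡ true
        inc {e} m = proj₂ (f⁻ {e} (subst (e ∈_) (sym eq) m))
        p : ∀ a b c → (a + b) + c ≡ (a + (b + 0)) + c
        p = solve-∀

    away : ∀ {u e} → u ≢ v → Isolated h u → e ∈ f → other v e ≢ u
    away {u} {s , z} u≢v iso m o with f⁻ m
    ... | e∈ , i with other-end {v = v} {s , z} i
    ...   | inj₁ (a , b) with iso e∈ (subst (λ k → incident k (s , z) ≡ true) (trans b o) (incident₂ (s , z)))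
    ...     | refl = u≢v a
    away {u} {s , z} u≢v iso m o | e∈ , i | inj₂ (a , b) with iso e∈ (subst (λ k → incident k (s , z) ≡ true) (trans b o) (incident₁ (s , z)))
    ...     | refl = u≢v a

    isolated-other : ∀ {u} → u ≢ v → Isolated h u → Isolated (suppress v h) u
    isolated-other {u} u≢v iso = go view
      where
      go : ∀ {h′} → View h′ → Isolated h′ u
      go (same _) = iso
      go (joined {e₁} {e₂} eq) (there m) p = iso (proj₁ (r⁻ m)) p
      go (joined {e₁} {e₂} eq) (here refl) p with incident⁻ {v = u} {other v e₁ , other v e₂} p
      ... | inj₁ q = ⊥-elim (away u≢v iso (subst (e₁ ∈_) (sym eq) (here refl)) q)
      ... | inj₂ q = ⊥-elim (away u≢v iso (subst (e₂ ∈_) (sym eq) (there (here refl))) q)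

    -- If the joined edge met `v` again, one of the two old edges would be a loop and `v` would have
    -- degree at least 3. If there are not exactly two incident edges, degree 2 leaves only a single
    -- loop.
    isolated-self : deg h v ≡ 2 ⊎ Isolated h v → Isolated (suppress v h) v
    isolated-self d = go d view
      where
      go : ∀ {h′} → deg h v ≡ 2 ⊎ Isolated h v → View h′ → Isolated h′ v
      go (inj₂ iso) (same _) = iso
      go (inj₂ iso) (joined eq) (there m) p = ⊥-elim (false≢true (proj₂ (r⁻ m)) p)
      go (inj₂ iso) (joined {e₁} {e₂} eq) (here refl) p = cong₂ _,_ (loop (here refl)) (loop (there (here refl)))
        where
        loop : ∀ {e} → e ∈ e₁ ∷ e₂ ∷ [] → other v e ≡ v
        loop {e} m with f⁻ {e} (subst (e ∈_) (sym eq) m)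
        ... | e∈ , i with iso {e} e∈ i
        ...   | refl rewrite =ᶠ-refl v = refl
      go (inj₁ d) (same not-two) {e} m p = loop f not-two (trans (sym deg-f) d) (λ {x} q → proj₂ (f⁻ {x} q)) (f⁺ m p)
        where
        loop : ∀ g → (∀ {e₁ e₂} → g ≢ e₁ ∷ e₂ ∷ []) → deg g v ≡ 2 → (∀ {x} → x ∈ g → incident v x ≡ true) → e ∈ g → e ≡ (v , v)
        loop (x ∷ []) nt d inc (here refl) = loop-of-ends (≤-reflexive (sym (trans (sym (+-identityʳ _)) d)))
        loop (x ∷ y ∷ []) nt d inc m = ⊥-elim (nt refl)
        loop (x ∷ y ∷ z ∷ g) nt d inc m = ⊥-elim (<-irrefl refl (≤-trans (+-mono-≤ (ends-pos {e = x} (inc (here refl)))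
          (+-mono-≤ (ends-pos {e = y} (inc (there (here refl)))) (≤-trans (ends-pos {e = z} (inc (there (there (here refl))))) (m≤m+n _ (deg g v))))) (≤-reflexive d)))
      go (inj₁ d) (joined eq) (there m) p = ⊥-elim (false≢true (proj₂ (r⁻ m)) p)
      go (inj₁ d) (joined {e₁} {e₂} eq) (here refl) p = ⊥-elim (<-irrefl refl (≤-trans (three (incident⁻ {v = v} {other v e₁ , other v e₂} p)) (≤-reflexive total)))
        where
        inc : ∀ {e} → e ∈ e₁ ∷ e₂ ∷ [] → incident v e ≡ true
        inc {e} m = proj₂ (f⁻ {e} (subst (e ∈_) (sym eq) m))
        total : ends v e₁ + ends v e₂ ≡ 2
        total = trans (cong (ends v e₁ +_) (sym (+-identityʳ _))) (trans (cong (λ k → deg k v) (sym eq)) (trans (sym deg-f) d))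
        three : other v e₁ ≡ v ⊎ other v e₂ ≡ v → 3 ≤ ends v e₁ + ends v e₂
        three (inj₁ q) = +-mono-≤ (other-loop {e = e₁} (inc (here refl)) q) (ends-pos {e = e₂} (inc (there (here refl))))
        three (inj₂ q) = +-mono-≤ (ends-pos {e = e₁} (inc (here refl))) (other-loop {e = e₂} (inc (there (here refl))) q)

    conn-suppress : (R : Fin n → Fin n → Set) → (∀ {a b} → R a b → R b a) → (∀ {a b c} → R a b → R b c → R a c)
      → (∀ {e} → e ∈ h → R (proj₁ e) (proj₂ e)) → ∀ {e} → e ∈ suppress v h → R (proj₁ e) (proj₂ e)
    conn-suppress R R-sym R-trans hR = go view
      where
      go : ∀ {h′} → View h′ → ∀ {e} → e ∈ h′ → R (proj₁ e) (proj₂ e)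
      go (same _) m = hR m
      go (joined eq) (there m) = hR (proj₁ (r⁻ m))
      go (joined {e₁} {e₂} eq) (here refl) = R-trans (R-sym (from (here refl))) (from (there (here refl)))
        where
        from : ∀ {e} → e ∈ e₁ ∷ e₂ ∷ [] → R v (other v e)
        from {s , z} m with f⁻ (subst ((s , z) ∈_) (sym eq) m)
        ... | e∈ , i with other-end {v = v} {s , z} i
        ...   | inj₁ (a , b) = subst₂ R a b (hR e∈)
        ...   | inj₂ (a , b) = subst₂ R a b (R-sym (hR e∈))

  module Suppression {n : ℕ} (D : DegSeq n) {es : List (Edge n)} (es∈ : es ∈ realisations D) where
    open Switching D

    A : Fin n → Fin n → Bool
    A = adj es

    conn-sym : ∀ {a b} → Conn A a b → Conn A b a
    conn-sym = reverse (adj-sym es _ _)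

    deg-es : ∀ v → deg es v ≡ D v
    deg-es = proj₂ (real⁻ es∈)

    -- `bounded` lets the degrees in `D` control the number of edges, `finished` keeps vertices of
    -- degree 2 out of the other components, and `connected` leads back to paths in the given graph.
    -- `pending` is what supplies `finished` when the turn of a vertex comes.
    record Inv (done : List (Fin n)) (h : List (Edge n)) : Set where
      field
        bounded : ∀ u → D u ≢ 2 → deg h u ≤ D u
        pending : ∀ u → D u ≡ 2 → deg h u ≡ 2 ⊎ Isolated h u
        finished : ∀ {u} → u ∈ done → D u ≡ 2 → Isolated h u
        connected : ∀ {e} → e ∈ h → Conn A (proj₁ e) (proj₂ e)

    h₀ : List (Edge n)
    h₀ = filterᵇ (λ e → not (inCycleComp es (proj₁ e))) es

    inv₀ : Inv [] h₀
    inv₀ = record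
      { bounded = λ u _ → ≤-trans (≤-trans (m≤m+n _ _) (≤-reflexive (sym (deg-filter u p es)))) (≤-reflexive (deg-es u))
      ; pending = λ u Du → pend u Du (bool-cases (inCycleComp es u))
      ; finished = λ ()
      ; connected = λ m → adj⁺ (proj₁ (∈-filterᵇ⁻ p {xs = es} m)) ◅ ε }
      where
      p : Edge n → Bool
      p e = not (inCycleComp es (proj₁ e))
      side : ∀ {u} {e} → e ∈ es → incident u e ≡ true → inCycleComp es (proj₁ e) ≡ inCycleComp es u
      side {u} {s , z} m i with incident⁻ {v = u} {s , z} i
      ... | inj₁ refl = refl
      ... | inj₂ refl = Component.cycle-edge es m
      no-ends : ∀ {u} {e : Edge n} → incident u e ≡ false → ends u e ≡ 0
      no-ends {u} {s , z} i with s =ᶠ u | z =ᶠ u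
      no-ends {u} {s , z} () | true | _
      no-ends {u} {s , z} () | false | true
      no-ends {u} {s , z} i | false | false = refl
      pend : ∀ u → D u ≡ 2 → inCycleComp es u ≡ true ⊎ inCycleComp es u ≡ false → deg h₀ u ≡ 2 ⊎ Isolated h₀ u
      -- Whole components are deleted, so `u` has lost either all its edges or none.
      pend u Du (inj₁ cyc) = inj₂ λ {e} m i → let a , b = ∈-filterᵇ⁻ p {xs = es} m in ⊥-elim (false≢true (not⁻ b) (trans (side {e = e} a i) cyc))
      pend u Du (inj₂ acyc) = inj₁ (trans (trans (∑-filter p es (ends u)) (∑-cong∈ es keep)) (trans (deg-es u) Du))
        where
        keep : ∀ {e} → e ∈ es → 𝟙 (p e) * ends u e ≡ ends u e
        keep {e} m with bool-cases (incident u e)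
        ... | inj₁ i = trans (cong (λ b → 𝟙 (not b) * ends u e) (trans (side {e = e} m i) acyc)) (+-identityʳ _)
        ... | inj₂ i = trans (cong (𝟙 (p e) *_) (no-ends {e = e} i)) (trans (*-zeroʳ (𝟙 (p e))) (sym (no-ends {e = e} i)))

    sup : Fin n → List (Edge n) → List (Edge n)
    sup v acc = if deg es v ≡ᵇ 2 then suppress v acc else acc

    inv-step : ∀ v {done h} → Inv done h → Inv (v ∷ done) (sup v h)
    inv-step v {done} {h} I with deg es v ≡ᵇ 2 in eq
    ... | false = record { bounded = bounded ; pending = pending ; connected = connected
        ; finished = λ { (here refl) Du → ⊥-elim (false≢true eq (T⇒≡ (≡⇒≡ᵇ _ 2 (trans (deg-es v) Du)))) ; (there m) Du → finished m Du } }
      where open Inv I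
    ... | true = record
        { bounded = λ u Du → ≤-trans (≤-reflexive (S.deg-other λ { refl → Du Dv })) (bounded u Du)
        ; pending = λ u Du → pend u Du
        ; finished = fin
        ; connected = S.conn-suppress (Conn A) conn-sym _◅◅_ connected }
      where
      open Inv I
      module S = Suppress v h
      Dv : D v ≡ 2
      Dv = trans (sym (deg-es v)) (≡ᵇ⇒≡ _ 2 (≡⇒T eq))
      pend : ∀ u → D u ≡ 2 → deg (suppress v h) u ≡ 2 ⊎ Isolated (suppress v h) u
      pend u Du with u ≟F v | pending u Du
      ... | yes refl | d = inj₂ (S.isolated-self d)
      ... | no ne | inj₁ d = inj₁ (trans (S.deg-other ne) d)
      ... | no ne | inj₂ iso = inj₂ (S.isolated-other ne iso)
      fin : ∀ {u} → u ∈ v ∷ done → D u ≡ 2 → Isolated (suppress v h) u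
      fin {u} m Du with u ≟F v
      ... | yes refl = S.isolated-self (pending u Du)
      fin {u} (here e) Du | no ne = ⊥-elim (ne e)
      fin {u} (there m) Du | no ne = S.isolated-other ne (finished m Du)

    inv-fold : ∀ vs → Inv vs (foldr sup h₀ vs)
    inv-fold [] = inv₀
    inv-fold (v ∷ vs) = inv-step v (inv-fold vs)

    -- `W` is the component in the suppressed multigraph. Each edge is charged to its first end, so
    -- the size is at most the degree sum over `W`, and suppression has not raised the degrees of
    -- its vertices.
    big-component : ∀ v → isVertexH es v ≡ true → ∃ λ (W : Fin n → Bool) →
      (∀ {u} → W u ≡ true → D u ≢ 2) × (∀ {u w} → W u ≡ true → W w ≡ true → Conn A u w)
      × compSizeH es v ≤ ∑ V (λ u → 𝟙 (W u) * D u)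
    big-component v vert = W , (λ p → proj₁ (reach p)) , (λ p q → conn-sym (proj₂ (reach p)) ◅◅ proj₂ (reach q)) , size≤
      where
      h = edgesH es
      I : Inv V h
      I = inv-fold V
      open Inv I
      W : Fin n → Bool
      W = component h v
      Dv : D v ≢ 2
      Dv e = false≢true (not⁻ (proj₂ (∧⁻ {not (inCycleComp es v)} vert))) (T⇒≡ (≡⇒≡ᵇ (deg es v) 2 (trans (deg-es v) e)))
      reach : ∀ {u} → W u ≡ true → D u ≢ 2 × Conn A v u
      -- The component never enters a vertex of degree 2: by `finished`, an edge that meets such a
      -- vertex is a loop there.
      reach = Component.component-least h (λ u → D u ≢ 2 × Conn A v u) v (Dv , ε) λ {s} {z} m →
        (λ (Ds , c) → (λ Dz → Ds (trans (cong (D ∘ proj₁) (finished (∈-allFin z) Dz m (incident₂ (s , z)))) Dz)) , c ◅◅ connected m) ,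
        (λ (Dz , c) → (λ Ds → Dz (trans (cong (D ∘ proj₂) (finished (∈-allFin s) Ds m (incident₁ (s , z)))) Ds)) , c ◅◅ conn-sym (connected m))
      size≤ : compSizeH es v ≤ ∑ V (λ u → 𝟙 (W u) * D u)
      size≤ = begin
        length (filterᵇ (λ e → W (proj₁ e)) h)                         ≡⟨ trans (sym (*-identityʳ _)) (sym (∑-const (filterᵇ (λ e → W (proj₁ e)) h) 1)) ⟩
        ∑ (filterᵇ (λ e → W (proj₁ e)) h) (λ _ → 1)                    ≡⟨ ∑-filter (λ e → W (proj₁ e)) h (λ _ → 1) ⟩
        ∑ h (λ e → 𝟙 (W (proj₁ e)) * 1)                                ≡⟨ ∑-cong h (λ e → trans (*-identityʳ _) (sym (∑-δ (proj₁ e) V (𝟙 ∘ W) (allFin⁺ n) (∈-allFin _)))) ⟩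
        ∑ h (λ e → ∑ V (λ u → δ (proj₁ e) u * 𝟙 (W u)))                ≤⟨ ∑-mono h (λ {e} _ → ∑-mono V (λ {u} _ → *-monoˡ-≤ (𝟙 (W u)) (m≤m+n (δ (proj₁ e) u) (δ (proj₂ e) u)))) ⟩
        ∑ h (λ e → ∑ V (λ u → ends u e * 𝟙 (W u)))                     ≡⟨ ∑-swap h V _ ⟩
        ∑ V (λ u → ∑ h (λ e → ends u e * 𝟙 (W u)))                     ≡⟨ ∑-cong V (λ u → trans (∑-*ʳ h (𝟙 (W u)) (ends u)) (*-comm (deg h u) (𝟙 (W u)))) ⟩
        ∑ V (λ u → 𝟙 (W u) * deg h u)                                  ≤⟨ ∑-mono V (λ {u} _ → le u) ⟩
        ∑ V (λ u → 𝟙 (W u) * D u)                                      ∎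
        where
        open ≤-Reasoning
        le : ∀ u → 𝟙 (W u) * deg h u ≤ 𝟙 (W u) * D u
        le u with bool-cases (W u)
        ... | inj₁ p = *-monoʳ-≤ (𝟙 (W u)) (bounded u (proj₁ (reach p)))
        ... | inj₂ p = ≤-trans (≤-reflexive (cong (λ b → 𝟙 b * deg h u) p)) z≤n

  -- The degree sequence

  -- The terms d (d - 2) in the definition of `jD` are -1 at 1 and nonnegative elsewhere. These are
  -- their positive and negative parts.
  gain one : ℕ → ℕ
  gain d = d * (d ∸ 2)
  one d = 𝟙 (d ≡ᵇ 1)

  term-split : ∀ d → (ℤ.+ d) ℤ.* ((ℤ.+ d) ℤ.- (ℤ.+ 2)) ≡ (ℤ.+ gain d) ℤ.- (ℤ.+ one d)
  term-split zero = refl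
  term-split (suc zero) = refl
  term-split (suc (suc d)) = begin
    (ℤ.+ suc (suc d)) ℤ.* ((ℤ.+ suc (suc d)) ℤ.- (ℤ.+ 2))   ≡⟨ cong ((ℤ.+ suc (suc d)) ℤ.*_) (p (ℤ.+ d)) ⟩
    (ℤ.+ suc (suc d)) ℤ.* (ℤ.+ d)                         ≡⟨ ℤP.pos-* (suc (suc d)) d ⟨
    ℤ.+ gain (suc (suc d))                              ≡⟨ ℤP.+-identityʳ _ ⟨
    (ℤ.+ gain (suc (suc d))) ℤ.- (ℤ.+ 0)                  ∎
    where
    open ≡-Reasoning
    p : ∀ x → ((ℤ.+ 2) ℤ.+ x) ℤ.- (ℤ.+ 2) ≡ x
    p = ℤR.solve-∀

  regroup : ∀ p n g o → (p ℤ.- n) ℤ.+ (g ℤ.- o) ≡ (p ℤ.+ g) ℤ.- (n ℤ.+ o)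
  regroup = ℤR.solve-∀

  -- The accumulator is a difference P - N of natural numbers, and no partial sum before the first
  -- positive one exceeds 0. If an index is returned, the entries strictly before it form such a
  -- prefix; otherwise every prefix is one.
  firstPos-prefix : ∀ P N k ds → P ≤ N
    → (firstPos ((ℤ.+ P) ℤ.- (ℤ.+ N)) k ds ≡ nothing → ∀ m → P + ∑ (take m ds) gain ≤ N + ∑ (take m ds) one)
    × (∀ {j} → firstPos ((ℤ.+ P) ℤ.- (ℤ.+ N)) k ds ≡ just j → ∃ λ m → j ≡ suc (k + m) × P + ∑ (take m ds) gain ≤ N + ∑ (take m ds) one)
  firstPos-prefix P N k [] P≤N = (λ _ m → subst (λ l → P + ∑ l gain ≤ N + ∑ l one) (sym (take-[] m)) (+-monoˡ-≤ 0 P≤N)) , λ ()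
    where take-[] : ∀ m → take {A = ℕ} m [] ≡ []
          take-[] zero = refl
          take-[] (suc m) = refl
  firstPos-prefix P N k (d ∷ ds) P≤N rewrite term-split d with (ℤ.+ 0) ℤP.<? (((ℤ.+ P) ℤ.- (ℤ.+ N)) ℤ.+ ((ℤ.+ gain d) ℤ.- (ℤ.+ one d)))
  ... | yes _ = (λ ()) , λ { refl → 0 , cong suc (sym (+-identityʳ k)) , +-monoˡ-≤ 0 P≤N }
  ... | no ¬pos rewrite regroup (ℤ.+ P) (ℤ.+ N) (ℤ.+ gain d) (ℤ.+ one d) =
    let IH = firstPos-prefix (P + gain d) (N + one d) (suc k) ds P′≤N′ in
    (λ e → λ { zero → +-monoˡ-≤ 0 P≤N ; (suc m) → shift m (proj₁ IH e m) }) ,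
    (λ e → let m , j≡ , le = proj₂ IH e in suc m , trans j≡ (cong suc (sym (+-suc k m))) , shift m le)
    where
    P′≤N′ : P + gain d ≤ N + one d
    P′≤N′ = ℤP.drop‿+≤+ (ℤP.i-j≤0⇒i≤j (ℤP.≮⇒≥ ¬pos))
    shift : ∀ m → (P + gain d) + ∑ (take m ds) gain ≤ (N + one d) + ∑ (take m ds) one → P + (gain d + ∑ (take m ds) gain) ≤ N + (one d + ∑ (take m ds) one)
    shift m h = subst₂ _≤_ (+-assoc P _ _) (+-assoc N _ _) h

  module Degrees {n : ℕ} (D : DegSeq n) (t : ℕ) where
    open Count D t
    private
      V = allFin n

    pre suf : List ℕ
    pre = take (jD D ∸ 1) (sortedD D)
    suf = drop (jD D ∸ 1) (sortedD D)

    ∑-sorted : ∀ (f : ℕ → ℕ) → ∑ V (f ∘ D) ≡ ∑ pre f + ∑ suf f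
    ∑-sorted f = begin
      ∑ V (f ∘ D)                 ≡⟨ ∑-map D V f ⟨
      ∑ (toListD D) f             ≡⟨ sum-↭ (↭.map⁺ f (Sort.sort-↭ ≤-decTotalOrder (toListD D))) ⟨
      ∑ (sortedD D) f             ≡⟨ cong (λ l → ∑ l f) (take++drop≡id (jD D ∸ 1) (sortedD D)) ⟨
      ∑ (pre ++ suf) f            ≡⟨ ∑-++ pre suf f ⟩
      ∑ pre f + ∑ suf f           ∎
      where open ≡-Reasoning

    RD≡ : RD D ≡ ∑ suf id
    RD≡ = cong sum (sym (map-id suf))

    MD≡M : MD D ≡ M
    MD≡M = begin
      sum (filterᵇ (λ d → not (d ≡ᵇ 2)) (toListD D))         ≡⟨ cong sum (map-id (filterᵇ (λ d → not (d ≡ᵇ 2)) (toListD D))) ⟨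
      ∑ (filterᵇ (λ d → not (d ≡ᵇ 2)) (toListD D)) id        ≡⟨ ∑-filter (λ d → not (d ≡ᵇ 2)) (toListD D) id ⟩
      ∑ (toListD D) (λ d → 𝟙 (not (d ≡ᵇ 2)) * d)             ≡⟨ ∑-map D V _ ⟩
      M                                                      ∎
      where open ≡-Reasoning

    pre-gain : ∑ pre gain ≤ ∑ pre one
    pre-gain = go (firstPos (ℤ.+ 0) 0 (sortedD D)) refl
      where
      l = sortedD D
      prefix = firstPos-prefix 0 0 0 l z≤n
      go : ∀ r → firstPos (ℤ.+ 0) 0 l ≡ r → ∑ (take (maybe′ (λ j → j) n r ∸ 1) l) gain ≤ ∑ (take (maybe′ (λ j → j) n r ∸ 1) l) one
      go nothing e = proj₁ prefix e (n ∸ 1)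
      go (just j) e with proj₂ prefix e
      ... | m , refl , le = le

    m : ℕ → ℕ
    m d = 𝟙 (not (d ≡ᵇ 2)) * d

    M-split : M ≡ ∑ pre m + ∑ suf m
    M-split = ∑-sorted m

    one≤m : ∀ d → one d ≤ m d
    one≤m zero = z≤n
    one≤m (suc zero) = ≤-refl
    one≤m (suc (suc d)) = z≤n

    -- Before `jD` the gains amount to at most the number of ones, hence to at most `M`, and a
    -- degree above s + 1 satisfies d - 2 ≥ s. The entries from `jD` on have sum `RD D`.
    Big-bound : ∀ s → s * Big (suc s) ≤ s * RD D + M
    Big-bound s = begin
      s * Big (suc s)                                  ≡⟨ cong (s *_) (∑-sorted big) ⟩
      s * (∑ pre big + ∑ suf big)                      ≡⟨ trans (*-distribˡ-+ s (∑ pre big) (∑ suf big)) (+-comm (s * ∑ pre big) (s * ∑ suf big)) ⟩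
      s * ∑ suf big + s * ∑ pre big                    ≤⟨ +-mono-≤ (*-monoʳ-≤ s (∑-mono suf (λ {d} _ → ≤-trans (*-monoˡ-≤ d (𝟙≤1 (suc s <ᵇ d))) (≤-reflexive (*-identityˡ d))))) pre-part ⟩
      s * ∑ suf id + M                                 ≡⟨ cong (λ r → s * r + M) RD≡ ⟨
      s * RD D + M                                     ∎
      where
      open ≤-Reasoning
      big : ℕ → ℕ
      big d = 𝟙 (suc s <ᵇ d) * d
      le : ∀ d → s * big d ≤ gain d
      le d with suc s <ᵇ d in eq
      ... | false = ≤-trans (≤-reflexive (*-zeroʳ s)) z≤n
      ... | true = ≤-trans (≤-reflexive (trans (cong (s *_) (*-identityˡ d)) (*-comm s d)))
                     (*-monoʳ-≤ d (∸-monoˡ-≤ 2 (<ᵇ⇒< (suc s) d (≡⇒T eq))))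
      pre-part : s * ∑ pre big ≤ M
      pre-part = begin
        s * ∑ pre big            ≡⟨ ∑-*ˡ pre s big ⟨
        ∑ pre (λ d → s * big d)  ≤⟨ ∑-mono pre (λ {d} _ → le d) ⟩
        ∑ pre gain               ≤⟨ pre-gain ⟩
        ∑ pre one                ≤⟨ ∑-mono pre (λ {d} _ → one≤m d) ⟩
        ∑ pre m                  ≤⟨ m≤m+n _ _ ⟩
        ∑ pre m + ∑ suf m        ≡⟨ M-split ⟨
        M                        ∎

    -- Write d (d - 1) as d (d - 2) + d. Before `jD` the first parts have a sum of at most 0, and
    -- the second parts, over degrees other than 2, at most `M`. From `jD` on the factor d - 1 is at
    -- most `t` wherever `small` does not vanish.
    Q-bound : Q ≤ M + t * RD D
    Q-bound = begin
      Q                            ≡⟨ ∑-sorted q ⟩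
      ∑ pre q + ∑ suf q            ≤⟨ +-mono-≤ pre-part (≤-trans (∑-mono suf (λ {d} _ → suf-le d)) (≤-reflexive (trans (∑-*ˡ suf t id) (cong (t *_) (sym RD≡))))) ⟩
      M + t * RD D                 ∎
      where
      open ≤-Reasoning
      q : ℕ → ℕ
      q d = ((𝟙 (not (t <ᵇ d)) * 𝟙 (not (d ≡ᵇ 2))) * (d ∸ 1)) * d
      suf-le : ∀ d → q d ≤ t * d
      suf-le d with t <ᵇ d in eq
      ... | true = z≤n
      ... | false = *-monoˡ-≤ d (≤-trans (*-monoˡ-≤ (d ∸ 1) (*-monoʳ-≤ 1 (𝟙≤1 (not (d ≡ᵇ 2))))) (≤-trans (≤-reflexive (*-identityˡ _))
                      (≤-trans (m∸n≤m d 1) (≮⇒≥ λ b → false≢true eq (T⇒≡ (<⇒<ᵇ b))))))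
      pre-le : ∀ d → q d + one d ≤ gain d + m d
      pre-le zero = ≤-reflexive (cong (_+ 0) (*-zeroʳ ((𝟙 (not (t <ᵇ 0)) * 1) * 0)))
      pre-le (suc zero) rewrite *-zeroʳ (𝟙 (not (t <ᵇ 1)) * 1) = ≤-refl
      pre-le (suc (suc zero)) rewrite *-zeroʳ (𝟙 (not (t <ᵇ 2))) = z≤n
      pre-le (suc (suc (suc d))) = ≤-trans (≤-reflexive (+-identityʳ _)) (≤-trans (*-monoˡ-≤ (3 + d) (*-monoˡ-≤ (2 + d) (*-monoˡ-≤ 1 (𝟙≤1 (not (t <ᵇ (3 + d)))))))
        (≤-reflexive (p d)))
        where p : ∀ d → ((1 * 1) * (2 + d)) * (3 + d) ≡ (3 + d) * (1 + d) + 1 * (3 + d)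
              p = solve-∀
      pre-part : ∑ pre q ≤ M
      pre-part = ≤-trans (+-cancelʳ-≤ (∑ pre one) _ _ (begin
        ∑ pre q + ∑ pre one              ≡⟨ ∑-+ pre q one ⟨
        ∑ pre (λ d → q d + one d)        ≤⟨ ∑-mono pre (λ {d} _ → pre-le d) ⟩
        ∑ pre (λ d → gain d + m d)       ≡⟨ ∑-+ pre gain m ⟩
        ∑ pre gain + ∑ pre m             ≤⟨ +-monoˡ-≤ _ pre-gain ⟩
        ∑ pre one + ∑ pre m              ≡⟨ +-comm (∑ pre one) _ ⟩
        ∑ pre m + ∑ pre one              ∎)) (≤-trans (m≤m+n _ _) (≤-reflexive (sym M-split)))

open import Data.Bool using (Bool; true; _∧_)
open import Data.Bool.ListAction using (any)
open import Data.Empty using (⊥-elim)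
open import Data.Integer as ℤ using (+_; -[1+_])
import Data.Integer.Properties as ℤP
open import Data.List using (List; allFin)
open import Data.List.Membership.Propositional using (_∈_)
open import Data.Nat using (zero; suc; z≤n; s≤s; _+_) renaming (_*_ to _·_; _≤_ to _≤ₙ_; _<_ to _<ₙ_)
import Data.Nat.Properties as ℕP
open import Data.Nat.Tactic.RingSolver using (solve-∀)
open import Data.Product using (_,_; proj₁; proj₂; map₂)
open import Data.Rational using (ℚ; 0ℚ; _<_; _≤_; _*_; ∣_∣)
open import Data.Rational as ℚ using (mkℚ; toℚᵘ; _/_; *≤*; *<*; ↧ₙ_)
import Data.Rational.Properties as ℚP
open import Data.Rational.Unnormalised as ℚᵘ using (mkℚᵘ)
import Data.Rational.Unnormalised.Properties as ℚᵘP
open import Function using (_∘_)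
open import Relation.Binary.PropositionalEquality
open import Relation.Nullary using (yes; no)

open Counting

-- From natural numbers to rationals

toℚᵘ-ℕ : ∀ m → toℚᵘ (ℕtoℚ m) ℚᵘ.≃ mkℚᵘ (+ m) 0
toℚᵘ-ℕ m = ℚP.toℚᵘ-fromℚᵘ (mkℚᵘ (+ m) 0)

toℚᵘ-scale : ∀ a m → toℚᵘ (a * ℕtoℚ m) ℚᵘ.≃ toℚᵘ a ℚᵘ.* mkℚᵘ (+ m) 0
toℚᵘ-scale a m = ℚᵘP.≃-trans (ℚP.toℚᵘ-homo-* a (ℕtoℚ m)) (ℚᵘP.*-congˡ {toℚᵘ a} (toℚᵘ-ℕ m))

-- The numerator of a positive rational is at least 1, so the reciprocal of its denominator bounds
-- it from below.
scale-≤⇒ : ∀ a m c → 0ℚ < a → a * ℕtoℚ m ≤ ℕtoℚ c → m ℕ.≤ ↧ₙ a ℕ.* c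
scale-≤⇒ (mkℚ -[1+ p ] d _) m c (*<* ()) _
scale-≤⇒ (mkℚ (+ zero) d _) m c (*<* (ℤ.+<+ ())) _
scale-≤⇒ a@(mkℚ (+ suc p) d _) m c _ h = begin
  m                                ≤⟨ ℕP.m≤m+n m (p ℕ.* m) ⟩
  suc p ℕ.* m                      ≡⟨ ℕP.*-identityʳ _ ⟨
  suc p ℕ.* m ℕ.* 1                ≤⟨ ℤP.drop‿+≤+ (subst₂ ℤ._≤_ lhs rhs (ℚᵘP.drop-*≤* le)) ⟩
  c ℕ.* (suc d ℕ.* 1)              ≡⟨ trans (cong (c ℕ.*_) (ℕP.*-identityʳ (suc d))) (ℕP.*-comm c (suc d)) ⟩
  suc d ℕ.* c                      ∎
  where
  open ℕP.≤-Reasoning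
  le : toℚᵘ a ℚᵘ.* mkℚᵘ (+ m) 0 ℚᵘ.≤ mkℚᵘ (+ c) 0
  le = ℚᵘP.≤-respʳ-≃ (toℚᵘ-ℕ c) (ℚᵘP.≤-respˡ-≃ (toℚᵘ-scale a m) (ℚP.toℚᵘ-mono-≤ h))
  lhs : ((+ suc p) ℤ.* (+ m)) ℤ.* (+ 1) ≡ + (suc p ℕ.* m ℕ.* 1)
  lhs = trans (cong (ℤ._* (+ 1)) (sym (ℤP.pos-* (suc p) m))) (sym (ℤP.pos-* (suc p ℕ.* m) 1))
  rhs : (+ c) ℤ.* (+ (suc d ℕ.* 1)) ≡ + (c ℕ.* (suc d ℕ.* 1))
  rhs = sym (ℤP.pos-* c (suc d ℕ.* 1))

<⇒<-scale : ∀ a b m → 0ℚ < a → ↧ₙ a ℕ.* b ℕ.< m → ℕtoℚ b < a * ℕtoℚ m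
<⇒<-scale (mkℚ -[1+ p ] d _) b m (*<* ()) _
<⇒<-scale (mkℚ (+ zero) d _) b m (*<* (ℤ.+<+ ())) _
<⇒<-scale a@(mkℚ (+ suc p) d _) b m _ h = ℚP.toℚᵘ-cancel-<
  (ℚᵘP.<-respʳ-≃ (ℚᵘP.≃-sym (toℚᵘ-scale a m)) (ℚᵘP.<-respˡ-≃ (ℚᵘP.≃-sym (toℚᵘ-ℕ b)) (ℚᵘ.*<* (subst₂ ℤ._<_ (sym lhs) (sym rhs) (ℤ.+<+ lt)))))
  where
  open ℕP.≤-Reasoning
  lhs : (+ b) ℤ.* (+ (suc d ℕ.* 1)) ≡ + (b ℕ.* (suc d ℕ.* 1))
  lhs = sym (ℤP.pos-* b (suc d ℕ.* 1))
  rhs : ((+ suc p) ℤ.* (+ m)) ℤ.* (+ 1) ≡ + (suc p ℕ.* m ℕ.* 1)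
  rhs = trans (cong (ℤ._* (+ 1)) (sym (ℤP.pos-* (suc p) m))) (sym (ℤP.pos-* (suc p ℕ.* m) 1))
  lt : b ℕ.* (suc d ℕ.* 1) ℕ.< suc p ℕ.* m ℕ.* 1
  lt = begin-strict
    b ℕ.* (suc d ℕ.* 1)   ≡⟨ trans (cong (b ℕ.*_) (ℕP.*-identityʳ (suc d))) (ℕP.*-comm b (suc d)) ⟩
    suc d ℕ.* b           <⟨ h ⟩
    m                     ≤⟨ ℕP.m≤m+n m (p ℕ.* m) ⟩
    suc p ℕ.* m           ≡⟨ ℕP.*-identityʳ _ ⟨
    suc p ℕ.* m ℕ.* 1     ∎

p≤∣p∣ : ∀ p → p ≤ ∣ p ∣
p≤∣p∣ (mkℚ (+ _) _ _) = ℚP.≤-refl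
p≤∣p∣ (mkℚ -[1+ _ ] _ _) = *≤* ℤ.-≤+

unit : ℕ → ℚ
unit l = (+ 1) / suc l

unit-pos : ∀ l → 0ℚ < unit l
unit-pos l = ℚP.positive⁻¹ (unit l) {{ℚP.normalize-pos 1 (suc l)}}

small-scale : ∀ l a r m → ∣ a ∣ < unit l → ℕtoℚ r ≤ a * ℕtoℚ m → suc l ℕ.* r ℕ.≤ m
small-scale l a r m a<l h = begin
  suc l ℕ.* r              ≡⟨ trans (ℕP.*-comm (suc l) r) (cong (r ℕ.*_) (sym (ℕP.*-identityʳ (suc l)))) ⟩
  r ℕ.* (suc l ℕ.* 1)      ≤⟨ ℤP.drop‿+≤+ (subst₂ ℤ._≤_ (sym (ℤP.pos-* r (suc l ℕ.* 1))) rhs (ℚᵘP.drop-*≤* le)) ⟩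
  1 ℕ.* m ℕ.* 1            ≡⟨ trans (ℕP.*-identityʳ _) (ℕP.*-identityˡ m) ⟩
  m                        ∎
  where
  open ℕP.≤-Reasoning
  h′ : ℕtoℚ r ≤ unit l * ℕtoℚ m
  h′ = ℚP.≤-trans h (ℚP.*-monoʳ-≤-nonNeg (ℕtoℚ m) {{ℚP.normalize-nonNeg m 1}} (ℚP.≤-trans (p≤∣p∣ a) (ℚP.<⇒≤ a<l)))
  le : mkℚᵘ (+ r) 0 ℚᵘ.≤ mkℚᵘ (+ 1) l ℚᵘ.* mkℚᵘ (+ m) 0
  le = ℚᵘP.≤-respʳ-≃ (ℚᵘP.≃-trans (toℚᵘ-scale (unit l) m) (ℚᵘP.*-congʳ {mkℚᵘ (+ m) 0} (ℚP.toℚᵘ-fromℚᵘ (mkℚᵘ (+ 1) l))))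
         (ℚᵘP.≤-respˡ-≃ (toℚᵘ-ℕ r) (ℚP.toℚᵘ-mono-≤ h′))
  rhs : ((+ 1) ℤ.* (+ m)) ℤ.* (+ 1) ≡ + (1 ℕ.* m ℕ.* 1)
  rhs = trans (cong (ℤ._* (+ 1)) (sym (ℤP.pos-* 1 m))) (sym (ℤP.pos-* (1 ℕ.* m) 1))

-- Choice of constants and conclusion

-- P = 2 H² and K = 4 H² with H = 8gh are forced by the telescoped recursion; 24 and 72 make the contributions of the
-- degrees above t and above t₂ to P * w at most M / 8 each, up to multiples of the sum R of the exceptional degrees.
module Constants (g h P K s s₂ : ℕ) (1≤g : 1 ≤ₙ g) (1≤h : 1 ≤ₙ h)
  (P≡ : P ≡ 2 · (8 · (g · h) · (8 · (g · h)))) (K≡ : K ≡ 4 · (8 · (g · h) · (8 · (g · h))))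
  (s≡ : s ≡ 24 · P) (s₂≡ : s₂ ≡ 72 · (P · suc s)) where

  t t₂ : ℕ
  t = suc s
  t₂ = suc s₂

  -- A copy of `cap` outside the scope of any degree sequence, so that `M₀` can be chosen before
  -- `D`.
  capped : ℕ → ℕ
  capped zero = 1
  capped (suc k) = 1 + t · capped k

  -- `base` is the part of `loss` without the degrees above `t₂`. The first summand of `M₀` makes it
  -- negligible, and the second lifts a component of size M / g above the threshold of `spread`. `L`
  -- collects the multiples of R that arise in the bound for 8 P w.
  base M₀ L : ℕ
  base = t₂ · (1 + t) + (t₂ · (1 + t₂) + (t₂ · (t · capped K) + t · capped K))
  M₀ = 24 · (P · t) · base + suc (g · (t · (1 + t · capped K)))
  L = 72 · (P · t) + 24 · P + 16 · (P · t)

  2≤t : 2 ≤ₙ t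
  2≤t = s≤s (subst (1 ≤ₙ_) (sym s≡) (ℕP.*-mono-≤ {1} {24} {1} {P} (s≤s z≤n)
    (subst (1 ≤ₙ_) (sym P≡) (ℕP.*-mono-≤ {1} {2} (s≤s z≤n) (ℕP.*-mono-≤ 1≤H 1≤H)))))
    where
    1≤H : 1 ≤ₙ 8 · (g · h)
    1≤H = ℕP.*-mono-≤ {1} {8} (s≤s z≤n) (ℕP.*-mono-≤ 1≤g 1≤h)

  module _ {n : ℕ} (D : DegSeq n) where
    open Count D t using (M; Big; X; Bᵏ)

    capped≡ : ∀ k → capped k ≡ Explore.cap D t k
    capped≡ zero = refl
    capped≡ (suc k) = cong (λ c → 1 + t · c) (capped≡ k)

    few : M₀ ≤ₙ M → L · RD D ≤ₙ M → (bad : List (Edge n) → Bool)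
      → (∀ {G} → G ∈ realisations D → bad G ≡ true → ∃ λ v → isVertexH G v ≡ true × M ≤ₙ g · compSizeH G v)
      → 2 · (h · ∑ (realisations D) (𝟙 ∘ bad)) ≤ₙ length (realisations D)
    few M₀≤M LR≤M bad bad⇒ = Dec.Small.few-bad (Degrees.Q-bound D t) g h 1≤g 1≤h K≡ (subst (λ p → p · Dec.w ≤ₙ M) P≡ small-w) 1≤M bad big
      where
      open ℕP.≤-Reasoning
      module Dec = Decay D t 2≤t t₂ (t · RD D) K
      threshold<M : g · Spread.threshold D t 2≤t K <ₙ M
      threshold<M = subst (λ c → g · (t · (1 + t · c)) <ₙ M) (capped≡ K) (ℕP.≤-trans (ℕP.m≤n+m _ (24 · (P · t) · base)) M₀≤M)
      1≤M : 1 ≤ₙ M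
      1≤M = ℕP.≤-trans (s≤s z≤n) threshold<M
      base≤ : 24 · (P · t) · base ≤ₙ M
      base≤ = ℕP.≤-trans (ℕP.m≤m+n _ _) M₀≤M
      B B₂ R C : ℕ
      B = Big t
      B₂ = Big t₂
      R = RD D
      C = capped K
      w-eq : Dec.w ≡ 3 · (t · (t₂ · (1 + t) + (t₂ · (1 + t₂) + (t₂ · (t · C) + (t · C + (B₂ + (B₂ + B₂)))))) + B) + 2 · (t · R)
      w-eq = cong (λ c → 3 · (t · (t₂ · (1 + t) + (t₂ · (1 + t₂) + (t₂ · (t · c) + (t · c + (B₂ + (B₂ + B₂)))))) + B) + 2 · (t · R)) (sym (capped≡ K))
      poly : ∀ p t a b c e B B₂ R → 8 · (p · (3 · (t · (a + (b + (c + (e + (B₂ + (B₂ + B₂)))))) + B) + 2 · (t · R)))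
        ≡ 24 · (p · t) · (a + (b + (c + e))) + (72 · (p · t) · B₂ + (24 · p · B + 16 · (p · t) · R))
      poly = solve-∀
      collect : ∀ p t R m → m + ((72 · (p · t) · R + m) + ((24 · p · R + m) + 16 · (p · t) · R)) ≡ (72 · (p · t) + 24 · p + 16 · (p · t)) · R + 3 · m
      collect = solve-∀
      big₁ : 24 · P · B ≤ₙ 24 · P · R + M
      big₁ = subst (λ c → c · B ≤ₙ c · R + M) s≡ (Degrees.Big-bound D t s)
      big₂ : 72 · (P · t) · B₂ ≤ₙ 72 · (P · t) · R + M
      big₂ = subst (λ c → c · B₂ ≤ₙ c · R + M) s₂≡ (Degrees.Big-bound D t s₂)
      small-w : P · Dec.w ≤ₙ M
      small-w = ℕP.*-cancelˡ-≤ 8 (begin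
        8 · (P · Dec.w)     ≡⟨ trans (cong (λ z → 8 · (P · z)) w-eq) (poly P t (t₂ · (1 + t)) (t₂ · (1 + t₂)) (t₂ · (t · C)) (t · C) B B₂ R) ⟩
        24 · (P · t) · base + (72 · (P · t) · B₂ + (24 · P · B + 16 · (P · t) · R))
          ≤⟨ ℕP.+-mono-≤ base≤ (ℕP.+-mono-≤ big₂ (ℕP.+-monoˡ-≤ (16 · (P · t) · R) big₁)) ⟩
        M + ((72 · (P · t) · R + M) + ((24 · P · R + M) + 16 · (P · t) · R))   ≡⟨ collect P t R M ⟩
        L · R + 3 · M       ≤⟨ ℕP.+-monoˡ-≤ (3 · M) LR≤M ⟩
        4 · M               ≤⟨ ℕP.*-monoˡ-≤ M (ℕP.m≤m+n 4 4) ⟩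
        8 · M               ∎)
      big : ∀ {G} → G ∈ realisations D → bad G ≡ true → M ≤ₙ g · (X (Switching.adj D G) K + Bᵏ (Switching.adj D G) K + B)
      big {G} m p with bad⇒ m p
      ... | v , vert , M≤ with Suppression.big-component D m v vert
      ...   | W , W≢2 , W-conn , size≤ with Spread.threshold D t 2≤t K ℕ.<? ∑ (allFin n) (λ u → 𝟙 (W u) · D u)
      ...     | yes lt = ℕP.≤-trans M≤ (ℕP.*-monoʳ-≤ g (ℕP.≤-trans size≤ (Spread.spread D t 2≤t K m W W≢2 W-conn lt)))
      ...     | no ¬lt = ⊥-elim (ℕP.<⇒≱ threshold<M (ℕP.≤-trans M≤ (ℕP.*-monoʳ-≤ g (ℕP.≤-trans size≤ (ℕP.≮⇒≥ ¬lt)))))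

any-∧⁻ : ∀ {A : Set} (p q : A → Bool) xs → any (λ x → p x ∧ q x) xs ≡ true → ∃ λ x → p x ≡ true × q x ≡ true
any-∧⁻ p q xs e with any⁻ (λ x → p x ∧ q x) xs e
... | x , _ , r = x , ∧⁻ {p x} r

≤ᵇ⇒≤ : ∀ p q → (p ℚ.≤ᵇ q) ≡ true → p ≤ q
≤ᵇ⇒≤ p q e = ℚP.≤ᵇ⇒≤ {p} {q} (≡⇒T e)

hasBigComp⁻ : ∀ {n} γ m (es : List (Edge n)) → hasBigComp γ m es ≡ true
  → ∃ λ v → isVertexH es v ≡ true × γ * ℕtoℚ m ≤ ℕtoℚ (compSizeH es v)
hasBigComp⁻ {n} γ m es p = map₂ (λ {v} → map₂ (≤ᵇ⇒≤ (γ * ℕtoℚ m) (ℕtoℚ (compSizeH es v))))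
  (any-∧⁻ (isVertexH es) (λ v → (γ * ℕtoℚ m) ℚ.≤ᵇ ℕtoℚ (compSizeH es v)) (allFin n) p)

badCount≡ : ∀ {n} γ (D : DegSeq n) → ∑ (realisations D) (λ G → 𝟙 (hasBigComp γ (MD D) G)) ≡ badCount γ D
badCount≡ γ D = ∑-count (hasBigComp γ (MD D)) (realisations D)

abstract
  -- `M₀` and `L` are chosen before `n` and `D`, which is the uniformity of the theorem. The
  -- denominator of `γ` serves as `g`.
  uniform-bound : ∀ γ h → 0ℚ < γ → 1 ≤ₙ h → ∃ λ M₀ → ∃ λ L → ∀ {n} (D : DegSeq n) → M₀ ≤ₙ MD D → L · RD D ≤ₙ MD D
    → 2 · (h · badCount γ D) ≤ₙ length (realisations D)
  uniform-bound γ h 0<γ 1≤h = choose (↧ₙ γ) (s≤s z≤n)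
    (λ D G p → map₂ (λ {v} → map₂ (scale-≤⇒ γ (MD D) (compSizeH G v) 0<γ)) (hasBigComp⁻ γ (MD D) G p)) _ _ _ _ refl refl refl refl
    where
    choose : ∀ g → 1 ≤ₙ g → (∀ {n} (D : DegSeq n) (G : List (Edge n)) → hasBigComp γ (MD D) G ≡ true → ∃ λ v → isVertexH G v ≡ true × MD D ≤ₙ g · compSizeH G v)
      → ∀ P K s s₂ → P ≡ 2 · (8 · (g · h) · (8 · (g · h))) → K ≡ 4 · (8 · (g · h) · (8 · (g · h))) → s ≡ 24 · P → s₂ ≡ 72 · (P · suc s)
      → ∃ λ M₀ → ∃ λ L → ∀ {n} (D : DegSeq n) → M₀ ≤ₙ MD D → L · RD D ≤ₙ MD D → 2 · (h · badCount γ D) ≤ₙ length (realisations D)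
    choose g 1≤g big P K s s₂ P≡ K≡ s≡ s₂≡ = C.M₀ , C.L , λ D M₀≤ LR≤ →
      subst (λ b → 2 · (h · b) ≤ₙ length (realisations D)) (badCount≡ γ D)
        (C.few D (subst (C.M₀ ≤ₙ_) (M≡ D) M₀≤) (subst (C.L · RD D ≤ₙ_) (M≡ D) LR≤) (hasBigComp γ (MD D))
          λ {G} _ p → map₂ (λ {v} → map₂ (subst (_≤ₙ g · compSizeH G v) (M≡ D))) (big D G p))
      where
      module C = Constants g h P K s s₂ 1≤g 1≤h P≡ K≡ s≡ s₂≡
      M≡ : ∀ {n} (D : DegSeq n) → MD D ≡ Count.M D C.t
      M≡ D = Degrees.MD≡M D C.t

-- For positive `b` the factor 2 yields strictness; for b = 0 it comes from 0 < m, that is, from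
-- feasibility.
half-below : ∀ ε b m → 0ℚ < ε → 0 <ₙ m → 2 · (↧ₙ ε · b) ≤ₙ m → ℕtoℚ b < ε * ℕtoℚ m
half-below ε b m 0<ε 0<m h = <⇒<-scale ε b m 0<ε (strict (↧ₙ ε · b) h)
  where
  strict : ∀ c → 2 · c ≤ₙ m → c <ₙ m
  strict zero _ = 0<m
  strict (suc c) le = ℕP.≤-trans (ℕP.+-monoʳ-≤ 1 (ℕP.≤-trans (ℕP.≤-reflexive (sym (ℕP.+-identityʳ (suc c)))) (ℕP.m≤n+m (suc c + 0) c))) le

theorem8 : (lam : ℕ → ℕ) → (∀ K → ∃ λ N → ∀ n → N ℕ.≤ n → K ℕ.≤ lam n)
    → (δ : ℕ → ℚ) → (∀ ε → 0ℚ < ε → ∃ λ N → ∀ n → N ℕ.≤ n → ∣ δ n ∣ < ε)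
    → (γ : ℚ) → 0ℚ < γ
    → ∀ ε → 0ℚ < ε → ∃ λ N → ∀ n → N ℕ.≤ n → (D : DegSeq n)
    → Positive D → Feasible D → WellBehaved lam D
    → ℕtoℚ (RD D) ≤ δ n * ℕtoℚ (MD D)
    → ℕtoℚ (badCount γ D) < ε * ℕtoℚ (length (realisations D))
theorem8 lam lam→∞ δ δ→0 γ 0<γ ε 0<ε = proj₁ M-large ℕ.⊔ proj₁ δ-small , λ n N≤n D _ feasible well R≤ →
  half-below ε (badCount γ D) (length (realisations D)) 0<ε feasible
    (proj₂ (proj₂ bound) D
      (ℕP.≤-trans (proj₂ M-large n (ℕP.≤-trans (ℕP.m≤m⊔n (proj₁ M-large) (proj₁ δ-small)) N≤n)) well)
      (ℕP.≤-trans (ℕP.*-monoˡ-≤ (RD D) (ℕP.n≤1+n L))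
        (small-scale L (δ n) (RD D) (MD D) (proj₂ δ-small n (ℕP.≤-trans (ℕP.m≤n⊔m (proj₁ M-large) (proj₁ δ-small)) N≤n)) R≤)))
  where
  bound = uniform-bound γ (↧ₙ ε) 0<γ (s≤s z≤n)
  L = proj₁ (proj₂ bound)
  M-large = lam→∞ (proj₁ bound)
  -- The bound 1 / (L + 1) avoids a separate case L = 0; the resulting multiple L + 1 of R dominates
  -- the multiple L.
  δ-small = δ→0 (unit L) (unit-pos L)
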